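{- There is an absolute constant $C$ such that the following holds. Let $G$ be a caterpillar graph on $n$ vertices and let $\ell$ be an integer with $n/2 + C \le \ell \le n$. If $H$ is any graph with $\mathcal{D}_\ell(H) = \mathcal{D}_\ell(G)$, then $H \cong G$. (That is, every caterpillar on $n$ vertices can be reconstructed from its $(n/2+O(1))$-deck.)
   Context: All graphs are finite and simple. For a graph $G$ and an integer $\ell$, the $\ell$-deck $\mathcal{D}_\ell(G)$ is the multiset of isomorphism classes of the induced subgraphs $G[U]$, where $U$ ranges over all $\ell$-element subsets of $V(G)$. A caterpillar graph is a tree such that removing all its leaves (vertices of degree $1$) results in a path. -}

module Defs where

open import Data.Nat using (ℕ; zero; suc; _+_; _≤_)
open import Data.Bool using (Bool; true; false; if_then_else_)
open import Data.Fin using (Fin; zero; suc; toℕ; inject₁; fromℕ)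
open import Data.Vec using (Vec; []; _∷_; lookup)
open import Data.Product using (Σ; _×_; _,_; proj₁; proj₂)
open import Data.Sum using (_⊎_)
open import Function.Bundles using (_↔_; Inverse; _⇔_)
open import Function.Definitions using (Injective)
open import Relation.Binary.PropositionalEquality using (_≡_)
open import Relation.Nullary using (¬_)

record Graph (n : ℕ) : Set where
  field
    adj    : Fin n → Fin n → Bool
    adj-sym    : ∀ i j → adj i j ≡ adj j i
    adj-irrefl : ∀ i → adj i i ≡ false
open Graph public

-- Graph isomorphism (between graphs with possibly different vertex counts;
-- a bijection Fin n ↔ Fin m forces n = m).
Iso : ∀ {n m} → Graph n → Graph m → Set
Iso {n} {m} G H =
  Σ (Fin n ↔ Fin m) λ f →
    ∀ i j → adj G i j ≡ adj H (Inverse.to f i) (Inverse.to f j)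

Subset : ℕ → Set
Subset n = Vec Bool n

size : ∀ {n} → Subset n → ℕ
size []          = zero
size (true ∷ p)  = suc (size p)
size (false ∷ p) = size p

elems : ∀ {n} (p : Subset n) → Fin (size p) → Fin n
elems (true ∷ p) zero    = zero
elems (true ∷ p) (suc i) = suc (elems p i)
elems (false ∷ p) i      = suc (elems p i)

induced : ∀ {n} → Graph n → (p : Subset n) → Graph (size p)
induced G p = record
  { adj        = λ i j → adj G (elems p i) (elems p j)
  ; adj-sym    = λ i j → adj-sym G (elems p i) (elems p j)
  ; adj-irrefl = λ i → adj-irrefl G (elems p i)
  }

Card : ℕ → ℕ → Set
Card ℓ n = Σ (Subset n) λ p → size p ≡ ℓ

-- 𝒟_ℓ(G) = 𝒟_ℓ(H) as multisets of isomorphism classes: there is a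
-- bijection between the ℓ-subsets of V(G) and of V(H) matching each
-- induced subgraph with an isomorphic one.
SameDeck : ∀ {n m} → ℕ → Graph n → Graph m → Set
SameDeck {n} {m} ℓ G H =
  Σ (Card ℓ n ↔ Card ℓ m) λ σ →
    ∀ (c : Card ℓ n) →
      Iso (induced G (proj₁ c)) (induced H (proj₁ (Inverse.to σ c)))

boolToℕ : Bool → ℕ
boolToℕ true  = 1
boolToℕ false = 0

countTrue : ∀ {n} → (Fin n → Bool) → ℕ
countTrue {zero}  f = zero
countTrue {suc n} f = boolToℕ (f zero) + countTrue (λ i → f (suc i))

degree : ∀ {n} → Graph n → Fin n → ℕ
degree G i = countTrue (adj G i)

data Walk {n} (G : Graph n) : Fin n → Fin n → Set where
  here : ∀ {i} → Walk G i i
  step : ∀ {i k j} → adj G i k ≡ true → Walk G k j → Walk G i j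

Connected : ∀ {n} → Graph n → Set
Connected {n} G = ∀ (i j : Fin n) → Walk G i j

HasCycle : ∀ {n} → Graph n → Set
HasCycle {n} G =
  Σ ℕ λ k → Σ (Fin (suc (suc (suc k))) → Fin n) λ v →
    Injective _≡_ _≡_ v ×
    (∀ (i : Fin (suc (suc k))) → adj G (v (inject₁ i)) (v (suc i)) ≡ true) ×
    adj G (v (fromℕ (suc (suc k)))) (v zero) ≡ true

IsTree : ∀ {n} → Graph n → Set
IsTree {n} G = 1 ≤ n × Connected G × ¬ HasCycle G

IsPath : ∀ {k} → Graph k → Set
IsPath {k} P =
  Σ (Fin k ↔ Fin k) λ f →
    ∀ i j → (adj P (Inverse.to f i) (Inverse.to f j) ≡ true) ⇔
            (toℕ j ≡ suc (toℕ i) ⊎ toℕ i ≡ suc (toℕ j))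

isNotLeaf : ℕ → Bool
isNotLeaf 1 = false
isNotLeaf _ = true

nonLeaves : ∀ {n} → Graph n → Subset n
nonLeaves {zero}  G = []
nonLeaves {suc n} G = Data.Vec.tabulate (λ i → isNotLeaf (degree G i))
  where import Data.Vec

IsCaterpillar : ∀ {n} → Graph n → Set
IsCaterpillar G = IsTree G × IsPath (induced G (nonLeaves G))

{-# OPTIONS --safe #-}
module Submission where

-- Kelly's lemma: if j + |L| ≤ ℓ, the deck determines every sum, over j-tuples t of vertices, of an
-- isomorphism-invariant weight of t times a product of |L| linear factors c − deg tᵢ, because
-- c − deg v = Σ_y (c [y = v] − [y ~ v]) turns each factor into one more vertex of the tuple.
--
-- Only a few linear factors are needed. A product of factors over the degrees of the nonleaves detects the
-- leaves, and its length is at most (n − k) / 4 + 4 for a spine of k vertices. Hence H has the same number of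
-- nonleaves as G and no vertex with three nonleaf neighbours. Counting paths of ⌊k / 2⌋ + 1 vertices that
-- start at an end of the spine, with squares of linear factors as weights, shows that the degree sequences
-- along such paths in H are those read from the two ends of G: there are only two of them in G, so four
-- factors kill them both. An end path in H extends to a maximal path of nonleaves; the nonleaves off it
-- would span a subgraph of minimum degree 2 with at most k / 2 vertices, which does not occur in G. So H is a
-- caterpillar with a spine of k vertices, whose degrees are known from both ends up to the middle.

open import Defs
open import Data.Nat using (ℕ; zero; suc; _+_; _*_; _∸_; _≤_; _<_; z≤n; s≤s; _<?_; _≤?_; ⌊_/2⌋)
import Data.Nat.Properties as ℕₚ
import Data.Nat.Tactic.RingSolver as ℕ-Solver
import Data.Integer as ℤ
open import Data.Integer using (ℤ; 0ℤ; 1ℤ) renaming (+_ to pos; _+_ to _+ᶻ_; _*_ to _*ᶻ_; _-_ to _-ᶻ_; -_ to -ᶻ_; _≤_ to _≤ᶻ_)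
import Data.Integer.Properties as ℤₚ
import Data.Integer.Tactic.RingSolver as ℤ-Solver
open import Algebra.Properties.Semiring.Sum ℤₚ.+-*-semiring using (sum; sum-cong-≗; sum-replicate-zero; sum-permute; ∑-distrib-+; ∑-comm; *-distribˡ-sum)
open import Algebra.Properties.AbelianGroup ℤₚ.+-0-abelianGroup using () renaming (∙-cancelʳ to +ᶻ-cancelʳ; ∙-cancelˡ to +ᶻ-cancelˡ)
open import Data.Bool using (Bool; true; false; if_then_else_; _∧_; _∨_; not)
import Data.Bool.Properties as Boolₚ
open import Data.Fin using (Fin; zero; suc; toℕ; fromℕ; fromℕ<; punchIn; _↑ʳ_)
open import Data.Fin.Properties as Finₚ using (_≟_; any?; all?; ¬∀⟶∃¬)
open import Data.Fin.Permutation as Perm using (Permutation; _⟨$⟩ʳ_)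
open import Data.List using (List; []; _∷_; _++_; length; map; filter; tabulate; allFin)
import Data.List.Properties as Listₚ
open import Data.List.Membership.Propositional using (_∈_)
import Data.List.Membership.Propositional.Properties as ∈ₚ
open import Data.List.Membership.Propositional.Properties.WithK using (unique∧set⇒bag)
open import Data.List.Relation.Binary.BagAndSetEquality using (∼bag⇒↭)
open import Data.List.Relation.Binary.Permutation.Propositional as ↭ using (_↭_)
import Data.List.Relation.Binary.Permutation.Propositional.Properties as ↭ₚ
open import Data.List.Relation.Unary.Unique.Propositional using (Unique)
import Data.List.Relation.Unary.Unique.Propositional.Properties as Uniqueₚ
import Data.List.Relation.Unary.AllPairs as AllPairs
import Data.List.Relation.Unary.All as All
open import Data.List.Relation.Unary.Any using (here; there)
open import Data.Vec as Vec using (Vec; []; _∷_; lookup)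
import Data.Vec.Properties as Vecₚ
open import Data.Product using (Σ; ∃; ∃₂; _×_; _,_; proj₁; proj₂)
import Data.Product.Properties as ×ₚ
open import Data.Sum using (_⊎_; inj₁; inj₂)
open import Data.Empty using (⊥; ⊥-elim)
open import Function using (_∘_; id; _↔_; Inverse; Equivalence; mk⇔)
open import Function.Definitions using (Injective)
open import Relation.Binary.PropositionalEquality using (_≡_; _≢_; refl; sym; trans; cong; cong₂; subst; subst₂; module ≡-Reasoning)
open import Relation.Binary.Definitions using (DecidableEquality)
open import Relation.Nullary using (¬_; Dec; yes; no; does; contradiction)
open import Relation.Nullary.Decidable using (dec-true; dec-false; ¬?; _×-dec_)

-- An induced subgraph loses the edges to deleted vertices, so degrees are invisible on cards, and
-- exhibiting a vertex of degree d with all its neighbours would take d + 1 vertices. A linear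
-- factor costs one vertex whatever the degree. H is arbitrary, so an equality of sums says
-- something about a single tuple of H only if terms cannot cancel; hence the squares, which double
-- the price. Squaring the product over all nonleaf degrees costs (n - k) / 2 + O(1). Reading half
-- of the spine costs k / 2 for the path and (n - k) / 4 for one nonleaf condition. Both fit into n
-- / 2 + O(1), but nothing of order n - k can be paid at several vertices of a long path. This is
-- why long paths are tested only by factors 1 - deg at their two ends, inner vertices being
-- nonleaves for free, and why starting at an end of the spine is expressed by 2 - ν, with ν the
-- number of nonleaf neighbours: this is nonnegative without squaring once no vertex has three of
-- them.

private
  variable
    n m j k r : ℕ

-- Counting Boolean predicates

eqᵇ : Fin n → Fin n → Bool
eqᵇ x y = does (x ≟ y)

eqᵇ-refl : (x : Fin n) → eqᵇ x x ≡ true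
eqᵇ-refl x = dec-true (x ≟ x) refl

eqᵇ-≢ : {x y : Fin n} → x ≢ y → eqᵇ x y ≡ false
eqᵇ-≢ {x = x} {y} = dec-false (x ≟ y)

∧-intro : ∀ {a b} → a ≡ true → b ≡ true → a ∧ b ≡ true
∧-intro refl refl = refl

∧-elim : ∀ a {b} → a ∧ b ≡ true → a ≡ true × b ≡ true
∧-elim true p = refl , p

true≢false : ∀ {a} → a ≡ true → a ≢ false
true≢false refl ()

infixl 7 _∖_
_∖_ : (Fin n → Bool) → Fin n → Fin n → Bool
(f ∖ x) y = f y ∧ not (eqᵇ x y)

∖-intro : (f : Fin n → Bool) {x y : Fin n} → f y ≡ true → x ≢ y → (f ∖ x) y ≡ true
∖-intro f fy x≢y = ∧-intro fy (cong not (eqᵇ-≢ x≢y))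

∖-elim : (f : Fin n → Bool) {x y : Fin n} → (f ∖ x) y ≡ true → f y ≡ true × x ≢ y
∖-elim f {x} {y} p with ∧-elim (f y) p
... | fy , q = fy , λ { refl → true≢false q (cong not (eqᵇ-refl x)) }

count-cong : {f g : Fin n → Bool} → (∀ x → f x ≡ g x) → countTrue f ≡ countTrue g
count-cong {zero}  eq = refl
count-cong {suc n} eq = cong₂ _+_ (cong boolToℕ (eq zero)) (count-cong (eq ∘ suc))

count-remove : (f : Fin n → Bool) (x : Fin n) → countTrue f ≡ boolToℕ (f x) + countTrue (f ∖ x)
count-remove f zero with f zero
... | true  = cong suc (count-cong (λ y → sym (Boolₚ.∧-identityʳ (f (suc y)))))
... | false = count-cong (λ y → sym (Boolₚ.∧-identityʳ (f (suc y))))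
count-remove f (suc x) = begin
  boolToℕ (f zero) + countTrue (f ∘ suc)
    ≡⟨ cong₂ _+_ (cong boolToℕ (sym (Boolₚ.∧-identityʳ (f zero)))) (count-remove (f ∘ suc) x) ⟩
  boolToℕ (f zero ∧ true) + (boolToℕ (f (suc x)) + countTrue (f ∘ suc ∖ x))
    ≡⟨ swap (boolToℕ (f zero ∧ true)) (boolToℕ (f (suc x))) _ ⟩
  boolToℕ (f (suc x)) + (boolToℕ (f zero ∧ true) + countTrue (f ∘ suc ∖ x)) ∎
  where
  open ≡-Reasoning
  swap : ∀ a b c → a + (b + c) ≡ b + (a + c)
  swap = ℕ-Solver.solve-∀

count-take : (f : Fin n → Bool) {x : Fin n} → f x ≡ true → countTrue f ≡ suc (countTrue (f ∖ x))
count-take f {x} fx rewrite count-remove f x | fx = refl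

count-none : {f : Fin n → Bool} → (∀ x → f x ≢ true) → countTrue f ≡ 0
count-none {zero}          none = refl
count-none {suc n} {f = f} none with f zero in eq
... | true  = contradiction eq (none zero)
... | false = count-none (none ∘ suc)

count-witness : (f : Fin n → Bool) → 1 ≤ countTrue f → ∃ λ x → f x ≡ true
count-witness {suc n} f 1≤ with f zero in eq
... | true  = zero , eq
... | false = let x , fx = count-witness (f ∘ suc) 1≤ in suc x , fx

count-≤1 : (f : Fin n → Bool) → (∀ {x y} → f x ≡ true → f y ≡ true → x ≡ y) → countTrue f ≤ 1
count-≤1 f uniq with 1 ≤? countTrue f
... | no ¬1≤ = ℕₚ.≤-trans (ℕₚ.≤-pred (ℕₚ.≰⇒> ¬1≤)) z≤n
... | yes 1≤ with count-witness f 1≤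
... | x , fx rewrite count-take f fx =
  s≤s (ℕₚ.≤-reflexive (count-none {f = f ∖ x} λ y p → let fy , x≢y = ∖-elim f {x} {y} p in x≢y (uniq fx fy)))

count-≤2 : (f : Fin n → Bool) →
  (∀ {x y z} → f x ≡ true → f y ≡ true → f z ≡ true → x ≢ y → x ≢ z → y ≡ z) → countTrue f ≤ 2
count-≤2 f noThree with 1 ≤? countTrue f
... | no ¬1≤ = ℕₚ.≤-trans (ℕₚ.≤-pred (ℕₚ.≰⇒> ¬1≤)) z≤n
... | yes 1≤ with count-witness f 1≤
... | x , fx rewrite count-take f fx = s≤s (count-≤1 (f ∖ x) λ p q →
  let fy , x≢y = ∖-elim f p
      fz , x≢z = ∖-elim f q
  in noThree fx fy fz x≢y x≢z)

count-unique : (f : Fin n → Bool) {x y : Fin n} → countTrue f ≤ 1 → f x ≡ true → f y ≡ true → x ≡ y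
count-unique f {x} {y} ≤1 fx fy with x ≟ y
... | yes x≡y = x≡y
... | no x≢y rewrite count-take f fx | count-take (f ∖ x) (∖-intro f fy x≢y) with ≤1
... | s≤s ()

sumTo : ℕ → (ℕ → ℕ) → ℕ
sumTo zero    f = 0
sumTo (suc k) f = sumTo k f + f k

sumTo-cong : ∀ k {f g : ℕ → ℕ} → (∀ i → i < k → f i ≡ g i) → sumTo k f ≡ sumTo k g
sumTo-cong zero    eq = refl
sumTo-cong (suc k) eq = cong₂ _+_ (sumTo-cong k λ i i<k → eq i (ℕₚ.m<n⇒m<1+n i<k)) (eq k (ℕₚ.n<1+n k))

sumTo-ones : ∀ k → sumTo k (λ _ → 1) ≡ k
sumTo-ones zero    = refl
sumTo-ones (suc k) rewrite sumTo-ones k = ℕₚ.+-comm k 1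

removeAll : (Fin n → Bool) → (ℕ → Fin n) → ℕ → Fin n → Bool
removeAll f p zero    = f
removeAll f p (suc k) = removeAll f p k ∖ p k

removeAll-intro : ∀ (f : Fin n → Bool) p k {y} → f y ≡ true → (∀ i → i < k → p i ≢ y) →
  removeAll f p k y ≡ true
removeAll-intro f p zero    fy fresh = fy
removeAll-intro f p (suc k) fy fresh = ∖-intro (removeAll f p k)
  (removeAll-intro f p k fy λ i i<k → fresh i (ℕₚ.m<n⇒m<1+n i<k)) (fresh k (ℕₚ.n<1+n k))

removeAll-elim : ∀ (f : Fin n → Bool) p k {y} → removeAll f p k y ≡ true →
  f y ≡ true × (∀ i → i < k → p i ≢ y)
removeAll-elim f p zero    r = r , λ _ ()
removeAll-elim f p (suc k) {y} r with ∖-elim (removeAll f p k) r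
... | r′ , pk≢y with removeAll-elim f p k r′
... | fy , fresh = fy , λ i i<1+k → case-≤ i (ℕₚ.m≤n⇒m<n∨m≡n (ℕₚ.≤-pred i<1+k))
  where
  case-≤ : ∀ i → i < k ⊎ i ≡ k → p i ≢ y
  case-≤ i (inj₁ i<k)  = fresh i i<k
  case-≤ i (inj₂ refl) = pk≢y

InjBelow : ℕ → (ℕ → Fin n) → Set
InjBelow k p = ∀ i j → i < k → j < k → p i ≡ p j → i ≡ j

InjBelow-pred : ∀ {k} {p : ℕ → Fin n} → InjBelow (suc k) p → InjBelow k p
InjBelow-pred inj i j i<k j<k = inj i j (ℕₚ.m<n⇒m<1+n i<k) (ℕₚ.m<n⇒m<1+n j<k)

removeAll-fresh : ∀ (f : Fin n → Bool) p k → InjBelow (suc k) p → removeAll f p k (p k) ≡ f (p k)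
removeAll-fresh f p k inj with f (p k) in eq
... | true  = removeAll-intro f p k eq λ i i<k e →
  ℕₚ.<⇒≢ i<k (inj i k (ℕₚ.m<n⇒m<1+n i<k) (ℕₚ.n<1+n k) e)
... | false with removeAll f p k (p k) in eq′
... | true  = contradiction eq (true≢false (proj₁ (removeAll-elim f p k eq′)))
... | false = refl

count-removeAll : ∀ (f : Fin n → Bool) p k → InjBelow k p →
  countTrue f ≡ sumTo k (boolToℕ ∘ f ∘ p) + countTrue (removeAll f p k)
count-removeAll f p zero    inj = refl
count-removeAll f p (suc k) inj = begin
  countTrue f
    ≡⟨ count-removeAll f p k (InjBelow-pred inj) ⟩
  s + countTrue (removeAll f p k)
    ≡⟨ cong (s +_) (count-remove (removeAll f p k) (p k)) ⟩
  s + (boolToℕ (removeAll f p k (p k)) + countTrue (removeAll f p (suc k)))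
    ≡⟨ cong (λ b → s + (boolToℕ b + countTrue (removeAll f p (suc k)))) (removeAll-fresh f p k inj) ⟩
  s + (boolToℕ (f (p k)) + countTrue (removeAll f p (suc k)))
    ≡⟨ sym (ℕₚ.+-assoc s _ _) ⟩
  s + boolToℕ (f (p k)) + countTrue (removeAll f p (suc k)) ∎
  where
  open ≡-Reasoning
  s = sumTo k (boolToℕ ∘ f ∘ p)

count-range : ∀ (f : Fin n → Bool) p k → InjBelow k p →
  (∀ {x} → f x ≡ true → ∃ λ i → i < k × p i ≡ x) → countTrue f ≡ sumTo k (boolToℕ ∘ f ∘ p)
count-range f p k inj covers = begin
  countTrue f                                      ≡⟨ count-removeAll f p k inj ⟩
  s + countTrue (removeAll f p k)                  ≡⟨ cong (s +_) (count-none none) ⟩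
  s + 0                                            ≡⟨ ℕₚ.+-identityʳ s ⟩
  s                                                ∎
  where
  open ≡-Reasoning
  s = sumTo k (boolToℕ ∘ f ∘ p)
  none : ∀ x → removeAll f p k x ≢ true
  none x r = let fx , fresh = removeAll-elim f p k r
                 i , i<k , e = covers fx
             in fresh i i<k e

-- Sums over tuples of vertices and over cards

ind : Bool → ℤ
ind b = pos (boolToℕ b)

sum-ind : (f : Fin n → Bool) → sum (ind ∘ f) ≡ pos (countTrue f)
sum-ind {zero}  f = refl
sum-ind {suc n} f = cong (ind (f zero) +ᶻ_) (sum-ind (f ∘ suc))

-- Repetitions are allowed because the vertex that expands a linear factor may coincide with any
-- vertex already in the tuple.
sumV : ∀ r → (Vec (Fin n) r → ℤ) → ℤ
sumV zero    f = f []
sumV (suc r) f = sum λ x → sumV r λ t → f (x ∷ t)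

sumV-cong : ∀ r {f g : Vec (Fin n) r → ℤ} → (∀ t → f t ≡ g t) → sumV r f ≡ sumV r g
sumV-cong zero    eq = eq []
sumV-cong (suc r) eq = sum-cong-≗ λ x → sumV-cong r λ t → eq (x ∷ t)

sumV-+ : ∀ r (f g : Vec (Fin n) r → ℤ) → sumV r (λ t → f t +ᶻ g t) ≡ sumV r f +ᶻ sumV r g
sumV-+ zero    f g = refl
sumV-+ (suc r) f g = trans (sum-cong-≗ λ x → sumV-+ r (f ∘ (x ∷_)) (g ∘ (x ∷_)))
  (∑-distrib-+ (λ x → sumV r (f ∘ (x ∷_))) _)

sumV-* : ∀ r c (f : Vec (Fin n) r → ℤ) → c *ᶻ sumV r f ≡ sumV r (λ t → c *ᶻ f t)
sumV-* zero    c f = refl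
sumV-* (suc r) c f = trans (*-distribˡ-sum c (λ x → sumV r (f ∘ (x ∷_))))
  (sum-cong-≗ λ x → sumV-* r c (f ∘ (x ∷_)))

sumV-sum : ∀ r (f : Fin m → Vec (Fin n) r → ℤ) →
  sum (λ x → sumV r (f x)) ≡ sumV r (λ t → sum λ x → f x t)
sumV-sum zero    f = refl
sumV-sum (suc r) f = trans (∑-comm λ x y → sumV r λ t → f x (y ∷ t))
  (sum-cong-≗ λ y → sumV-sum r λ x t → f x (y ∷ t))

sumV-comm : ∀ q r (f : Vec (Fin m) q → Vec (Fin n) r → ℤ) →
  sumV q (λ s → sumV r (f s)) ≡ sumV r (λ t → sumV q λ s → f s t)
sumV-comm zero    r f = refl
sumV-comm (suc q) r f = trans (sum-cong-≗ λ x → sumV-comm q r λ s → f (x ∷ s))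
  (sumV-sum r λ x t → sumV q λ s → f (x ∷ s) t)

sumV-++ : ∀ q r (f : Vec (Fin n) (q + r) → ℤ) →
  sumV (q + r) f ≡ sumV q (λ s → sumV r λ t → f (s Vec.++ t))
sumV-++ zero    r f = refl
sumV-++ (suc q) r f = sum-cong-≗ λ x → sumV-++ q r λ t → f (x ∷ t)

sumV-bijection : ∀ r (π : Permutation m n) (f : Vec (Fin n) r → ℤ) →
  sumV r f ≡ sumV r (f ∘ Vec.map (π ⟨$⟩ʳ_))
sumV-bijection zero    π f = refl
sumV-bijection (suc r) π f = trans (sum-permute (λ x → sumV r (f ∘ (x ∷_))) π)
  (sum-cong-≗ λ x → sumV-bijection r π (f ∘ ((π ⟨$⟩ʳ x) ∷_)))

sum-elems : (p : Subset n) (f : Fin n → ℤ) → sum (f ∘ elems p) ≡ sum (λ x → ind (lookup p x) *ᶻ f x)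
sum-elems []          f = refl
sum-elems (true ∷ p)  f = cong₂ _+ᶻ_ (sym (ℤₚ.*-identityˡ (f zero))) (sum-elems p (f ∘ suc))
sum-elems (false ∷ p) f = trans (sum-elems p (f ∘ suc)) (sym (ℤₚ.+-identityˡ _))

inside : Subset n → Vec (Fin n) r → ℤ
inside p []      = 1ℤ
inside p (x ∷ t) = ind (lookup p x) *ᶻ inside p t

sumV-elems : ∀ r (p : Subset n) (f : Vec (Fin n) r → ℤ) →
  sumV r (f ∘ Vec.map (elems p)) ≡ sumV r (λ t → inside p t *ᶻ f t)
sumV-elems zero    p f = sym (ℤₚ.*-identityˡ (f []))
sumV-elems (suc r) p f = begin
  sum (λ i → sumV r λ t → f (elems p i ∷ Vec.map (elems p) t))
    ≡⟨ sum-elems p (λ x → sumV r λ t → f (x ∷ Vec.map (elems p) t)) ⟩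
  sum (λ x → ind (lookup p x) *ᶻ sumV r λ t → f (x ∷ Vec.map (elems p) t))
    ≡⟨ sum-cong-≗ (λ x → cong (ind (lookup p x) *ᶻ_) (sumV-elems r p (f ∘ (x ∷_)))) ⟩
  sum (λ x → ind (lookup p x) *ᶻ sumV r λ t → inside p t *ᶻ f (x ∷ t))
    ≡⟨ sum-cong-≗ (λ x → sumV-* r (ind (lookup p x)) _) ⟩
  sum (λ x → sumV r λ t → ind (lookup p x) *ᶻ (inside p t *ᶻ f (x ∷ t)))
    ≡⟨ sum-cong-≗ (λ x → sumV-cong r λ t → sym (ℤₚ.*-assoc (ind (lookup p x)) _ _)) ⟩
  sum (λ x → sumV r λ t → ind (lookup p x) *ᶻ inside p t *ᶻ f (x ∷ t)) ∎
  where open ≡-Reasoning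

sumL : {A : Set} → List A → (A → ℤ) → ℤ
sumL []       f = 0ℤ
sumL (x ∷ xs) f = f x +ᶻ sumL xs f

sumL-cong : {A : Set} (xs : List A) {f g : A → ℤ} → (∀ x → f x ≡ g x) → sumL xs f ≡ sumL xs g
sumL-cong []       eq = refl
sumL-cong (x ∷ xs) eq = cong₂ _+ᶻ_ (eq x) (sumL-cong xs eq)

sumL-zero : {A : Set} (xs : List A) {f : A → ℤ} → (∀ x → f x ≡ 0ℤ) → sumL xs f ≡ 0ℤ
sumL-zero []       eq = refl
sumL-zero (x ∷ xs) eq = cong₂ _+ᶻ_ (eq x) (sumL-zero xs eq)

sumL-map : {A B : Set} (g : A → B) (xs : List A) (f : B → ℤ) → sumL (map g xs) f ≡ sumL xs (f ∘ g)
sumL-map g []       f = refl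
sumL-map g (x ∷ xs) f = cong (f (g x) +ᶻ_) (sumL-map g xs f)

sumL-++ : {A : Set} (xs ys : List A) (f : A → ℤ) → sumL (xs ++ ys) f ≡ sumL xs f +ᶻ sumL ys f
sumL-++ []       ys f = sym (ℤₚ.+-identityˡ _)
sumL-++ (x ∷ xs) ys f = trans (cong (f x +ᶻ_) (sumL-++ xs ys f)) (sym (ℤₚ.+-assoc (f x) _ _))

sumL-* : {A : Set} (xs : List A) (f : A → ℤ) (c : ℤ) → sumL xs (λ x → f x *ᶻ c) ≡ sumL xs f *ᶻ c
sumL-* []       f c = refl
sumL-* (x ∷ xs) f c = trans (cong (f x *ᶻ c +ᶻ_) (sumL-* xs f c)) (sym (ℤₚ.*-distribʳ-+ c (f x) _))

sumL-↭ : {A : Set} {xs ys : List A} (f : A → ℤ) → xs ↭ ys → sumL xs f ≡ sumL ys f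
sumL-↭ f ↭.refl          = refl
sumL-↭ f (↭.prep x s)    = cong (f x +ᶻ_) (sumL-↭ f s)
sumL-↭ f (↭.swap x y s)  = trans (swap (f x) (f y) _) (cong (λ z → f y +ᶻ (f x +ᶻ z)) (sumL-↭ f s))
  where
  swap : ∀ a b c → a +ᶻ (b +ᶻ c) ≡ b +ᶻ (a +ᶻ c)
  swap = ℤ-Solver.solve-∀
sumL-↭ f (↭.trans s s′)  = trans (sumL-↭ f s) (sumL-↭ f s′)

sumV-zero : ∀ {n} r → sumV {n} r (λ _ → 0ℤ) ≡ 0ℤ
sumV-zero     zero    = refl
sumV-zero {n} (suc r) = trans (sum-cong-≗ {n} λ _ → sumV-zero r) (sum-replicate-zero n)

sumL-sumV : {A : Set} (xs : List A) (r : ℕ) (f : A → Vec (Fin n) r → ℤ) →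
  sumL xs (λ a → sumV r (f a)) ≡ sumV r (λ t → sumL xs λ a → f a t)
sumL-sumV []       r f = sym (sumV-zero r)
sumL-sumV (x ∷ xs) r f = trans (cong (sumV r (f x) +ᶻ_) (sumL-sumV xs r f))
  (sym (sumV-+ r (f x) _))

include : ∀ {ℓ} → Card ℓ n → Card (suc ℓ) (suc n)
include (p , eq) = true ∷ p , cong suc eq

exclude : ∀ {ℓ} → Card ℓ n → Card ℓ (suc n)
exclude (p , eq) = false ∷ p , eq

Card-≡ : ∀ {ℓ} {c d : Card ℓ n} → proj₁ c ≡ proj₁ d → c ≡ d
Card-≡ {c = p , eq} {.p , eq′} refl = cong (p ,_) (ℕₚ.≡-irrelevant eq eq′)

cards : ∀ ℓ n → List (Card ℓ n)
cards zero    zero    = ([] , refl) ∷ []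
cards (suc ℓ) zero    = []
cards zero    (suc n) = map exclude (cards zero n)
cards (suc ℓ) (suc n) = map include (cards ℓ n) ++ map exclude (cards (suc ℓ) n)

cards-complete : ∀ {ℓ n} (c : Card ℓ n) → c ∈ cards ℓ n
cards-complete {zero}  {zero}  ([] , refl) = here refl
cards-complete {zero}  {suc n} (false ∷ p , eq) = ∈ₚ.∈-map⁺ exclude (cards-complete (p , eq))
cards-complete {suc ℓ} {suc n} (true ∷ p , eq) = subst (_∈ cards (suc ℓ) (suc n)) (Card-≡ refl)
  (∈ₚ.∈-++⁺ˡ (∈ₚ.∈-map⁺ include (cards-complete (p , ℕₚ.suc-injective eq))))
cards-complete {suc ℓ} {suc n} (false ∷ p , eq) =
  ∈ₚ.∈-++⁺ʳ (map include (cards ℓ n)) (∈ₚ.∈-map⁺ exclude (cards-complete (p , eq)))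

cards-unique : ∀ ℓ n → Unique (cards ℓ n)
cards-unique zero    zero    = All.[] AllPairs.∷ AllPairs.[]
cards-unique (suc ℓ) zero    = AllPairs.[]
cards-unique zero    (suc n) = Uniqueₚ.map⁺ (Card-≡ ∘ Vecₚ.∷-injectiveʳ ∘ cong proj₁) (cards-unique zero n)
cards-unique (suc ℓ) (suc n) = Uniqueₚ.++⁺
  (Uniqueₚ.map⁺ (Card-≡ ∘ Vecₚ.∷-injectiveʳ ∘ cong proj₁) (cards-unique ℓ n))
  (Uniqueₚ.map⁺ (Card-≡ ∘ Vecₚ.∷-injectiveʳ ∘ cong proj₁) (cards-unique (suc ℓ) n))
  λ (c∈i , c∈e) → disjoint (∈ₚ.∈-map⁻ include c∈i) (∈ₚ.∈-map⁻ exclude c∈e)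
  where
  disjoint : ∀ {c : Card (suc ℓ) (suc n)} →
    (∃ λ d → d ∈ cards ℓ n × c ≡ include d) → (∃ λ d → d ∈ cards (suc ℓ) n × c ≡ exclude d) → ⊥
  disjoint (_ , _ , refl) (_ , _ , ())

↔-injective : {A B : Set} (σ : A ↔ B) → Injective _≡_ _≡_ (Inverse.to σ)
↔-injective σ {x} {y} eq = trans (sym (Inverse.strictlyInverseʳ σ x))
  (trans (cong (Inverse.from σ) eq) (Inverse.strictlyInverseʳ σ y))

-- Both lists are free of duplicates and contain every card, so they agree as bags. This lets the
-- deck bijection reindex a sum over cards.
cards-↭ : ∀ {ℓ} (σ : Card ℓ m ↔ Card ℓ n) → map (Inverse.to σ) (cards ℓ m) ↭ cards ℓ n
cards-↭ {m} {n} {ℓ} σ = ∼bag⇒↭ (unique∧set⇒bag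
  (Uniqueₚ.map⁺ (↔-injective σ) (cards-unique ℓ m)) (cards-unique ℓ n)
  λ {c} → mk⇔ (λ _ → cards-complete c)
    (λ _ → subst (_∈ map (Inverse.to σ) (cards ℓ m)) (Inverse.strictlyInverseˡ σ c)
      (∈ₚ.∈-map⁺ (Inverse.to σ) (cards-complete (Inverse.from σ c)))))

-- Kelly's lemma for tuples of vertices

binom : ℕ → ℕ → ℕ
binom n       zero    = 1
binom zero    (suc ℓ) = 0
binom (suc n) (suc ℓ) = binom n ℓ + binom n (suc ℓ)

binom-pos : ∀ {n ℓ} → ℓ ≤ n → 1 ≤ binom n ℓ
binom-pos {n} {zero}      z≤n       = s≤s z≤n
binom-pos {suc n} {suc ℓ} (s≤s ℓ≤n) = ℕₚ.≤-trans (binom-pos ℓ≤n) (ℕₚ.m≤m+n _ _)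

binom-mono : ∀ ℓ {m n} → m ≤ n → binom m ℓ ≤ binom n ℓ
binom-mono zero    m≤n       = s≤s z≤n
binom-mono (suc ℓ) z≤n       = z≤n
binom-mono (suc ℓ) (s≤s m≤n) = ℕₚ.+-mono-≤ (binom-mono ℓ m≤n) (binom-mono (suc ℓ) m≤n)

binom-strict : ∀ ℓ {m n} → m < n → suc ℓ ≤ n → binom m (suc ℓ) < binom n (suc ℓ)
binom-strict ℓ {m} {suc n} (s≤s m≤n) (s≤s ℓ≤n) =
  ℕₚ.≤-trans (s≤s (binom-mono (suc ℓ) m≤n)) (ℕₚ.+-monoˡ-≤ _ (binom-pos ℓ≤n))

length-cards : ∀ ℓ n → length (cards ℓ n) ≡ binom n ℓ
length-cards zero    zero    = refl
length-cards (suc ℓ) zero    = refl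
length-cards zero    (suc n) = trans (Listₚ.length-map exclude (cards zero n)) (length-cards zero n)
length-cards (suc ℓ) (suc n) = trans (Listₚ.length-++ (map include (cards ℓ n))) (cong₂ _+_
  (trans (Listₚ.length-map include (cards ℓ n)) (length-cards ℓ n))
  (trans (Listₚ.length-map exclude (cards (suc ℓ) n)) (length-cards (suc ℓ) n)))

-- More vertices give strictly more cards as soon as the larger order is at least ℓ. The bound 1 ≤ ℓ
-- matters: every graph has exactly one card with no vertices.
same-order : ∀ {ℓ} → 1 ≤ ℓ → ℓ ≤ n → Card ℓ m ↔ Card ℓ n → m ≡ n
same-order {n} {m} {suc ℓ} _ ℓ≤n σ = ℕₚ.≤-antisym (ℕₚ.≮⇒≥ ¬n<m) (ℕₚ.≮⇒≥ ¬m<n)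
  where
  eq : binom m (suc ℓ) ≡ binom n (suc ℓ)
  eq = trans (sym (length-cards (suc ℓ) m))
    (trans (sym (Listₚ.length-map (Inverse.to σ) (cards (suc ℓ) m)))
      (trans (↭ₚ.↭-length (cards-↭ σ)) (length-cards (suc ℓ) n)))
  ¬m<n : ¬ m < n
  ¬m<n m<n = ℕₚ.<⇒≢ (binom-strict ℓ m<n ℓ≤n) eq
  ¬n<m : ¬ n < m
  ¬n<m n<m = ℕₚ.<⇒≢ (binom-strict ℓ n<m (ℕₚ.≤-trans ℓ≤n (ℕₚ.<⇒≤ n<m))) (sym eq)

-- The number of ℓ-sets containing a given s-set whose complement has c elements.
supersets : ℕ → ℕ → ℕ → ℕ
supersets c ℓ       zero    = binom c ℓ
supersets c zero    (suc s) = 0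
supersets c (suc ℓ) (suc s) = supersets c ℓ s

supersets-zero : ∀ c s → supersets (suc c) zero s ≡ supersets c zero s
supersets-zero c zero    = refl
supersets-zero c (suc s) = refl

supersets-suc : ∀ c ℓ s → supersets (suc c) (suc ℓ) s ≡ supersets c ℓ s + supersets c (suc ℓ) s
supersets-suc c ℓ       zero    = refl
supersets-suc c zero    (suc s) = supersets-zero c s
supersets-suc c (suc ℓ) (suc s) = supersets-suc c ℓ s

supersets-pos : ∀ c ℓ s → s ≤ ℓ → ℓ ≤ c + s → 1 ≤ supersets c ℓ s
supersets-pos c ℓ       zero    s≤ℓ       ℓ≤c+s = binom-pos (subst (ℓ ≤_) (ℕₚ.+-identityʳ c) ℓ≤c+s)
supersets-pos c (suc ℓ) (suc s) (s≤s s≤ℓ) ℓ≤c+s =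
  supersets-pos c ℓ s s≤ℓ (ℕₚ.≤-pred (subst (suc ℓ ≤_) (ℕₚ.+-suc c s) ℓ≤c+s))

containsᶻ : Subset n → Subset n → ℤ
containsᶻ []          []      = 1ℤ
containsᶻ (true ∷ S)  (b ∷ p) = ind b *ᶻ containsᶻ S p
containsᶻ (false ∷ S) (b ∷ p) = containsᶻ S p

cosize : Subset n → ℕ
cosize []          = 0
cosize (true ∷ S)  = cosize S
cosize (false ∷ S) = suc (cosize S)

cosize+size : (S : Subset n) → cosize S + size S ≡ n
cosize+size []          = refl
cosize+size (true ∷ S)  = trans (ℕₚ.+-suc (cosize S) (size S)) (cong suc (cosize+size S))
cosize+size (false ∷ S) = cong suc (cosize+size S)

-- Induction over the vertices: for a vertex of S only the cards that include it contribute; for any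
-- other vertex the two halves of the enumeration add up by Pascal's rule.
sum-contains : ∀ ℓ (S : Subset n) →
  sumL (cards ℓ n) (containsᶻ S ∘ proj₁) ≡ pos (supersets (cosize S) ℓ (size S))
sum-contains zero    []         = refl
sum-contains (suc ℓ) []         = refl
sum-contains {suc n} zero (true ∷ S) =
  trans (sumL-map exclude (cards zero n) _) (sumL-zero (cards zero n) λ _ → refl)
sum-contains {suc n} zero (false ∷ S) = trans (sumL-map exclude (cards zero n) _)
  (trans (sum-contains zero S) (cong pos (sym (supersets-zero (cosize S) (size S)))))
sum-contains {suc n} (suc ℓ) (true ∷ S) = begin
  sumL (map include (cards ℓ n) ++ map exclude (cards (suc ℓ) n)) F
    ≡⟨ sumL-++ (map include (cards ℓ n)) _ F ⟩
  sumL (map include (cards ℓ n)) F +ᶻ sumL (map exclude (cards (suc ℓ) n)) F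
    ≡⟨ cong₂ _+ᶻ_ (sumL-map include (cards ℓ n) F) (sumL-map exclude (cards (suc ℓ) n) F) ⟩
  sumL (cards ℓ n) (λ c → 1ℤ *ᶻ containsᶻ S (proj₁ c)) +ᶻ sumL (cards (suc ℓ) n) (λ c → 0ℤ)
    ≡⟨ cong₂ _+ᶻ_ (sumL-cong (cards ℓ n) λ c → ℤₚ.*-identityˡ (containsᶻ S (proj₁ c)))
                  (sumL-zero (cards (suc ℓ) n) λ _ → refl) ⟩
  sumL (cards ℓ n) (containsᶻ S ∘ proj₁) +ᶻ 0ℤ
    ≡⟨ ℤₚ.+-identityʳ _ ⟩
  sumL (cards ℓ n) (containsᶻ S ∘ proj₁)
    ≡⟨ sum-contains ℓ S ⟩
  pos (supersets (cosize S) ℓ (size S)) ∎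
  where
  open ≡-Reasoning
  F : Card (suc ℓ) (suc n) → ℤ
  F = containsᶻ (true ∷ S) ∘ proj₁
sum-contains {suc n} (suc ℓ) (false ∷ S) = begin
  sumL (map include (cards ℓ n) ++ map exclude (cards (suc ℓ) n)) F
    ≡⟨ sumL-++ (map include (cards ℓ n)) _ F ⟩
  sumL (map include (cards ℓ n)) F +ᶻ sumL (map exclude (cards (suc ℓ) n)) F
    ≡⟨ cong₂ _+ᶻ_ (sumL-map include (cards ℓ n) F) (sumL-map exclude (cards (suc ℓ) n) F) ⟩
  sumL (cards ℓ n) (containsᶻ S ∘ proj₁) +ᶻ sumL (cards (suc ℓ) n) (containsᶻ S ∘ proj₁)
    ≡⟨ cong₂ _+ᶻ_ (sum-contains ℓ S) (sum-contains (suc ℓ) S) ⟩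
  pos (supersets (cosize S) ℓ (size S) + supersets (cosize S) (suc ℓ) (size S))
    ≡⟨ cong pos (sym (supersets-suc (cosize S) ℓ (size S))) ⟩
  pos (supersets (suc (cosize S)) (suc ℓ) (size S)) ∎
  where
  open ≡-Reasoning
  F : Card (suc ℓ) (suc n) → ℤ
  F = containsᶻ (false ∷ S) ∘ proj₁

_∈ᵇ_ : Fin n → Vec (Fin n) r → Bool
x ∈ᵇ []      = false
x ∈ᵇ (y ∷ t) = eqᵇ x y ∨ x ∈ᵇ t

imageSize : Vec (Fin n) r → ℕ
imageSize []      = 0
imageSize (x ∷ t) = if x ∈ᵇ t then imageSize t else suc (imageSize t)

imageSize≤ : (t : Vec (Fin n) r) → imageSize t ≤ r
imageSize≤ []      = z≤n
imageSize≤ (x ∷ t) with x ∈ᵇ t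
... | true  = ℕₚ.m≤n⇒m≤1+n (imageSize≤ t)
... | false = s≤s (imageSize≤ t)

insert : Fin n → Subset n → Subset n
insert zero    (b ∷ S) = true ∷ S
insert (suc x) (b ∷ S) = b ∷ insert x S

support : Vec (Fin n) r → Subset n
support {n} []  = Vec.replicate n false
support (x ∷ t) = insert x (support t)

lookup-insert : (x y : Fin n) (S : Subset n) → lookup (insert y S) x ≡ eqᵇ x y ∨ lookup S x
lookup-insert zero    zero    (b ∷ S) = refl
lookup-insert (suc x) zero    (b ∷ S) = refl
lookup-insert zero    (suc y) (b ∷ S) = refl
lookup-insert (suc x) (suc y) (b ∷ S) = lookup-insert x y S

lookup-support : (x : Fin n) (t : Vec (Fin n) r) → lookup (support t) x ≡ x ∈ᵇ t
lookup-support x []      = Vecₚ.lookup-replicate x false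
lookup-support x (y ∷ t) = trans (lookup-insert x y (support t)) (cong (eqᵇ x y ∨_) (lookup-support x t))

size-insert : (x : Fin n) (S : Subset n) → size (insert x S) ≡ (if lookup S x then size S else suc (size S))
size-insert zero    (true ∷ S)  = refl
size-insert zero    (false ∷ S) = refl
size-insert (suc x) (true ∷ S)  rewrite size-insert x S with lookup S x
... | true  = refl
... | false = refl
size-insert (suc x) (false ∷ S) = size-insert x S

size-replicate : ∀ n → size (Vec.replicate n false) ≡ 0
size-replicate zero    = refl
size-replicate (suc n) = size-replicate n

size-support : (t : Vec (Fin n) r) → size (support t) ≡ imageSize t
size-support {n} []  = size-replicate n
size-support (x ∷ t) rewrite size-insert x (support t) | lookup-support x t | size-support t = refl

ind-idem : ∀ b (z : ℤ) → ind b *ᶻ z ≡ ind b *ᶻ (ind b *ᶻ z)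
ind-idem true  z = cong (1ℤ *ᶻ_) (sym (ℤₚ.*-identityˡ z))
ind-idem false z = refl

-- If x is in S already, the additional factor is absorbed because an indicator is idempotent.
-- Repeated entries of a tuple are harmless for this reason.
contains-insert : (x : Fin n) (S p : Subset n) → containsᶻ (insert x S) p ≡ ind (lookup p x) *ᶻ containsᶻ S p
contains-insert zero    (true ∷ S)  (b ∷ p) = ind-idem b (containsᶻ S p)
contains-insert zero    (false ∷ S) (b ∷ p) = refl
contains-insert (suc x) (true ∷ S)  (b ∷ p) =
  trans (cong (ind b *ᶻ_) (contains-insert x S p)) (swap (ind b) (ind (lookup p x)) (containsᶻ S p))
  where
  swap : ∀ a b c → a *ᶻ (b *ᶻ c) ≡ b *ᶻ (a *ᶻ c)
  swap = ℤ-Solver.solve-∀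
contains-insert (suc x) (false ∷ S) (b ∷ p) = contains-insert x S p

contains-replicate : (p : Subset n) → containsᶻ (Vec.replicate n false) p ≡ 1ℤ
contains-replicate []      = refl
contains-replicate (b ∷ p) = contains-replicate p

inside≡contains : (p : Subset n) (t : Vec (Fin n) r) → inside p t ≡ containsᶻ (support t) p
inside≡contains p []      = sym (contains-replicate p)
inside≡contains p (x ∷ t) =
  trans (cong (ind (lookup p x) *ᶻ_) (inside≡contains p t)) (sym (contains-insert x (support t) p))

sum-inside : ∀ ℓ (t : Vec (Fin n) r) →
  sumL (cards ℓ n) (λ c → inside (proj₁ c) t) ≡ pos (supersets (n ∸ imageSize t) ℓ (imageSize t))
sum-inside {n} ℓ t = begin
  sumL (cards ℓ n) (λ c → inside (proj₁ c) t)
    ≡⟨ sumL-cong (cards ℓ n) (λ c → inside≡contains (proj₁ c) t) ⟩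
  sumL (cards ℓ n) (containsᶻ (support t) ∘ proj₁)
    ≡⟨ sum-contains ℓ (support t) ⟩
  pos (supersets (cosize (support t)) ℓ (size (support t)))
    ≡⟨ cong₂ (λ c s → pos (supersets c ℓ s)) cosize≡ (size-support t) ⟩
  pos (supersets (n ∸ imageSize t) ℓ (imageSize t)) ∎
  where
  open ≡-Reasoning
  cosize≡ : cosize (support t) ≡ n ∸ imageSize t
  cosize≡ = begin
    cosize (support t)                                               ≡⟨ sym (ℕₚ.m+n∸n≡m _ (size (support t))) ⟩
    cosize (support t) + size (support t) ∸ size (support t)
      ≡⟨ cong₂ _∸_ (cosize+size (support t)) (size-support t) ⟩
    n ∸ imageSize t                                                  ∎

-- Invariant weights and double counting over cards

Weight : ℕ → Set
Weight r = ∀ {n} → Graph n → Vec (Fin n) r → ℤ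

Embeds : Graph m → Graph n → (Fin m → Fin n) → Set
Embeds G H f = Injective _≡_ _≡_ f × (∀ x y → adj G x y ≡ adj H (f x) (f y))

-- Induced embeddings cover both uses: the isomorphisms between matched cards, and the inclusion of
-- a card in the whole graph. A degree is not invariant in this sense.
Invariant : Weight r → Set
Invariant Ψ = ∀ {m n} (G : Graph m) (H : Graph n) f → Embeds G H f → ∀ t → Ψ G t ≡ Ψ H (Vec.map f t)

eqᵇ-map : (f : Fin m → Fin n) → Injective _≡_ _≡_ f → ∀ x y → eqᵇ x y ≡ eqᵇ (f x) (f y)
eqᵇ-map f inj x y with x ≟ y
... | yes refl = sym (eqᵇ-refl (f x))
... | no x≢y   = sym (eqᵇ-≢ (x≢y ∘ inj))

∈ᵇ-map : (f : Fin m → Fin n) → Injective _≡_ _≡_ f → ∀ x (t : Vec (Fin m) r) → x ∈ᵇ t ≡ f x ∈ᵇ Vec.map f t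
∈ᵇ-map f inj x []      = refl
∈ᵇ-map f inj x (y ∷ t) = cong₂ _∨_ (eqᵇ-map f inj x y) (∈ᵇ-map f inj x t)

imageSize-map : (f : Fin m → Fin n) → Injective _≡_ _≡_ f → (t : Vec (Fin m) r) →
  imageSize t ≡ imageSize (Vec.map f t)
imageSize-map f inj []      = refl
imageSize-map f inj (x ∷ t) rewrite ∈ᵇ-map f inj x t | imageSize-map f inj t = refl

elems-injective : (p : Subset n) → Injective _≡_ _≡_ (elems p)
elems-injective (true ∷ p)  {zero}  {zero}  eq = refl
elems-injective (true ∷ p)  {suc i} {suc j} eq = cong suc (elems-injective p (Finₚ.suc-injective eq))
elems-injective (false ∷ p) {i}     {j}     eq = elems-injective p (Finₚ.suc-injective eq)

deck-sum : ∀ ℓ → Weight r → Graph n → ℤ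
deck-sum {r} {n} ℓ Ψ G = sumL (cards ℓ n) λ c → sumV r (Ψ (induced G (proj₁ c)))

deck-sum-≡ : ∀ {ℓ} (Ψ : Weight r) → Invariant Ψ → (H : Graph m) (G : Graph n) → SameDeck ℓ H G →
  deck-sum ℓ Ψ H ≡ deck-sum ℓ Ψ G
deck-sum-≡ {r} {m} {n} {ℓ} Ψ inv H G (σ , iso) = begin
  sumL (cards ℓ m) (λ c → sumV r (Ψ (induced H (proj₁ c))))
    ≡⟨ sumL-cong (cards ℓ m) card ⟩
  sumL (cards ℓ m) (λ c → sumV r (Ψ (induced G (proj₁ (Inverse.to σ c)))))
    ≡⟨ sym (sumL-map (Inverse.to σ) (cards ℓ m) _) ⟩
  sumL (map (Inverse.to σ) (cards ℓ m)) (λ c → sumV r (Ψ (induced G (proj₁ c))))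
    ≡⟨ sumL-↭ _ (cards-↭ σ) ⟩
  sumL (cards ℓ n) (λ c → sumV r (Ψ (induced G (proj₁ c)))) ∎
  where
  open ≡-Reasoning
  card : ∀ c → sumV r (Ψ (induced H (proj₁ c))) ≡ sumV r (Ψ (induced G (proj₁ (Inverse.to σ c))))
  card c = let π , pres = iso c in
    trans (sumV-cong r (inv _ _ (Inverse.to π) (↔-injective π , pres))) (sym (sumV-bijection r π _))

-- By invariance the tuples of a card are the tuples of G inside it. Exchanging the two sums counts
-- each tuple once for every card that contains it.
deck-sum-expand : ∀ ℓ (Ψ : Weight r) → Invariant Ψ → (G : Graph n) →
  deck-sum ℓ Ψ G ≡ sumV r (λ t → pos (supersets (n ∸ imageSize t) ℓ (imageSize t)) *ᶻ Ψ G t)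
deck-sum-expand {r} {n} ℓ Ψ inv G = begin
  sumL (cards ℓ n) (λ c → sumV r (Ψ (induced G (proj₁ c))))
    ≡⟨ sumL-cong (cards ℓ n) card ⟩
  sumL (cards ℓ n) (λ c → sumV r λ t → inside (proj₁ c) t *ᶻ Ψ G t)
    ≡⟨ sumL-sumV (cards ℓ n) r _ ⟩
  sumV r (λ t → sumL (cards ℓ n) λ c → inside (proj₁ c) t *ᶻ Ψ G t)
    ≡⟨ sumV-cong r (λ t → trans (sumL-* (cards ℓ n) _ (Ψ G t)) (cong (_*ᶻ Ψ G t) (sum-inside ℓ t))) ⟩
  sumV r (λ t → pos (supersets (n ∸ imageSize t) ℓ (imageSize t)) *ᶻ Ψ G t) ∎
  where
  open ≡-Reasoning
  card : ∀ c → sumV r (Ψ (induced G (proj₁ c))) ≡ sumV r (λ t → inside (proj₁ c) t *ᶻ Ψ G t)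
  card (p , _) = trans
    (sumV-cong r (inv (induced G p) G (elems p) (elems-injective p , λ _ _ → refl)))
    (sumV-elems r p (Ψ G))

_≡ᵇℕ_ : ℕ → ℕ → Bool
a ≡ᵇℕ b = does (a ℕₚ.≟ b)

-- Tuples with different image sizes lie in different numbers of cards, so they are counted separately.
restrict : ℕ → Weight r → Weight r
restrict s Ψ G t = ind (imageSize t ≡ᵇℕ s) *ᶻ Ψ G t

restrict-invariant : ∀ s {Ψ : Weight r} → Invariant Ψ → Invariant (restrict s Ψ)
restrict-invariant s inv G H f emb t =
  cong₂ (λ a z → ind (a ≡ᵇℕ s) *ᶻ z) (imageSize-map f (proj₁ emb) t) (inv G H f emb t)

supersets-restrict : ∀ ℓ s (Ψ : Weight r) (G : Graph n) t →
  pos (supersets (n ∸ imageSize t) ℓ (imageSize t)) *ᶻ restrict s Ψ G t ≡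
  pos (supersets (n ∸ s) ℓ s) *ᶻ restrict s Ψ G t
supersets-restrict {n = n} ℓ s Ψ G t with imageSize t ℕₚ.≟ s
... | yes refl = refl
... | no  ne rewrite dec-false (imageSize t ℕₚ.≟ s) ne =
                 trans (ℤₚ.*-zeroʳ (pos (supersets (n ∸ imageSize t) ℓ (imageSize t))))
                       (sym (ℤₚ.*-zeroʳ (pos (supersets (n ∸ s) ℓ s))))

-- With the number s of distinct entries fixed, all tuples lie in equally many cards; this number is
-- positive because s ≤ ℓ ≤ n, so it cancels.
restricted-sum-≡ : ∀ {ℓ} s (Ψ : Weight r) → Invariant Ψ → (H G : Graph n) → SameDeck ℓ H G →
  s ≤ ℓ → ℓ ≤ n → sumV r (restrict s Ψ H) ≡ sumV r (restrict s Ψ G)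
restricted-sum-≡ {r} {n} {ℓ} s Ψ inv H G deck s≤ℓ ℓ≤n = cancel c c>0 _ _ (begin
  pos c *ᶻ sumV r (restrict s Ψ H)    ≡⟨ sym (expand H) ⟩
  deck-sum ℓ (restrict s Ψ) H         ≡⟨ deck-sum-≡ (restrict s Ψ) (restrict-invariant s {Ψ} inv) H G deck ⟩
  deck-sum ℓ (restrict s Ψ) G         ≡⟨ expand G ⟩
  pos c *ᶻ sumV r (restrict s Ψ G)    ∎)
  where
  open ≡-Reasoning
  c = supersets (n ∸ s) ℓ s
  c>0 : 1 ≤ c
  c>0 = supersets-pos (n ∸ s) ℓ s s≤ℓ
    (subst (ℓ ≤_) (sym (ℕₚ.m∸n+n≡m (ℕₚ.≤-trans s≤ℓ ℓ≤n))) ℓ≤n)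
  cancel : ∀ c → 1 ≤ c → ∀ x y → pos c *ᶻ x ≡ pos c *ᶻ y → x ≡ y
  cancel (suc c) _ x y = ℤₚ.*-cancelˡ-≡ (pos (suc c)) x y
  expand : ∀ X → deck-sum ℓ (restrict s Ψ) X ≡ pos c *ᶻ sumV r (restrict s Ψ X)
  expand X = trans (deck-sum-expand ℓ (restrict s Ψ) (restrict-invariant s {Ψ} inv) X)
    (trans (sumV-cong r (supersets-restrict ℓ s Ψ X)) (sym (sumV-* r (pos c) (restrict s Ψ X))))

sumUpTo : ℕ → (ℕ → ℤ) → ℤ
sumUpTo zero    f = 0ℤ
sumUpTo (suc k) f = sumUpTo k f +ᶻ f k

sumUpTo-cong : ∀ k {f g : ℕ → ℤ} → (∀ s → s < k → f s ≡ g s) → sumUpTo k f ≡ sumUpTo k g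
sumUpTo-cong zero    eq = refl
sumUpTo-cong (suc k) eq = cong₂ _+ᶻ_ (sumUpTo-cong k λ s s<k → eq s (ℕₚ.m<n⇒m<1+n s<k)) (eq k (ℕₚ.n<1+n k))

sumUpTo-zero : ∀ k a z → k ≤ a → sumUpTo k (λ s → ind (a ≡ᵇℕ s) *ᶻ z) ≡ 0ℤ
sumUpTo-zero zero    a z k≤a = refl
sumUpTo-zero (suc k) a z k<a rewrite dec-false (a ℕₚ.≟ k) (λ e → ℕₚ.<⇒≢ k<a (sym e)) =
  cong (_+ᶻ 0ℤ) (sumUpTo-zero k a z (ℕₚ.<⇒≤ k<a))

sumUpTo-ind : ∀ k a z → a < k → sumUpTo k (λ s → ind (a ≡ᵇℕ s) *ᶻ z) ≡ z
sumUpTo-ind (suc k) a z a<1+k with a ℕₚ.≟ k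
... | yes refl rewrite dec-true (a ℕₚ.≟ a) refl =
  trans (cong₂ _+ᶻ_ (sumUpTo-zero k a z ℕₚ.≤-refl) (ℤₚ.*-identityˡ z)) (ℤₚ.+-identityˡ z)
... | no a≢k rewrite dec-false (a ℕₚ.≟ k) a≢k =
  trans (ℤₚ.+-identityʳ _) (sumUpTo-ind k a z (ℕₚ.≤∧≢⇒< (ℕₚ.≤-pred a<1+k) a≢k))

sumUpTo-sumV : ∀ k r (f : ℕ → Vec (Fin n) r → ℤ) →
  sumUpTo k (λ s → sumV r (f s)) ≡ sumV r (λ t → sumUpTo k λ s → f s t)
sumUpTo-sumV zero    r f = sym (sumV-zero r)
sumUpTo-sumV (suc k) r f = trans (cong (_+ᶻ sumV r (f k)) (sumUpTo-sumV k r f)) (sym (sumV-+ r _ (f k)))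

-- Every tuple has exactly one image size, and it is at most r, so r ≤ ℓ makes all the restricted
-- sums available.
tuple-sum-≡ : ∀ {ℓ} (Ψ : Weight r) → Invariant Ψ → (H G : Graph n) → SameDeck ℓ H G →
  r ≤ ℓ → ℓ ≤ n → sumV r (Ψ H) ≡ sumV r (Ψ G)
tuple-sum-≡ {r} {ℓ = ℓ} Ψ inv H G deck r≤ℓ ℓ≤n = begin
  sumV r (Ψ H)                                     ≡⟨ split H ⟩
  sumUpTo (suc r) (λ s → sumV r (restrict s Ψ H))  ≡⟨ sumUpTo-cong (suc r) (λ s s≤r →
    restricted-sum-≡ s Ψ inv H G deck (ℕₚ.≤-trans (ℕₚ.≤-pred s≤r) r≤ℓ) ℓ≤n) ⟩
  sumUpTo (suc r) (λ s → sumV r (restrict s Ψ G))  ≡⟨ sym (split G) ⟩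
  sumV r (Ψ G)                                     ∎
  where
  open ≡-Reasoning
  split : ∀ X → sumV r (Ψ X) ≡ sumUpTo (suc r) (λ s → sumV r (restrict s Ψ X))
  split X = trans
    (sumV-cong r λ t → sym (sumUpTo-ind (suc r) (imageSize t) (Ψ X t) (s≤s (imageSize≤ t))))
    (sym (sumUpTo-sumV (suc r) r λ s → restrict s Ψ X))

-- Tuple sums weighted by linear factors in the degrees

count-eq : (v : Fin n) → countTrue (λ y → eqᵇ y v) ≡ 1
count-eq v = trans (count-take (λ y → eqᵇ y v) {v} (eqᵇ-refl v)) (cong suc (count-none {f = (λ y → eqᵇ y v) ∖ v} none))
  where
  none : ∀ y → ((λ y → eqᵇ y v) ∖ v) y ≢ true
  none y p with ∖-elim (λ y → eqᵇ y v) {v} {y} p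
  ... | eq , v≢y = true≢false eq (eqᵇ-≢ (v≢y ∘ sym))

Factors : ℕ → Set
Factors j = List (Fin j × ℤ)

lin : Graph n → Factors j → Vec (Fin n) j → ℤ
lin G []            t = 1ℤ
lin G ((i , c) ∷ L) t = (c -ᶻ pos (degree G (lookup t i))) *ᶻ lin G L t

-- c − deg v is the sum over all vertices y of this.
factor : Graph n → ℤ → Fin n → Fin n → ℤ
factor G c v y = c *ᶻ ind (eqᵇ y v) -ᶻ ind (adj G v y)

sum-factor : (G : Graph n) (c : ℤ) (v : Fin n) → sum (factor G c v) ≡ c -ᶻ pos (degree G v)
sum-factor G c v = begin
  sum (λ y → c *ᶻ ind (eqᵇ y v) +ᶻ -ᶻ ind (adj G v y))
    ≡⟨ ∑-distrib-+ (λ y → c *ᶻ ind (eqᵇ y v)) _ ⟩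
  sum (λ y → c *ᶻ ind (eqᵇ y v)) +ᶻ sum (λ y → -ᶻ ind (adj G v y))
    ≡⟨ cong₂ _+ᶻ_ (sym (*-distribˡ-sum c (λ y → ind (eqᵇ y v))))
         (trans (sum-cong-≗ λ y → sym (ℤₚ.-1*i≡-i (ind (adj G v y)))) (sym (*-distribˡ-sum ℤ.-1ℤ (ind ∘ adj G v)))) ⟩
  c *ᶻ sum (λ y → ind (eqᵇ y v)) +ᶻ ℤ.-1ℤ *ᶻ sum (ind ∘ adj G v)
    ≡⟨ cong₂ (λ a b → c *ᶻ a +ᶻ ℤ.-1ℤ *ᶻ b)
         (trans (sum-ind (λ y → eqᵇ y v)) (cong pos (count-eq v))) (sum-ind (adj G v)) ⟩
  c *ᶻ 1ℤ +ᶻ ℤ.-1ℤ *ᶻ pos (degree G v)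
    ≡⟨ cong₂ _+ᶻ_ (ℤₚ.*-identityʳ c) (ℤₚ.-1*i≡-i (pos (degree G v))) ⟩
  c -ᶻ pos (degree G v) ∎
  where open ≡-Reasoning

-- One vertex is prepended per factor, and only adjacency and equality with the tested vertex enter.
-- So this weight is invariant although the degrees it stands for are not.
linWeight : (L : Factors j) → Weight j → Weight (length L + j)
linWeight []            Ψ G t       = Ψ G t
linWeight ((i , c) ∷ L) Ψ G (y ∷ t) = factor G c (lookup t (length L ↑ʳ i)) y *ᶻ linWeight L Ψ G t

linWeight-invariant : (L : Factors j) {Ψ : Weight j} → Invariant Ψ → Invariant (linWeight L Ψ)
linWeight-invariant []            inv G H f emb t       = inv G H f emb t
linWeight-invariant ((i , c) ∷ L) {Ψ} inv G H f emb (y ∷ t)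
  rewrite Vecₚ.lookup-map (length L ↑ʳ i) f t
        | eqᵇ-map f (proj₁ emb) y (lookup t (length L ↑ʳ i))
        | proj₂ emb (lookup t (length L ↑ʳ i)) y
        | linWeight-invariant L {Ψ} inv G H f emb t = refl

sumV-linWeight : (L : Factors j) (Ψ : Weight j) (G : Graph n) (t : Vec (Fin n) j) →
  sumV (length L) (λ s → linWeight L Ψ G (s Vec.++ t)) ≡ Ψ G t *ᶻ lin G L t
sumV-linWeight []            Ψ G t = sym (ℤₚ.*-identityʳ (Ψ G t))
sumV-linWeight ((i , c) ∷ L) Ψ G t = begin
  sum (λ y → sumV e λ s → factor G c (lookup (s Vec.++ t) (e ↑ʳ i)) y *ᶻ linWeight L Ψ G (s Vec.++ t))
    ≡⟨ sum-cong-≗ (λ y → trans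
         (sumV-cong e λ s → cong (λ v → factor G c v y *ᶻ linWeight L Ψ G (s Vec.++ t)) (Vecₚ.lookup-++ʳ s t i))
         (trans (sym (sumV-* e (factor G c v y) _)) (ℤₚ.*-comm (factor G c v y) S))) ⟩
  sum (λ y → S *ᶻ factor G c v y)
    ≡⟨ sym (*-distribˡ-sum S (factor G c v)) ⟩
  S *ᶻ sum (factor G c v)
    ≡⟨ cong₂ _*ᶻ_ (sumV-linWeight L Ψ G t) (sum-factor G c v) ⟩
  Ψ G t *ᶻ lin G L t *ᶻ (c -ᶻ pos (degree G v))
    ≡⟨ shuffle (Ψ G t) (lin G L t) (c -ᶻ pos (degree G v)) ⟩
  Ψ G t *ᶻ ((c -ᶻ pos (degree G v)) *ᶻ lin G L t) ∎
  where
  open ≡-Reasoning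
  e = length L
  v = lookup t i
  S = sumV e λ s → linWeight L Ψ G (s Vec.++ t)
  shuffle : ∀ a b c → a *ᶻ b *ᶻ c ≡ a *ᶻ (c *ᶻ b)
  shuffle = ℤ-Solver.solve-∀

-- Summing over the prepended vertices first yields the product of the linear factors, while Kelly's
-- lemma sees only tuples of `length L + j` vertices.
degree-sum-≡ : ∀ {ℓ} (L : Factors j) (Ψ : Weight j) → Invariant Ψ → (H G : Graph n) → SameDeck ℓ H G →
  length L + j ≤ ℓ → ℓ ≤ n →
  sumV j (λ t → Ψ H t *ᶻ lin H L t) ≡ sumV j (λ t → Ψ G t *ᶻ lin G L t)
degree-sum-≡ {j} L Ψ inv H G deck e+j≤ℓ ℓ≤n = begin
  sumV j (λ t → Ψ H t *ᶻ lin H L t)           ≡⟨ expand H ⟩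
  sumV (length L + j) (linWeight L Ψ H)
    ≡⟨ tuple-sum-≡ (linWeight L Ψ) (linWeight-invariant L {Ψ} inv) H G deck e+j≤ℓ ℓ≤n ⟩
  sumV (length L + j) (linWeight L Ψ G)       ≡⟨ sym (expand G) ⟩
  sumV j (λ t → Ψ G t *ᶻ lin G L t)           ∎
  where
  open ≡-Reasoning
  expand : ∀ X → sumV j (λ t → Ψ X t *ᶻ lin X L t) ≡ sumV (length L + j) (linWeight L Ψ X)
  expand X = trans (sumV-cong j λ t → sym (sumV-linWeight L Ψ X t))
    (trans (sumV-comm j (length L) λ t s → linWeight L Ψ X (s Vec.++ t))
      (sym (sumV-++ (length L) j (linWeight L Ψ X))))

-- Signs and zeros of weighted sums

*-nonNeg : ∀ {a b} → 0ℤ ≤ᶻ a → 0ℤ ≤ᶻ b → 0ℤ ≤ᶻ a *ᶻ b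
*-nonNeg {pos a} {pos b} _ _ = subst (0ℤ ≤ᶻ_) (ℤₚ.pos-* a b) (ℤ.+≤+ z≤n)

square-nonNeg : ∀ a → 0ℤ ≤ᶻ a *ᶻ a
square-nonNeg (pos a)      = *-nonNeg {pos a} {pos a} (ℤ.+≤+ z≤n) (ℤ.+≤+ z≤n)
square-nonNeg ℤ.-[1+ a ]   = ℤ.+≤+ z≤n

ind-nonNeg : ∀ b → 0ℤ ≤ᶻ ind b
ind-nonNeg b = ℤ.+≤+ z≤n

+-zero : ∀ {a b} → 0ℤ ≤ᶻ a → 0ℤ ≤ᶻ b → a +ᶻ b ≡ 0ℤ → a ≡ 0ℤ × b ≡ 0ℤ
+-zero {pos a} {pos b} _ _ eq = cong pos (ℕₚ.m+n≡0⇒m≡0 a (ℤₚ.+-injective eq)) ,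
  cong pos (ℕₚ.m+n≡0⇒n≡0 a (ℤₚ.+-injective eq))

*-≢0 : ∀ {a b} → a ≢ 0ℤ → b ≢ 0ℤ → a *ᶻ b ≢ 0ℤ
*-≢0 {a} a≢0 b≢0 eq with ℤₚ.i*j≡0⇒i≡0∨j≡0 a eq
... | inj₁ a≡0 = a≢0 a≡0
... | inj₂ b≡0 = b≢0 b≡0

*-≢0ˡ : ∀ {a b} → a *ᶻ b ≢ 0ℤ → a ≢ 0ℤ
*-≢0ˡ ab≢0 refl = ab≢0 refl

*-≢0ʳ : ∀ {a b} → a *ᶻ b ≢ 0ℤ → b ≢ 0ℤ
*-≢0ʳ {a} ab≢0 refl = ab≢0 (ℤₚ.*-zeroʳ a)

sum-nonNeg : {f : Fin n → ℤ} → (∀ x → 0ℤ ≤ᶻ f x) → 0ℤ ≤ᶻ sum f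
sum-nonNeg {zero}  f≥0 = ℤₚ.≤-refl
sum-nonNeg {suc n} f≥0 = ℤₚ.+-mono-≤ (f≥0 zero) (sum-nonNeg (f≥0 ∘ suc))

sum-zero : {f : Fin n → ℤ} → (∀ x → 0ℤ ≤ᶻ f x) → sum f ≡ 0ℤ → ∀ x → f x ≡ 0ℤ
sum-zero {suc n} f≥0 eq zero    = proj₁ (+-zero (f≥0 zero) (sum-nonNeg (f≥0 ∘ suc)) eq)
sum-zero {suc n} f≥0 eq (suc x) =
  sum-zero (f≥0 ∘ suc) (proj₂ (+-zero (f≥0 zero) (sum-nonNeg (f≥0 ∘ suc)) eq)) x

sum-witness : (f : Fin n → ℤ) → sum f ≢ 0ℤ → ∃ λ x → f x ≢ 0ℤ
sum-witness {zero}  f ≢0 = contradiction refl ≢0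
sum-witness {suc n} f ≢0 with f zero ℤ.≟ 0ℤ
... | no  f0≢0 = zero , f0≢0
... | yes f0≡0 = let x , fx = sum-witness (f ∘ suc) λ eq → ≢0 (cong₂ _+ᶻ_ f0≡0 eq) in suc x , fx

sumV-nonNeg : ∀ r {f : Vec (Fin n) r → ℤ} → (∀ t → 0ℤ ≤ᶻ f t) → 0ℤ ≤ᶻ sumV r f
sumV-nonNeg zero    f≥0 = f≥0 []
sumV-nonNeg (suc r) f≥0 = sum-nonNeg λ x → sumV-nonNeg r λ t → f≥0 (x ∷ t)

sumV-all-zero : ∀ r {f : Vec (Fin n) r → ℤ} → (∀ t → 0ℤ ≤ᶻ f t) → sumV r f ≡ 0ℤ → ∀ t → f t ≡ 0ℤ
sumV-all-zero zero    f≥0 eq []      = eq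
sumV-all-zero (suc r) f≥0 eq (x ∷ t) =
  sumV-all-zero r (λ t → f≥0 (x ∷ t)) (sum-zero (λ x → sumV-nonNeg r λ t → f≥0 (x ∷ t)) eq x) t

sumV-witness : ∀ r (f : Vec (Fin n) r → ℤ) → sumV r f ≢ 0ℤ → ∃ λ t → f t ≢ 0ℤ
sumV-witness zero    f ≢0 = [] , ≢0
sumV-witness (suc r) f ≢0 with sum-witness (λ x → sumV r λ t → f (x ∷ t)) ≢0
... | x , sx≢0 = let t , ft = sumV-witness r (λ t → f (x ∷ t)) sx≢0 in x ∷ t , ft

-- This carries universal statements from G to H: the sum vanishes for G, hence for H, and there a
-- vanishing sum of nonnegative terms vanishes termwise.
transfer-zero : ∀ {ℓ} (L : Factors j) (Ψ : Weight j) → Invariant Ψ → (H G : Graph n) → SameDeck ℓ H G →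
  length L + j ≤ ℓ → ℓ ≤ n → (∀ t → 0ℤ ≤ᶻ Ψ H t *ᶻ lin H L t) → (∀ t → Ψ G t *ᶻ lin G L t ≡ 0ℤ) →
  ∀ t → Ψ H t *ᶻ lin H L t ≡ 0ℤ
transfer-zero {j} L Ψ inv H G deck e+j≤ℓ ℓ≤n ≥0 ≡0 = sumV-all-zero j ≥0
  (trans (degree-sum-≡ L Ψ inv H G deck e+j≤ℓ ℓ≤n) (trans (sumV-cong j ≡0) (sumV-zero j)))

lin-++ : (G : Graph n) (L M : Factors j) (t : Vec (Fin n) j) → lin G (L ++ M) t ≡ lin G L t *ᶻ lin G M t
lin-++ G []            M t = sym (ℤₚ.*-identityˡ (lin G M t))
lin-++ G ((i , c) ∷ L) M t = trans (cong ((c -ᶻ pos (degree G (lookup t i))) *ᶻ_) (lin-++ G L M t))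
  (sym (ℤₚ.*-assoc (c -ᶻ pos (degree G (lookup t i))) _ _))

lin-vanish : (G : Graph n) {L : Factors j} {t : Vec (Fin n) j} {i : Fin j} {d : ℕ} →
  (i , pos d) ∈ L → degree G (lookup t i) ≡ d → lin G L t ≡ 0ℤ
lin-vanish G {(i , _) ∷ L} {t} (here refl) refl =
  cong (_*ᶻ lin G L t) (ℤₚ.+-inverseʳ (pos (degree G (lookup t i))))
lin-vanish G {(i′ , c) ∷ L} {t} (there i∈L) eq =
  trans (cong ((c -ᶻ pos (degree G (lookup t i′))) *ᶻ_) (lin-vanish G {L} {t} i∈L eq))
  (ℤₚ.*-zeroʳ (c -ᶻ pos (degree G (lookup t i′))))

lin-≢0 : (G : Graph n) {L : Factors j} {t : Vec (Fin n) j} →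
  (∀ {i c} → (i , c) ∈ L → pos (degree G (lookup t i)) ≢ c) → lin G L t ≢ 0ℤ
lin-≢0 G {[]}          {t} ≢c ()
lin-≢0 G {(i , c) ∷ L} {t} ≢c = *-≢0 (λ eq → ≢c (here refl) (sym (ℤₚ.i-j≡0⇒i≡j c _ eq)))
  (lin-≢0 G {L} {t} (≢c ∘ there))

lin-≡0 : (G : Graph n) (L : Factors j) (t : Vec (Fin n) j) → lin G L t ≡ 0ℤ →
  ∃₂ λ i c → (i , c) ∈ L × pos (degree G (lookup t i)) ≡ c
lin-≡0 G []            t ()
lin-≡0 G ((i , c) ∷ L) t eq with ℤₚ.i*j≡0⇒i≡0∨j≡0 (c -ᶻ pos (degree G (lookup t i))) eq
... | inj₁ z = i , c , here refl , sym (ℤₚ.i-j≡0⇒i≡j c _ z)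
... | inj₂ z = let i′ , c′ , ∈L , e = lin-≡0 G L t z in i′ , c′ , there ∈L , e

-- Caterpillars described by their spine

-- Degree 0 counts as nonleaf, following `isNotLeaf`. Isolated vertices of H are excluded only
-- later, through the list of degrees.
nl : Graph n → Fin n → Bool
nl G v = isNotLeaf (degree G v)

nl-false : (G : Graph n) {v : Fin n} → nl G v ≡ false → degree G v ≡ 1
nl-false G {v} eq with degree G v
... | suc zero = refl

nl-degree : (G : Graph n) {v : Fin n} → nl G v ≡ true → degree G v ≢ 1
nl-degree G {v} eq d≡1 rewrite d≡1 = contradiction eq λ ()

adj-swap : (G : Graph n) {x y : Fin n} → adj G x y ≡ true → adj G y x ≡ true
adj-swap G {x} {y} e = trans (adj-sym G y x) e

leaf-unique : (G : Graph n) {v x y : Fin n} → nl G v ≡ false → adj G v x ≡ true → adj G v y ≡ true → x ≡ y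
leaf-unique G {v} leaf = count-unique (adj G v) (ℕₚ.≤-reflexive (nl-false G leaf))

two-neighbours : (G : Graph n) {v x y : Fin n} → adj G v x ≡ true → adj G v y ≡ true → x ≢ y → nl G v ≡ true
two-neighbours G {v} vx vy x≢y with nl G v in eq
... | true  = refl
... | false = contradiction (leaf-unique G eq vx vy) x≢y

nlNbr : Graph n → Fin n → Fin n → Bool
nlNbr G v x = adj G v x ∧ nl G x

ν : Graph n → Fin n → ℕ
ν G v = countTrue (nlNbr G v)

Consec : ℕ → ℕ → Set
Consec i j = j ≡ suc i ⊎ i ≡ suc j

-- Indexing by ℕ makes shifting, reversing and extending easy; the values of p from k on are
-- arbitrary. The field `attached` rules out components made of two adjacent leaves.
record Spine (G : Graph n) (k : ℕ) (p : ℕ → Fin n) : Set where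
  field
    inj        : InjBelow k p
    nonleaf    : ∀ i → i < k → nl G (p i) ≡ true
    covers     : ∀ {v} → nl G v ≡ true → ∃ λ i → i < k × p i ≡ v
    adj⇒consec : ∀ i j → i < k → j < k → adj G (p i) (p j) ≡ true → Consec i j
    consec⇒adj : ∀ i → suc i < k → adj G (p i) (p (suc i)) ≡ true
    attached   : ∀ {v} → nl G v ≡ false → ∃ λ i → i < k × adj G v (p i) ≡ true

rev : ℕ → (ℕ → Fin n) → ℕ → Fin n
rev k p i = p (k ∸ suc i)

rev-< : ∀ {k i} → i < k → k ∸ suc i < k
rev-< {k} {i} i<k = ℕₚ.∸-monoʳ-< {k} {suc i} {0} (s≤s z≤n) i<k

rev-rev : ∀ {k i} → i < k → k ∸ suc (k ∸ suc i) ≡ i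
rev-rev {suc k} {i} (s≤s i≤k) = ℕₚ.m∸[m∸n]≡n i≤k

rev-suc : ∀ {k i} → suc i < k → k ∸ suc i ≡ suc (k ∸ suc (suc i))
rev-suc {suc k} {i} (s≤s i<k) = ℕₚ.+-∸-assoc 1 i<k

rev-consec : ∀ {k i j} → i < k → j < k → k ∸ suc j ≡ suc (k ∸ suc i) → i ≡ suc j
rev-consec {k} {i} {j} i<k j<k eq = begin
  i                                ≡⟨ sym (rev-rev i<k) ⟩
  k ∸ suc (k ∸ suc i)              ≡⟨ rev-suc (subst (_< k) eq (rev-< j<k)) ⟩
  suc (k ∸ suc (suc (k ∸ suc i)))  ≡⟨ cong (λ a → suc (k ∸ suc a)) (sym eq) ⟩
  suc (k ∸ suc (k ∸ suc j))        ≡⟨ cong suc (rev-rev j<k) ⟩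
  suc j                            ∎
  where open ≡-Reasoning

rev-inj : ∀ {k} {p : ℕ → Fin n} → InjBelow k p → InjBelow k (rev k p)
rev-inj {k = k} inj i j i<k j<k eq = begin
  i                    ≡⟨ sym (rev-rev i<k) ⟩
  k ∸ suc (k ∸ suc i)  ≡⟨ cong (λ a → k ∸ suc a) (inj _ _ (rev-< i<k) (rev-< j<k) eq) ⟩
  k ∸ suc (k ∸ suc j)  ≡⟨ rev-rev j<k ⟩
  j                    ∎
  where open ≡-Reasoning

Spine-rev : ∀ {G : Graph n} {k p} → Spine G k p → Spine G k (rev k p)
Spine-rev {G = G} {k} {p} S = record
  { inj        = rev-inj inj
  ; nonleaf    = λ i i<k → nonleaf _ (rev-< i<k)
  ; covers     = λ nlv → reindex (covers nlv)
  ; adj⇒consec = λ i j i<k j<k e → consec i<k j<k (adj⇒consec _ _ (rev-< i<k) (rev-< j<k) e)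
  ; consec⇒adj = λ i si<k → adj-swap G (subst (λ a → adj G (p (k ∸ suc (suc i))) (p a) ≡ true)
      (sym (rev-suc si<k))
      (consec⇒adj _ (subst (_< k) (rev-suc si<k) (rev-< (ℕₚ.<⇒≤ si<k)))))
  ; attached   = λ {v} leaf → reattach (attached leaf)
  }
  where
  open Spine S
  reindex : ∀ {v} → (∃ λ i → i < k × p i ≡ v) → ∃ λ i → i < k × rev k p i ≡ v
  reindex (i , i<k , eq) = k ∸ suc i , rev-< i<k , trans (cong p (rev-rev i<k)) eq
  reattach : ∀ {v} → (∃ λ i → i < k × adj G v (p i) ≡ true) → ∃ λ i → i < k × adj G v (rev k p i) ≡ true
  reattach {v} (i , i<k , e) = k ∸ suc i , rev-< i<k , subst (λ a → adj G v (p a) ≡ true) (sym (rev-rev i<k)) e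
  consec : ∀ {i j} → i < k → j < k → Consec (k ∸ suc i) (k ∸ suc j) → Consec i j
  consec i<k j<k (inj₁ eq) = inj₂ (rev-consec i<k j<k eq)
  consec i<k j<k (inj₂ eq) = inj₁ (rev-consec j<k i<k eq)

-- Paths in a graph and along a spine

pathᵇ : Graph n → Vec (Fin n) r → Bool
pathᵇ G []          = true
pathᵇ G (x ∷ [])    = true
pathᵇ G (x ∷ y ∷ t) = adj G x y ∧ (not (x ∈ᵇ (y ∷ t)) ∧ pathᵇ G (y ∷ t))

path-uncons : (G : Graph n) (x y : Fin n) (t : Vec (Fin n) r) → pathᵇ G (x ∷ y ∷ t) ≡ true →
  adj G x y ≡ true × x ∈ᵇ (y ∷ t) ≡ false × pathᵇ G (y ∷ t) ≡ true
path-uncons G x y t e with ∧-elim (adj G x y) e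
... | xy , e′ with ∧-elim (not (x ∈ᵇ (y ∷ t))) e′
... | x∉ , e″ = xy , not-true x∉ , e″
  where
  not-true : ∀ {b} → not b ≡ true → b ≡ false
  not-true {false} _ = refl

∈ᵇ-lookup : (t : Vec (Fin n) r) (i : Fin r) → lookup t i ∈ᵇ t ≡ true
∈ᵇ-lookup (x ∷ t) zero    rewrite eqᵇ-refl x = refl
∈ᵇ-lookup (x ∷ t) (suc i) rewrite ∈ᵇ-lookup t i = Boolₚ.∨-zeroʳ _

∉ᵇ⇒≢ : {x : Fin n} {t : Vec (Fin n) r} → x ∈ᵇ t ≡ false → ∀ i → x ≢ lookup t i
∉ᵇ⇒≢ {t = t} x∉t i refl = true≢false (∈ᵇ-lookup t i) x∉t

-- An inner vertex has two distinct neighbours on the path, so only the ends need a test. This keeps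
-- the number of linear factors for a path of nonleaves independent of its length.
path-nonleaf : (G : Graph n) (t : Vec (Fin n) (suc r)) → pathᵇ G t ≡ true →
  nl G (lookup t zero) ≡ true → nl G (lookup t (fromℕ r)) ≡ true → ∀ i → nl G (lookup t i) ≡ true
path-nonleaf G (x ∷ [])        path first last zero       = first
path-nonleaf G (x ∷ y ∷ [])    path first last zero       = first
path-nonleaf G (x ∷ y ∷ [])    path first last (suc zero) = last
path-nonleaf G (x ∷ y ∷ z ∷ t) path first last zero       = first
path-nonleaf G (x ∷ y ∷ z ∷ t) path first last (suc i)    with path-uncons G x y (z ∷ t) path
... | xy , x∉ , path′ = path-nonleaf G (y ∷ z ∷ t) path′
  (two-neighbours G (adj-swap G xy) (proj₁ (path-uncons G y z t path′)) (∉ᵇ⇒≢ {t = y ∷ z ∷ t} x∉ (suc zero)))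
  last i

seg : (ℕ → Fin n) → ℕ → ∀ r → Vec (Fin n) r
seg p i zero    = []
seg p i (suc r) = p i ∷ seg p (suc i) r

seg-lookup : ∀ (p : ℕ → Fin n) i r (a : Fin r) → lookup (seg p i r) a ≡ p (i + toℕ a)
seg-lookup p i (suc r) zero    = cong p (sym (ℕₚ.+-identityʳ i))
seg-lookup p i (suc r) (suc a) = trans (seg-lookup p (suc i) r a) (cong p (sym (ℕₚ.+-suc i (toℕ a))))

seg-∉ : ∀ {k} {p : ℕ → Fin n} → InjBelow k p → ∀ i a r → i < a → a + r ≤ k → p i ∈ᵇ seg p a r ≡ false
seg-∉ {p = p} inj i a zero    i<a a+r≤k = refl
seg-∉ {k = k} {p} inj i a (suc r) i<a a+r≤k = cong₂ _∨_
  (eqᵇ-≢ (λ e → ℕₚ.<⇒≢ i<a (inj i a (ℕₚ.<-trans i<a a<k) a<k e)))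
  (seg-∉ inj i (suc a) r (ℕₚ.m<n⇒m<1+n i<a) (subst (_≤ k) (ℕₚ.+-suc a r) a+r≤k))
  where
  a<k : a < k
  a<k = ℕₚ.≤-trans (s≤s (ℕₚ.m≤m+n a r)) (subst (_≤ k) (ℕₚ.+-suc a r) a+r≤k)

record Trail (G : Graph n) (k : ℕ) (p : ℕ → Fin n) : Set where
  field
    inj     : InjBelow k p
    nonleaf : ∀ i → i < k → nl G (p i) ≡ true
    links   : ∀ i → suc i < k → adj G (p i) (p (suc i)) ≡ true
    start   : ν G (p 0) ≤ 1

EndPath : Graph n → Vec (Fin n) (suc r) → Set
EndPath {r = r} G t = pathᵇ G t ≡ true × nl G (lookup t zero) ≡ true ×
  nl G (lookup t (fromℕ r)) ≡ true × ν G (lookup t zero) ≤ 1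

seg-path : ∀ {G : Graph n} {k p} → Trail G k p → ∀ i r → i + r ≤ k → pathᵇ G (seg p i r) ≡ true
seg-path T i zero          i+r≤k = refl
seg-path T i (suc zero)    i+r≤k = refl
seg-path {k = k} T i (suc (suc r)) i+r≤k = ∧-intro (links i 1+i<k)
  (∧-intro (cong not (seg-∉ inj i (suc i) (suc r) (ℕₚ.n<1+n i) 1+i+r≤k)) (seg-path T (suc i) (suc r) 1+i+r≤k))
  where
  open Trail T
  1+i+r≤k : suc i + suc r ≤ k
  1+i+r≤k = subst (_≤ k) (ℕₚ.+-suc i (suc r)) i+r≤k
  1+i<k : suc i < k
  1+i<k = ℕₚ.≤-trans (s≤s (s≤s (ℕₚ.m≤m+n i r))) (subst (λ a → suc a ≤ k) (ℕₚ.+-suc i r) 1+i+r≤k)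

seg-endPath : ∀ {G : Graph n} {k p} → Trail G k p → ∀ r → suc r ≤ k → EndPath G (seg p 0 (suc r))
seg-endPath {G = G} {k} {p} T r r<k = seg-path T 0 (suc r) r<k , nonleaf 0 (ℕₚ.≤-trans (s≤s z≤n) r<k) ,
  subst (λ v → nl G v ≡ true) (sym (seg-lookup p 0 (suc r) (fromℕ r)))
    (nonleaf _ (subst (_< k) (sym (Finₚ.toℕ-fromℕ r)) r<k)) ,
  start
  where open Trail T

module _ {G : Graph n} {k : ℕ} {p : ℕ → Fin n} (S : Spine G k p) where
  open Spine S

  nlNbr-index : ∀ {i x} → i < k → nlNbr G (p i) x ≡ true → ∃ λ j → j < k × p j ≡ x × Consec i j
  nlNbr-index {i} {x} i<k e with ∧-elim (adj G (p i) x) e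
  ... | ix , nlx with covers nlx
  ... | j , j<k , refl = j , j<k , refl , adj⇒consec i j i<k j<k ix

  next-nlNbr : ∀ {i} → suc i < k → nlNbr G (p i) (p (suc i)) ≡ true
  next-nlNbr {i} 1+i<k = ∧-intro (consec⇒adj i 1+i<k) (nonleaf (suc i) 1+i<k)

  prev-nlNbr : ∀ {i} → suc i < k → nlNbr G (p (suc i)) (p i) ≡ true
  prev-nlNbr {i} 1+i<k = ∧-intro (adj-swap G (consec⇒adj i 1+i<k)) (nonleaf i (ℕₚ.<⇒≤ 1+i<k))

  spine-trail : 1 ≤ k → Trail G k p
  spine-trail 1≤k = record { inj = inj ; nonleaf = nonleaf ; links = consec⇒adj ; start = count-≤1 _ uniq }
    where
    uniq : ∀ {x y} → nlNbr G (p 0) x ≡ true → nlNbr G (p 0) y ≡ true → x ≡ y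
    uniq ex ey with nlNbr-index 1≤k ex | nlNbr-index 1≤k ey
    ... | _ , _ , refl , inj₁ refl | _ , _ , refl , inj₁ refl = refl

  -- From index i the path can move only to i - 1 or i + 1. The last hypothesis forbids going back,
  -- and it passes to the tail because a path repeats no vertex.
  follow : (t : Vec (Fin n) (suc r)) → pathᵇ G t ≡ true → (∀ a → nl G (lookup t a) ≡ true) →
    ∀ i → i < k → lookup t zero ≡ p i → (∀ j → i ≡ suc j → p j ∈ᵇ t ≡ false) →
    t ≡ seg p i (suc r) × i + suc r ≤ k
  follow (x ∷ []) path nlt i i<k refl back = refl , subst (_≤ k) (ℕₚ.+-comm 1 i) i<k
  follow {r = suc r} (x ∷ y ∷ t) path nlt i i<k refl back with path-uncons G x y t path
  ... | xy , x∉ , path′ with covers (nlt (suc zero))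
  ... | j , j<k , refl with adj⇒consec i j i<k j<k xy
  ... | inj₂ refl = contradiction refl (∉ᵇ⇒≢ {t = p i ∷ p j ∷ t} (back j refl) (suc zero))
  ... | inj₁ refl with follow (y ∷ t) path′ (nlt ∘ suc) (suc i) j<k refl (λ { _ refl → x∉ })
  ... | eq , bound = cong (p i ∷_) eq , subst (_≤ k) (sym (ℕₚ.+-suc i (suc r))) bound

follow-start : ∀ {G : Graph n} {k p} → Spine G k p → (t : Vec (Fin n) (suc r)) → EndPath G t →
  0 < k → lookup t zero ≡ p 0 → t ≡ seg p 0 (suc r)
follow-start {G = G} S t (path , first , last , _) 0<k eq =
  proj₁ (follow S t path (path-nonleaf G t path first last) 0 0<k eq λ _ ())

-- An inner spine vertex has two distinct nonleaf neighbours, so ν ≤ 1 forces a start at one of the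
-- two ends, and from there the path is determined.
endPath-spine : ∀ {G : Graph n} {k p} → Spine G k p → (t : Vec (Fin n) (suc r)) → EndPath G t →
  t ≡ seg p 0 (suc r) ⊎ t ≡ seg (rev k p) 0 (suc r)
endPath-spine {n} {r} {G} {k} {p} S t ep@(_ , first , _ , ν≤1) with Spine.covers S first
... | i , i<k , eq = cases i i<k eq
  where
  open Spine S
  cases : ∀ i → i < k → p i ≡ lookup t zero → t ≡ seg p 0 (suc r) ⊎ t ≡ seg (rev k p) 0 (suc r)
  cases zero    0<k eq = inj₁ (follow-start S t ep 0<k (sym eq))
  cases (suc i) i<k eq with ℕₚ.m≤n⇒m<n∨m≡n i<k
  ... | inj₂ refl = inj₂ (follow-start (Spine-rev S) t ep (s≤s z≤n) (sym eq))
  ... | inj₁ 2+i<k = contradiction (inj _ _ (ℕₚ.<⇒≤ i<k) 2+i<k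
      (count-unique (nlNbr G (p (suc i))) (subst (λ v → ν G v ≤ 1) (sym eq) ν≤1) (prev-nlNbr S i<k) (next-nlNbr S 2+i<k)))
    λ ()

ThreeFree : Graph n → Set
ThreeFree G = ∀ c {x y z} → nlNbr G c x ≡ true → nlNbr G c y ≡ true → nlNbr G c z ≡ true →
  x ≢ y → x ≢ z → y ≡ z

spine-threeFree : ∀ {G : Graph n} {k p} → Spine G k p → ThreeFree G
spine-threeFree {G = G} S c {x} {y} {z} ex ey ez x≢y x≢z with nl G c in eq
... | false = contradiction
  (leaf-unique G eq (proj₁ (∧-elim (adj G c x) ex)) (proj₁ (∧-elim (adj G c y) ey))) x≢y
... | true with Spine.covers S eq
... | i , i<k , refl with nlNbr-index S i<k ex | nlNbr-index S i<k ey | nlNbr-index S i<k ez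
... | _ , _ , refl , inj₁ refl | _ , _ , refl , inj₁ refl | _ = contradiction refl x≢y
... | _ , _ , refl , inj₁ refl | _ , _ , refl , inj₂ refl | _ , _ , refl , inj₁ refl = contradiction refl x≢z
... | _ , _ , refl , inj₁ refl | _ , _ , refl , inj₂ refl | _ , _ , refl , inj₂ refl = refl
... | _ , _ , refl , inj₂ refl | _ , _ , refl , inj₁ refl | _ , _ , refl , inj₁ refl = refl
... | _ , _ , refl , inj₂ refl | _ , _ , refl , inj₁ refl | _ , _ , refl , inj₂ refl = contradiction refl x≢z
... | _ , _ , refl , inj₂ refl | _ , _ , refl , inj₂ refl | _ = contradiction refl x≢y

-- Extending an end path to a maximal trail

nth : Vec (Fin n) (suc r) → ℕ → Fin n
nth (x ∷ t)     zero    = x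
nth (x ∷ [])    (suc i) = x
nth (x ∷ y ∷ t) (suc i) = nth (y ∷ t) i

nth-lookup : (t : Vec (Fin n) (suc r)) (i : Fin (suc r)) → nth t (toℕ i) ≡ lookup t i
nth-lookup (x ∷ t)     zero    = refl
nth-lookup (x ∷ y ∷ t) (suc i) = nth-lookup (y ∷ t) i

nth-∈ : (t : Vec (Fin n) (suc r)) → ∀ i → i < suc r → ∃ λ a → nth t i ≡ lookup t a
nth-∈ t i i<r = fromℕ< i<r , trans (cong (nth t) (sym (Finₚ.toℕ-fromℕ< i<r))) (nth-lookup t (fromℕ< i<r))

nth-adj : (G : Graph n) (t : Vec (Fin n) (suc r)) → pathᵇ G t ≡ true →
  ∀ i → suc i < suc r → adj G (nth t i) (nth t (suc i)) ≡ true
nth-adj G (x ∷ [])        path i       (s≤s ())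
nth-adj G (x ∷ y ∷ t)     path zero    _         = proj₁ (path-uncons G x y t path)
nth-adj G (x ∷ y ∷ t)     path (suc i) (s≤s i<r) =
  nth-adj G (y ∷ t) (proj₂ (proj₂ (path-uncons G x y t path))) i i<r

nth-inj : (G : Graph n) (t : Vec (Fin n) (suc r)) → pathᵇ G t ≡ true → InjBelow (suc r) (nth t)
nth-inj G t       path zero    zero    _ _ _ = refl
nth-inj G (x ∷ y ∷ t) path zero    (suc j) _ (s≤s j<r) eq = let a , e = nth-∈ (y ∷ t) j j<r in
  contradiction (trans eq e) (∉ᵇ⇒≢ {t = y ∷ t} (proj₁ (proj₂ (path-uncons G x y t path))) a)
nth-inj G (x ∷ y ∷ t) path (suc i) zero    (s≤s i<r) _ eq = let a , e = nth-∈ (y ∷ t) i i<r in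
  contradiction (trans (sym eq) e) (∉ᵇ⇒≢ {t = y ∷ t} (proj₁ (proj₂ (path-uncons G x y t path))) a)
nth-inj G (x ∷ [])    path (suc i) _       (s≤s ()) _ eq
nth-inj G (x ∷ [])    path zero    (suc j) _ (s≤s ()) eq
nth-inj G (x ∷ y ∷ t) path (suc i) (suc j) (s≤s i<r) (s≤s j<r) eq =
  cong suc (nth-inj G (y ∷ t) (proj₂ (proj₂ (path-uncons G x y t path))) i j i<r j<r eq)

endPath-trail : (G : Graph n) (t : Vec (Fin n) (suc r)) → EndPath G t → Trail G (suc r) (nth t)
endPath-trail G t@(_ ∷ _) (path , first , last , ν≤1) = record
  { inj     = nth-inj G t path
  ; nonleaf = λ i i<r → let a , e = nth-∈ t i i<r in
      subst (λ v → nl G v ≡ true) (sym e) (path-nonleaf G t path first last a)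
  ; links   = nth-adj G t path
  ; start   = ν≤1
  }

OnTrail : ℕ → (ℕ → Fin n) → Fin n → Set
OnTrail k p y = ∃ λ i → i < k × p i ≡ y

-- The trail is then a whole component of the graph induced by the nonleaves.
Closed : Graph n → ℕ → (ℕ → Fin n) → Set
Closed G k p = ∀ {i y} → i < k → nlNbr G (p i) y ≡ true → OnTrail k p y

snoc : ℕ → (ℕ → Fin n) → Fin n → ℕ → Fin n
snoc k p y i with i <? k
... | yes _ = p i
... | no  _ = y

snoc-< : ∀ {k} {p : ℕ → Fin n} {y i} → i < k → snoc k p y i ≡ p i
snoc-< {k = k} {i = i} i<k with i <? k
... | yes _  = refl
... | no i≮k = contradiction i<k i≮k

snoc-last : ∀ k {p : ℕ → Fin n} {y} → snoc k p y k ≡ y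
snoc-last k with k <? k
... | yes k<k = contradiction refl (ℕₚ.<⇒≢ k<k)
... | no _    = refl

below-suc : ∀ {i k} → i < suc k → i < k ⊎ i ≡ k
below-suc i<1+k = ℕₚ.m≤n⇒m<n∨m≡n (ℕₚ.≤-pred i<1+k)

trail-snoc : ∀ {G : Graph n} {k p y} → Trail G (suc k) p → nlNbr G (p k) y ≡ true → ¬ OnTrail (suc k) p y →
  Trail G (suc (suc k)) (snoc (suc k) p y)
trail-snoc {n} {G} {k} {p} {y} T e fresh = record
  { inj     = λ i j i< j< → inj′ (below-suc i<) (below-suc j<)
  ; nonleaf = λ i i< → nonleaf′ (below-suc i<)
  ; links   = λ i i< → links′ (below-suc i<)
  ; start   = subst (λ v → ν G v ≤ 1) (sym (snoc-< {k = suc k} {p} {y} {0} (s≤s z≤n))) start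
  }
  where
  open Trail T
  q = snoc (suc k) p y
  old : ∀ {i} → i < suc k → q i ≡ p i
  old = snoc-<
  new : q (suc k) ≡ y
  new = snoc-last (suc k) {p}
  inj′ : ∀ {i j} → i < suc k ⊎ i ≡ suc k → j < suc k ⊎ j ≡ suc k → q i ≡ q j → i ≡ j
  inj′ (inj₁ i<) (inj₁ j<) eq = inj _ _ i< j< (trans (sym (old i<)) (trans eq (old j<)))
  inj′ (inj₁ i<) (inj₂ refl) eq = contradiction (_ , i< , trans (sym (old i<)) (trans eq new)) fresh
  inj′ (inj₂ refl) (inj₁ j<) eq = contradiction (_ , j< , trans (sym (old j<)) (trans (sym eq) new)) fresh
  inj′ (inj₂ refl) (inj₂ refl) eq = refl
  nonleaf′ : ∀ {i} → i < suc k ⊎ i ≡ suc k → nl G (q i) ≡ true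
  nonleaf′ (inj₁ i<)   = subst (λ v → nl G v ≡ true) (sym (old i<)) (nonleaf _ i<)
  nonleaf′ (inj₂ refl) = subst (λ v → nl G v ≡ true) (sym new) (proj₂ (∧-elim (adj G (p k) y) e))
  links′ : ∀ {i} → suc i < suc k ⊎ suc i ≡ suc k → adj G (q i) (q (suc i)) ≡ true
  links′ (inj₁ i<)   = subst₂ (λ v w → adj G v w ≡ true) (sym (old (ℕₚ.<⇒≤ i<))) (sym (old i<)) (links _ i<)
  links′ (inj₂ refl) = subst₂ (λ v w → adj G v w ≡ true) (sym (old (ℕₚ.n<1+n k))) (sym new)
    (proj₁ (∧-elim (adj G (p k) y) e))

trail-≤ : ∀ {G : Graph n} {k p} → Trail G k p → k ≤ n
trail-≤ {p = p} T = Finₚ.injective⇒≤ {f = p ∘ toℕ} λ {i} {j} eq →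
  Finₚ.toℕ-injective (Trail.inj T (toℕ i) (toℕ j) (Finₚ.toℕ<n i) (Finₚ.toℕ<n j) eq)

module _ {G : Graph n} (three-free : ThreeFree G) where

  -- The lower vertex has no room for a chord: the start has p 1 as its only nonleaf neighbour, and
  -- any later one already has its predecessor and its successor, so a third would contradict
  -- three-freeness.
  trail-adj-< : ∀ {k p} → Trail G k p → ∀ i j → i < j → j < k → adj G (p i) (p j) ≡ true → j ≡ suc i
  trail-adj-< {k} {p} T zero j 0<j j<k e = inj _ _ j<k 1<k
    (count-unique (nlNbr G (p 0)) start (∧-intro e (nonleaf j j<k)) (∧-intro (links 0 1<k) (nonleaf 1 1<k)))
    where
    open Trail T
    1<k = ℕₚ.≤-<-trans 0<j j<k
  trail-adj-< {k} {p} T (suc i) j i<j j<k e = sym (inj _ _ 2+i<k j<k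
    (three-free (p (suc i)) (∧-intro (adj-swap G (links i 1+i<k)) (nonleaf i i<k))
      (∧-intro (links (suc i) 2+i<k) (nonleaf _ 2+i<k)) (∧-intro e (nonleaf j j<k))
      (λ eq → ℕₚ.<⇒≢ (ℕₚ.m≤n⇒m≤1+n (ℕₚ.n<1+n i)) (inj _ _ i<k 2+i<k eq))
      (λ eq → ℕₚ.<⇒≢ (ℕₚ.<-trans (ℕₚ.n<1+n i) i<j) (inj _ _ i<k j<k eq))))
    where
    open Trail T
    2+i<k = ℕₚ.≤-<-trans i<j j<k
    1+i<k = ℕₚ.<⇒≤ 2+i<k
    i<k = ℕₚ.<⇒≤ 1+i<k

  trail-adj : ∀ {k p} → Trail G k p → ∀ i j → i < k → j < k → adj G (p i) (p j) ≡ true → Consec i j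
  trail-adj {p = p} T i j i<k j<k e with i <? j
  ... | yes i<j = inj₁ (trail-adj-< T i j i<j j<k e)
  ... | no i≮j with ℕₚ.m≤n⇒m<n∨m≡n (ℕₚ.≮⇒≥ i≮j)
  ... | inj₁ j<i  = inj₂ (trail-adj-< T j i j<i i<k (adj-swap G e))
  ... | inj₂ refl = contradiction (adj-irrefl G (p i)) (true≢false e)

  -- All vertices but the last have their nonleaf neighbours used up by the trail itself, so only
  -- the last one has to be tested.
  stuck-closed : ∀ {k p} → Trail G (suc k) p →
    (∀ {y} → nlNbr G (p k) y ≡ true → OnTrail (suc k) p y) → Closed G (suc k) p
  stuck-closed {k} {p} T stuck {i} {y} i<1+k e with below-suc i<1+k
  ... | inj₂ refl = stuck e
  ... | inj₁ i<k  = earlier i i<k e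
    where
    open Trail T
    earlier : ∀ i → i < k → nlNbr G (p i) y ≡ true → OnTrail (suc k) p y
    earlier zero 0<k e = 1 , s≤s 0<k ,
      count-unique (nlNbr G (p 0)) start (∧-intro (links 0 (s≤s 0<k)) (nonleaf 1 (s≤s 0<k))) e
    earlier (suc i) 1+i<k e with p i ≟ y
    ... | yes eq = i , ℕₚ.<-trans (ℕₚ.n<1+n i) (ℕₚ.m<n⇒m<1+n 1+i<k) , eq
    ... | no ne  = suc (suc i) , s≤s 1+i<k ,
      three-free (p (suc i)) (∧-intro (adj-swap G (links i 1+i<1+k)) (nonleaf i (ℕₚ.<⇒≤ 1+i<1+k)))
        (∧-intro (links (suc i) (s≤s 1+i<k)) (nonleaf _ (s≤s 1+i<k))) e
        (λ eq → ℕₚ.<⇒≢ (ℕₚ.m≤n⇒m≤1+n (ℕₚ.n<1+n i)) (inj _ _ (ℕₚ.<⇒≤ 1+i<1+k) (s≤s 1+i<k) eq)) ne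
      where 1+i<1+k = ℕₚ.m<n⇒m<1+n 1+i<k

  Extension : ℕ → (ℕ → Fin n) → Set
  Extension k p = ∃₂ λ k′ p′ → k ≤ k′ × Trail G k′ p′ × Closed G k′ p′ × (∀ {i} → i < k → p′ i ≡ p i)

  -- Greedy: a fresh nonleaf neighbour of the last vertex is appended while there is one. A trail
  -- has at most n vertices, so fuel 0 is contradictory.
  extend : ∀ fuel {k p} → Trail G (suc k) p → n ≤ k + fuel → Extension (suc k) p
  extend zero {k} T n≤k = contradiction (ℕₚ.≤-trans (trail-≤ T) (subst (n ≤_) (ℕₚ.+-identityʳ k) n≤k)) ℕₚ.1+n≰n
  extend (suc fuel) {k} {p} T n≤ with any? (λ y →
    (nlNbr G (p k) y Boolₚ.≟ true) ×-dec ¬? (ℕₚ.anyUpTo? (λ i → p i ≟ y) (suc k)))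
  ... | yes (y , e , fresh) =
    let k′ , p′ , k<k′ , T′ , closed , agree =
          extend fuel (trail-snoc T e fresh) (subst (n ≤_) (ℕₚ.+-suc k fuel) n≤)
    in k′ , p′ , ℕₚ.<⇒≤ k<k′ , T′ , closed ,
       λ i<k → trans (agree (ℕₚ.m<n⇒m<1+n i<k)) (snoc-< i<k)
  ... | no none = suc k , p , ℕₚ.≤-refl , T , stuck-closed T stuck , λ _ → refl
    where
    stuck : ∀ {y} → nlNbr G (p k) y ≡ true → OnTrail (suc k) p y
    stuck {y} e with ℕₚ.anyUpTo? (λ i → p i ≟ y) (suc k)
    ... | yes on = on
    ... | no off = contradiction (y , e , off) none

  endPath-extend : (t : Vec (Fin n) (suc r)) → EndPath G t → Extension (suc r) (nth t)
  endPath-extend {r = r} t ep = extend n (endPath-trail G t ep) (ℕₚ.m≤n+m n r)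

  -- Closedness puts every nonleaf neighbour of the last vertex on the trail, and in the absence of
  -- chords only the predecessor remains. The two ends of a maximal trail are thus alike.
  trail-last : ∀ {k p} → Trail G (suc k) p → Closed G (suc k) p → ν G (p k) ≤ 1
  trail-last {k} {p} T closed = count-≤1 (nlNbr G (p k)) λ ex ey → uniq (closed k<1+k ex) (closed k<1+k ey) ex ey
    where
    k<1+k = ℕₚ.n<1+n k
    pred-of : ∀ {i x} → i < suc k → p i ≡ x → nlNbr G (p k) x ≡ true → k ≡ suc i
    pred-of {i} i<k refl e with trail-adj T k i k<1+k i<k (proj₁ (∧-elim (adj G (p k) (p i)) e))
    ... | inj₁ refl = contradiction i<k (ℕₚ.<-irrefl refl)
    ... | inj₂ k≡1+i = k≡1+i
    uniq : ∀ {x y} → OnTrail (suc k) p x → OnTrail (suc k) p y →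
      nlNbr G (p k) x ≡ true → nlNbr G (p k) y ≡ true → x ≡ y
    uniq (i , i<k , refl) (j , j<k , refl) ex ey =
      cong p (ℕₚ.suc-injective (trans (sym (pred-of i<k refl ex)) (pred-of j<k refl ey)))

  trail-single : ∀ {p} → Trail G 1 p → Closed G 1 p → ν G (p 0) ≡ 0
  trail-single {p} T closed = count-none λ x e → loop x (closed (s≤s z≤n) e) e
    where
    loop : ∀ x → OnTrail 1 p x → nlNbr G (p 0) x ≢ true
    loop x (zero , _ , refl) e = true≢false (proj₁ (∧-elim (adj G (p 0) (p 0)) e)) (adj-irrefl G (p 0))
    loop x (suc _ , s≤s () , _) e

  trail-spine : ∀ {k p} → Trail G k p → (∀ {v} → nl G v ≡ true → OnTrail k p v) →
    (∀ {v x} → nl G v ≡ false → adj G v x ≡ true → nl G x ≡ true) → (∀ v → 1 ≤ degree G v) → Spine G k p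
  trail-spine {k} {p} T covers leaf-nl deg≥1 = record
    { inj        = inj
    ; nonleaf    = nonleaf
    ; covers     = covers
    ; adj⇒consec = trail-adj T
    ; consec⇒adj = links
    ; attached   = λ {v} leaf → let x , vx = count-witness (adj G v) (deg≥1 v)
                                    i , i<k , eq = covers (leaf-nl leaf vx)
                                in i , i<k , subst (λ w → adj G v w ≡ true) (sym eq) vx
    }
    where open Trail T

-- Statistics of G that H must share

count-weight-nonNeg : ∀ b (G : Graph n) (L : Factors j) t → 0ℤ ≤ᶻ ind b *ᶻ lin G (L ++ L) t
count-weight-nonNeg b G L t = *-nonNeg (ind-nonNeg b)
  (subst (0ℤ ≤ᶻ_) (sym (lin-++ G L L t)) (square-nonNeg (lin G L t)))

lin-square-zero : (G : Graph n) (L : Factors j) {t : Vec (Fin n) j} → lin G (L ++ L) t ≡ 0ℤ → lin G L t ≡ 0ℤ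
lin-square-zero G L {t} eq with ℤₚ.i*j≡0⇒i≡0∨j≡0 (lin G L t) (trans (sym (lin-++ G L L t)) eq)
... | inj₁ z = z
... | inj₂ z = z

ind-zero : ∀ {b} → ind b ≡ 0ℤ → b ≡ false
ind-zero {false} _ = refl

*-ind-zero : ∀ {b z} → (b ≡ true → z ≡ 0ℤ) → ind b *ᶻ z ≡ 0ℤ
*-ind-zero {true}  f = trans (ℤₚ.*-identityˡ _) (f refl)
*-ind-zero {false} f = refl

ind-*-zero : ∀ {b z} → ind b *ᶻ z ≡ 0ℤ → b ≡ true → z ≡ 0ℤ
ind-*-zero {z = z} eq refl = trans (sym (ℤₚ.*-identityˡ z)) eq

length-double : {A : Set} (L : List A) → length (L ++ L) ≡ 2 * length L
length-double L = trans (Listₚ.length-++ L) (cong (length L +_) (sym (ℕₚ.+-identityʳ (length L))))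

vertexFactors : Fin j → List ℕ → Factors j
vertexFactors i V = map (λ c → i , pos c) V

clawᵇ : ∀ {n} → Graph n → Vec (Fin n) 4 → Bool
clawᵇ G (c ∷ x ∷ y ∷ z ∷ []) =
  (adj G c x ∧ adj G c y ∧ adj G c z) ∧ (not (eqᵇ x y) ∧ not (eqᵇ x z) ∧ not (eqᵇ y z))


module _ {ℓ} (H G : Graph n) (deck : SameDeck ℓ H G) (ℓ≤n : ℓ ≤ n) where

  abstract
    -- The square of ∏ (c - deg v) over c in V vanishes at every vertex of G, hence at every vertex
    -- of H, where some factor must be 0. The coefficient 2 in the cost pays for the square.
    degrees-transfer : (V : List ℕ) → 2 * length V + 1 ≤ ℓ →
      (∀ v → degree G v ∈ V) → ∀ v → degree H v ∈ V
    degrees-transfer V cost degG v with lin-≡0 H L (v ∷ []) (lin-square-zero H L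
        (trans (sym (ℤₚ.*-identityˡ _)) (transfer-zero (L ++ L) (λ _ _ → 1ℤ) (λ _ _ _ _ _ → refl) H G deck
          (subst (λ a → a + 1 ≤ ℓ) (sym (trans (length-double L) (cong (2 *_) (Listₚ.length-map _ V)))) cost) ℓ≤n
          (count-weight-nonNeg true H L) vanish (v ∷ []))))
      where
      L : Factors 1
      L = vertexFactors zero V
      vanish : ∀ t → 1ℤ *ᶻ lin G (L ++ L) t ≡ 0ℤ
      vanish (u ∷ []) = trans (ℤₚ.*-identityˡ _)
        (lin-vanish G {L ++ L} {u ∷ []} (∈ₚ.∈-++⁺ˡ (∈ₚ.∈-map⁺ _ (degG u))) refl)
    ... | i , c , ∈L , eq with ∈ₚ.∈-map⁻ (λ c → zero , pos c) ∈L
    ... | d , d∈V , refl = subst (_∈ V) (sym (ℤₚ.+-injective eq)) d∈V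

  abstract
    -- The cost 10 is four vertices plus the factors 1 - deg at the three tips of a claw, each taken
    -- twice. In G every claw has a leaf among its tips, so the sum vanishes; a claw in H with three
    -- nonleaf tips would contribute a positive term.
    threeFree-transfer : 10 ≤ ℓ → ThreeFree G → ThreeFree H
    threeFree-transfer 10≤ℓ tfG c {x} {y} {z} ex ey ez x≢y x≢z with y ≟ z
    ... | yes y≡z = y≡z
    ... | no y≢z = contradiction (lin-square-zero H L {t} (ind-*-zero (transfer-zero (L ++ L) (λ X t → ind (clawᵇ X t)) inv
        H G deck 10≤ℓ ℓ≤n (λ t → count-weight-nonNeg (clawᵇ H t) H L t) vanish t) isClaw)) (lin-≢0 H {L} {t} nonzero)
      where
      L : Factors 4
      L = (suc zero , 1ℤ) ∷ (suc (suc zero) , 1ℤ) ∷ (suc (suc (suc zero)) , 1ℤ) ∷ []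
      t : Vec (Fin n) 4
      t = c ∷ x ∷ y ∷ z ∷ []
      inv : Invariant (λ X t → ind (clawᵇ X t))
      inv X Y f (finj , fadj) (c ∷ x ∷ y ∷ z ∷ []) = cong ind (cong₂ _∧_
        (cong₂ _∧_ (fadj c x) (cong₂ _∧_ (fadj c y) (fadj c z)))
        (cong₂ _∧_ (cong not (eqᵇ-map f finj x y))
          (cong₂ _∧_ (cong not (eqᵇ-map f finj x z)) (cong not (eqᵇ-map f finj y z)))))
      split : ∀ {c x} → nlNbr H c x ≡ true → adj H c x ≡ true × nl H x ≡ true
      split {c} {x} = ∧-elim (adj H c x)
      isClaw : clawᵇ H t ≡ true
      isClaw = ∧-intro (∧-intro (proj₁ (split ex)) (∧-intro (proj₁ (split ey)) (proj₁ (split ez))))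
        (∧-intro (cong not (eqᵇ-≢ x≢y)) (∧-intro (cong not (eqᵇ-≢ x≢z)) (cong not (eqᵇ-≢ y≢z))))
      nonzero : ∀ {i c} → (i , c) ∈ L → pos (degree H (lookup t i)) ≢ c
      nonzero (here refl)                 e = nl-degree H (proj₂ (split ex)) (ℤₚ.+-injective e)
      nonzero (there (here refl))         e = nl-degree H (proj₂ (split ey)) (ℤₚ.+-injective e)
      nonzero (there (there (here refl))) e = nl-degree H (proj₂ (split ez)) (ℤₚ.+-injective e)
      not-eq : ∀ {x y : Fin n} → not (eqᵇ x y) ≡ true → x ≢ y
      not-eq {x} e refl rewrite eqᵇ-refl x = contradiction e λ ()
      vanish : ∀ t → ind (clawᵇ G t) *ᶻ lin G (L ++ L) t ≡ 0ℤ
      vanish (c ∷ x ∷ y ∷ z ∷ []) = *-ind-zero leafy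
        where
        leafy : clawᵇ G (c ∷ x ∷ y ∷ z ∷ []) ≡ true → lin G (L ++ L) (c ∷ x ∷ y ∷ z ∷ []) ≡ 0ℤ
        leafy e with ∧-elim (adj G c x ∧ adj G c y ∧ adj G c z) e
        ... | es , ds with ∧-elim (adj G c x) es | ∧-elim (not (eqᵇ x y)) ds
        ... | cx , es′ | dxy , ds′ with ∧-elim (adj G c y) es′ | ∧-elim (not (eqᵇ x z)) ds′
        ... | cy , cz | dxz , dyz with nl G x in nx | nl G y in ny | nl G z in nz
        ... | false | _ | _ = lin-vanish G {L ++ L} {c ∷ x ∷ y ∷ z ∷ []} (here refl) (nl-false G nx)
        ... | true | false | _ = lin-vanish G {L ++ L} {c ∷ x ∷ y ∷ z ∷ []} (there (here refl)) (nl-false G ny)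
        ... | true | true | false =
          lin-vanish G {L ++ L} {c ∷ x ∷ y ∷ z ∷ []} (there (there (here refl))) (nl-false G nz)
        ... | true | true | true = contradiction
          (tfG c (∧-intro cx nx) (∧-intro cy ny) (∧-intro cz nz) (not-eq dxy) (not-eq dxz)) (not-eq dyz)

-- Leaf and nonleaf conditions as linear factors

leafWeight nlWeight : Graph n → List (Fin j) → Vec (Fin n) j → ℤ
leafWeight X []      t = 1ℤ
leafWeight X (i ∷ I) t = ind (not (nl X (lookup t i))) *ᶻ leafWeight X I t
nlWeight X []      t = 1ℤ
nlWeight X (i ∷ M) t = ind (nl X (lookup t i)) *ᶻ nlWeight X M t

-- A polynomial vanishing at all nonleaf degrees and equal to a constant K ≠ 0 at 1 is a multiple of the
-- indicator of the leaves, so leaf and nonleaf conditions cost |V| linear factors each.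
module Indicators (V : List ℕ) (1∉V : ¬ 1 ∈ V) where

  atOne : List ℕ → ℤ
  atOne []      = 1ℤ
  atOne (c ∷ W) = (pos c -ᶻ 1ℤ) *ᶻ atOne W

  K : ℤ
  K = atOne V

  K≢0 : K ≢ 0ℤ
  K≢0 = go V 1∉V
    where
    go : ∀ W → ¬ 1 ∈ W → atOne W ≢ 0ℤ
    go []      1∉W = λ ()
    go (c ∷ W) 1∉W = *-≢0 (λ e → 1∉W (here (sym (ℤₚ.+-injective (ℤₚ.i-j≡0⇒i≡j (pos c) 1ℤ e)))))
      (go W (1∉W ∘ there))

  leafFactors : List (Fin j) → Factors j
  leafFactors []      = []
  leafFactors (i ∷ I) = vertexFactors i V ++ leafFactors I

  length-leafFactors : (I : List (Fin j)) → length (leafFactors I) ≡ length I * length V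
  length-leafFactors []      = refl
  length-leafFactors (i ∷ I) = trans (Listₚ.length-++ (vertexFactors i V))
    (cong₂ _+_ (Listₚ.length-map _ V) (length-leafFactors I))

  Kpow : ℕ → ℤ
  Kpow zero    = 1ℤ
  Kpow (suc a) = K *ᶻ Kpow a

  Kpow≢0 : ∀ a → Kpow a ≢ 0ℤ
  Kpow≢0 zero    = λ ()
  Kpow≢0 (suc a) = *-≢0 K≢0 (Kpow≢0 a)

  module _ (X : Graph n) (degX : ∀ {v} → nl X v ≡ true → degree X v ∈ V) where

    lin-vertexFactors : (i : Fin j) (t : Vec (Fin n) j) →
      lin X (vertexFactors i V) t ≡ K *ᶻ ind (not (nl X (lookup t i)))
    lin-vertexFactors i t with nl X (lookup t i) in eq
    ... | true  = trans (lin-vanish X {vertexFactors i V} {t} (∈ₚ.∈-map⁺ _ (degX eq)) refl) (sym (ℤₚ.*-zeroʳ K))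
    ... | false = trans (go V) (sym (ℤₚ.*-identityʳ K))
      where
      go : ∀ W → lin X (vertexFactors i W) t ≡ atOne W
      go []      = refl
      go (c ∷ W) = cong₂ (λ d z → (pos c -ᶻ pos d) *ᶻ z) (nl-false X eq) (go W)

    lin-leafFactors : (I : List (Fin j)) (t : Vec (Fin n) j) →
      lin X (leafFactors I) t ≡ Kpow (length I) *ᶻ leafWeight X I t
    lin-leafFactors []      t = refl
    lin-leafFactors (i ∷ I) t = begin
      lin X (vertexFactors i V ++ leafFactors I) t
        ≡⟨ lin-++ X (vertexFactors i V) (leafFactors I) t ⟩
      lin X (vertexFactors i V) t *ᶻ lin X (leafFactors I) t
        ≡⟨ cong₂ _*ᶻ_ (lin-vertexFactors i t) (lin-leafFactors I t) ⟩
      K *ᶻ ind (not (nl X (lookup t i))) *ᶻ (Kpow (length I) *ᶻ leafWeight X I t)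
        ≡⟨ shuffle K (ind (not (nl X (lookup t i)))) (Kpow (length I)) (leafWeight X I t) ⟩
      K *ᶻ Kpow (length I) *ᶻ (ind (not (nl X (lookup t i))) *ᶻ leafWeight X I t) ∎
      where
      open ≡-Reasoning
      shuffle : ∀ a b c d → a *ᶻ b *ᶻ (c *ᶻ d) ≡ a *ᶻ c *ᶻ (b *ᶻ d)
      shuffle = ℤ-Solver.solve-∀

  stat : Weight j → Factors j → List (Fin j) → List (Fin j) → Graph n → ℤ
  stat {j} Ψ L I M X = sumV j λ t → Ψ X t *ᶻ lin X L t *ᶻ leafWeight X I t *ᶻ nlWeight X M t

  stat-split : (Ψ : Weight j) (L : Factors j) (I M : List (Fin j)) (i : Fin j) (X : Graph n) →
    stat Ψ L I M X ≡ stat Ψ L I (i ∷ M) X +ᶻ stat Ψ L (i ∷ I) M X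
  stat-split {j} Ψ L I M i X = trans
    (sumV-cong j λ t → split (nl X (lookup t i)) (Ψ X t *ᶻ lin X L t) (leafWeight X I t) (nlWeight X M t))
    (sumV-+ j _ _)
    where
    split : ∀ b a c d → a *ᶻ c *ᶻ d ≡ a *ᶻ c *ᶻ (ind b *ᶻ d) +ᶻ a *ᶻ (ind (not b) *ᶻ c) *ᶻ d
    split true  = ℤ-Solver.solve-∀
    split false = ℤ-Solver.solve-∀

  module Same {ℓ} (H G : Graph n) (deck : SameDeck ℓ H G) (ℓ≤n : ℓ ≤ n)
    (degH : ∀ {v} → nl H v ≡ true → degree H v ∈ V) (degG : ∀ {v} → nl G v ≡ true → degree G v ∈ V) where

    -- The leaf conditions turn into linear factors up to the constant K to the power |I|. One list
    -- V serves both graphs, so the constant is the same for both, and being nonzero it cancels.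
    stat-leaf-≡ : (Ψ : Weight j) → Invariant Ψ → (L : Factors j) (I : List (Fin j)) →
      length L + length I * length V + j ≤ ℓ → stat Ψ L I [] H ≡ stat Ψ L I [] G
    stat-leaf-≡ {j} Ψ inv L I cost = ℤₚ.*-cancelˡ-≡ a _ _ ⦃ ℤ.≢-nonZero (Kpow≢0 (length I)) ⦄ (begin
      a *ᶻ stat Ψ L I [] H                             ≡⟨ expand H degH ⟩
      sumV j (λ t → Ψ H t *ᶻ lin H (L ++ leafFactors I) t)
        ≡⟨ degree-sum-≡ (L ++ leafFactors I) Ψ inv H G deck
             (subst (λ e → e + j ≤ ℓ) (sym (trans (Listₚ.length-++ L) (cong (length L +_) (length-leafFactors I)))) cost)
             ℓ≤n ⟩
      sumV j (λ t → Ψ G t *ᶻ lin G (L ++ leafFactors I) t)   ≡⟨ sym (expand G degG) ⟩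
      a *ᶻ stat Ψ L I [] G                             ∎)
      where
      open ≡-Reasoning
      a = Kpow (length I)
      shuffle : ∀ k a b c → k *ᶻ (a *ᶻ b *ᶻ c *ᶻ 1ℤ) ≡ a *ᶻ (b *ᶻ (k *ᶻ c))
      shuffle = ℤ-Solver.solve-∀
      expand : ∀ X → (∀ {v} → nl X v ≡ true → degree X v ∈ V) →
        a *ᶻ stat Ψ L I [] X ≡ sumV j (λ t → Ψ X t *ᶻ lin X (L ++ leafFactors I) t)
      expand X degX = trans (sumV-* j a _) (sumV-cong j λ t → trans
        (shuffle a (Ψ X t) (lin X L t) (leafWeight X I t))
        (cong (Ψ X t *ᶻ_) (sym (trans (lin-++ X L (leafFactors I) t) (cong (lin X L t *ᶻ_) (lin-leafFactors X degX I t))))))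

    -- Polynomials vanishing on V express leaf conditions only. A nonleaf condition is therefore
    -- obtained as a difference: the sum without it, minus the sum with the leaf condition in its
    -- place. Both stay within the same cost.
    stat-≡ : (Ψ : Weight j) → Invariant Ψ → (L : Factors j) (I M : List (Fin j)) →
      length L + (length M + length I) * length V + j ≤ ℓ → stat Ψ L I M H ≡ stat Ψ L I M G
    stat-≡ Ψ inv L I []      cost = stat-leaf-≡ Ψ inv L I cost
    stat-≡ {j} Ψ inv L I (i ∷ M) cost = +ᶻ-cancelʳ (stat Ψ L (i ∷ I) M G) _ _ (begin
      stat Ψ L I (i ∷ M) H +ᶻ stat Ψ L (i ∷ I) M G  ≡⟨ cong (stat Ψ L I (i ∷ M) H +ᶻ_) (sym more) ⟩
      stat Ψ L I (i ∷ M) H +ᶻ stat Ψ L (i ∷ I) M H  ≡⟨ sym (stat-split Ψ L I M i H) ⟩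
      stat Ψ L I M H                                ≡⟨ fewer ⟩
      stat Ψ L I M G                                ≡⟨ stat-split Ψ L I M i G ⟩
      stat Ψ L I (i ∷ M) G +ᶻ stat Ψ L (i ∷ I) M G  ∎)
      where
      open ≡-Reasoning
      more : stat Ψ L (i ∷ I) M H ≡ stat Ψ L (i ∷ I) M G
      more = stat-≡ Ψ inv L (i ∷ I) M
        (subst (λ a → length L + a * length V + j ≤ ℓ) (sym (ℕₚ.+-suc (length M) (length I))) cost)
      fewer : stat Ψ L I M H ≡ stat Ψ L I M G
      fewer = stat-≡ Ψ inv L I M (ℕₚ.≤-trans (ℕₚ.+-monoˡ-≤ j (ℕₚ.+-monoʳ-≤ (length L)
        (ℕₚ.m≤n+m ((length M + length I) * length V) (length V)))) cost)

-- Weights that count nonleaves, edges between them and end paths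

one : Weight 1
one X t = 1ℤ

edge : Weight 2
edge X t = ind (adj X (lookup t zero) (lookup t (suc zero)))

edge-invariant : Invariant edge
edge-invariant X Y f (finj , fadj) (x ∷ y ∷ []) = cong ind (fadj x y)

path-map : {X : Graph m} {Y : Graph n} {f : Fin m → Fin n} → Embeds X Y f → (t : Vec (Fin m) r) →
  pathᵇ X t ≡ pathᵇ Y (Vec.map f t)
path-map emb []                              = refl
path-map emb (x ∷ [])                        = refl
path-map {f = f} emb@(finj , fadj) (x ∷ y ∷ t) = cong₂ _∧_ (fadj x y)
  (cong₂ _∧_ (cong not (∈ᵇ-map f finj x (y ∷ t))) (path-map emb (y ∷ t)))

path : Weight r
path X t = ind (pathᵇ X t)

path-invariant : Invariant {r} path
path-invariant X Y f emb t = cong ind (path-map emb t)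

-- The added vertex is any neighbour of the first vertex of t and may itself lie on t: summed over
-- the nonleaves, it multiplies the weight of the path by ν.
extendedPath : Weight (suc (suc r))
extendedPath X (x ∷ t) = ind (adj X (lookup t zero) x) *ᶻ path X t

extendedPath-invariant : Invariant {suc (suc r)} extendedPath
extendedPath-invariant X Y f emb@(_ , fadj) (x ∷ y ∷ t) =
  cong₂ _*ᶻ_ (cong ind (fadj y x)) (path-invariant X Y f emb (y ∷ t))

shift : Factors j → Factors (suc j)
shift = map λ (i , c) → suc i , c

lin-shift : (X : Graph n) (L : Factors j) (x : Fin n) (t : Vec (Fin n) j) → lin X (shift L) (x ∷ t) ≡ lin X L t
lin-shift X []            x t = refl
lin-shift X ((i , c) ∷ L) x t = cong ((c -ᶻ pos (degree X (lookup t i))) *ᶻ_) (lin-shift X L x t)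

ind-∧ : ∀ a b → ind a *ᶻ ind b ≡ ind (a ∧ b)
ind-∧ true  true  = refl
ind-∧ true  false = refl
ind-∧ false b     = refl

sum-nlNbr : (X : Graph n) (v : Fin n) → sum (λ x → ind (adj X v x) *ᶻ ind (nl X x)) ≡ pos (ν X v)
sum-nlNbr X v = trans (sum-cong-≗ λ x → ind-∧ (adj X v x) (nl X x)) (sum-ind (nlNbr X v))

2ℤ : ℤ
2ℤ = pos 2

-- Nonzero only at the ends of the spine: 1 at each of two ends, 2 at the centre of a star.
excess : Graph n → Fin n → ℤ
excess X v = ind (nl X v) *ᶻ (2ℤ -ᶻ pos (ν X v))

-- For L ⊇ [(0 , 1), (r , 1)] this is nonzero only if t is an end path: ν is 2 at an inner spine vertex.
endTerm : Graph n → Factors (suc r) → Vec (Fin n) (suc r) → ℤ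
endTerm X L t = path X t *ᶻ lin X L t *ᶻ (2ℤ -ᶻ pos (ν X (lookup t zero)))

endSum : Graph n → Factors (suc r) → ℤ
endSum {r = r} X L = sumV (suc r) (endTerm X L)

module _ (V : List ℕ) (1∉V : ¬ 1 ∈ V) where
  open Indicators V 1∉V

  stat-nl : (X : Graph n) → stat one [] [] (zero ∷ []) X ≡ pos (countTrue (nl X))
  stat-nl X = trans (sum-cong-≗ λ v → trans (ℤₚ.*-identityˡ _) (ℤₚ.*-identityʳ (ind (nl X v)))) (sum-ind (nl X))

  stat-nl-edges : (X : Graph n) →
    stat edge [] [] (zero ∷ suc zero ∷ []) X ≡ sum (λ v → ind (nl X v) *ᶻ pos (ν X v))
  stat-nl-edges X = sum-cong-≗ λ v → trans
    (sum-cong-≗ λ x → shuffle (ind (adj X v x)) (ind (nl X v)) (ind (nl X x)))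
    (trans (sym (*-distribˡ-sum (ind (nl X v)) λ x → ind (adj X v x) *ᶻ ind (nl X x))) (cong (ind (nl X v) *ᶻ_) (sum-nlNbr X v)))
    where
    shuffle : ∀ a b c → a *ᶻ 1ℤ *ᶻ 1ℤ *ᶻ (b *ᶻ (c *ᶻ 1ℤ)) ≡ b *ᶻ (a *ᶻ c)
    shuffle = ℤ-Solver.solve-∀

  -- The total excess is twice the number of nonleaves minus the number of ordered pairs of adjacent
  -- nonleaves, and the deck determines both numbers.
  sum-excess : (X : Graph n) →
    stat edge [] [] (zero ∷ suc zero ∷ []) X +ᶻ sum (excess X) ≡ 2ℤ *ᶻ stat one [] [] (zero ∷ []) X
  sum-excess X = begin
    stat edge [] [] (zero ∷ suc zero ∷ []) X +ᶻ sum (excess X)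
      ≡⟨ cong (_+ᶻ sum (excess X)) (stat-nl-edges X) ⟩
    sum (λ v → ind (nl X v) *ᶻ pos (ν X v)) +ᶻ sum (excess X)
      ≡⟨ sym (∑-distrib-+ (λ v → ind (nl X v) *ᶻ pos (ν X v)) (excess X)) ⟩
    sum (λ v → ind (nl X v) *ᶻ pos (ν X v) +ᶻ excess X v)
      ≡⟨ sum-cong-≗ (λ v → collect (ind (nl X v)) (pos (ν X v))) ⟩
    sum (λ v → 2ℤ *ᶻ ind (nl X v))
      ≡⟨ sym (*-distribˡ-sum 2ℤ (ind ∘ nl X)) ⟩
    2ℤ *ᶻ sum (ind ∘ nl X)
      ≡⟨ cong (2ℤ *ᶻ_) (trans (sum-ind (nl X)) (sym (stat-nl X))) ⟩
    2ℤ *ᶻ stat one [] [] (zero ∷ []) X ∎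
    where
    open ≡-Reasoning
    collect : ∀ a b → a *ᶻ b +ᶻ a *ᶻ (pos 2 -ᶻ b) ≡ pos 2 *ᶻ a
    collect = ℤ-Solver.solve-∀

  -- Multiplying by ν at the first vertex amounts to attaching one more nonleaf there. So the factor
  -- 2 - ν costs one vertex and a single nonleaf condition, however long the path is.
  endSum-stat : (X : Graph n) (L : Factors (suc r)) →
    stat extendedPath (shift L) [] (zero ∷ []) X +ᶻ endSum X L ≡ 2ℤ *ᶻ stat path L [] [] X
  endSum-stat {n} {r} X L = begin
    stat extendedPath (shift L) [] (zero ∷ []) X +ᶻ endSum X L
      ≡⟨ cong (_+ᶻ endSum X L) (sumV-sum (suc r) E) ⟩
    sumV (suc r) (λ t → sum λ x → E x t) +ᶻ endSum X L
      ≡⟨ sym (sumV-+ (suc r) (λ t → sum λ x → E x t) (endTerm X L)) ⟩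
    sumV (suc r) (λ t → sum (λ x → E x t) +ᶻ endTerm X L t)
      ≡⟨ sumV-cong (suc r) (λ t → trans
           (cong (_+ᶻ endTerm X L t) (inner t))
           (collect (path X t *ᶻ lin X L t) (pos (ν X (lookup t zero))))) ⟩
    sumV (suc r) (λ t → 2ℤ *ᶻ A t)
      ≡⟨ sym (sumV-* (suc r) 2ℤ A) ⟩
    2ℤ *ᶻ stat path L [] [] X ∎
    where
    open ≡-Reasoning
    A : Vec (Fin n) (suc r) → ℤ
    A t = path X t *ᶻ lin X L t *ᶻ 1ℤ *ᶻ 1ℤ
    E : Fin n → Vec (Fin n) (suc r) → ℤ
    E x t = extendedPath X (x ∷ t) *ᶻ lin X (shift L) (x ∷ t) *ᶻ 1ℤ *ᶻ (ind (nl X x) *ᶻ 1ℤ)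
    collect : ∀ a b → a *ᶻ b +ᶻ a *ᶻ (pos 2 -ᶻ b) ≡ pos 2 *ᶻ (a *ᶻ 1ℤ *ᶻ 1ℤ)
    collect = ℤ-Solver.solve-∀
    shuffle : ∀ a b c d → a *ᶻ b *ᶻ c *ᶻ 1ℤ *ᶻ (d *ᶻ 1ℤ) ≡ b *ᶻ c *ᶻ (a *ᶻ d)
    shuffle = ℤ-Solver.solve-∀
    inner : ∀ t → sum (λ x → E x t) ≡ path X t *ᶻ lin X L t *ᶻ pos (ν X (lookup t zero))
    inner t@(_ ∷ _) = begin
      sum (λ x → E x t)
        ≡⟨ sum-cong-≗ (λ x → trans
             (cong (λ z → extendedPath X (x ∷ t) *ᶻ z *ᶻ 1ℤ *ᶻ (ind (nl X x) *ᶻ 1ℤ)) (lin-shift X L x t))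
             (shuffle (ind (adj X (lookup t zero) x)) (path X t) (lin X L t) (ind (nl X x)))) ⟩
      sum (λ x → path X t *ᶻ lin X L t *ᶻ (ind (adj X (lookup t zero) x) *ᶻ ind (nl X x)))
        ≡⟨ sym (*-distribˡ-sum (path X t *ᶻ lin X L t) λ x → ind (adj X (lookup t zero) x) *ᶻ ind (nl X x)) ⟩
      path X t *ᶻ lin X L t *ᶻ sum (λ x → ind (adj X (lookup t zero) x) *ᶻ ind (nl X x))
        ≡⟨ cong (path X t *ᶻ lin X L t *ᶻ_) (sum-nlNbr X (lookup t zero)) ⟩
      path X t *ᶻ lin X L t *ᶻ pos (ν X (lookup t zero)) ∎

  module Transferred {ℓ} (H G : Graph n) (deck : SameDeck ℓ H G) (ℓ≤n : ℓ ≤ n)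
    (degH : ∀ {v} → nl H v ≡ true → degree H v ∈ V) (degG : ∀ {v} → nl G v ≡ true → degree G v ∈ V)
    (cost : 2 * length V + 2 ≤ ℓ) where

    open Same H G deck ℓ≤n degH degG

    stat-one-≡ : stat one [] [] (zero ∷ []) H ≡ stat one [] [] (zero ∷ []) G
    stat-one-≡ = stat-≡ one (λ _ _ _ _ _ → refl) [] [] (zero ∷ []) (ℕₚ.≤-trans
      (ℕₚ.+-mono-≤ (ℕₚ.*-monoˡ-≤ (length V) {1} {2} (s≤s z≤n)) (s≤s z≤n)) cost)

    abstract
      nl-count-≡ : countTrue (nl H) ≡ countTrue (nl G)
      nl-count-≡ = ℤₚ.+-injective (trans (sym (stat-nl H)) (trans stat-one-≡ (stat-nl G)))

    abstract
      excess-≡ : sum (excess H) ≡ sum (excess G)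
      excess-≡ = +ᶻ-cancelˡ (stat edge [] [] (zero ∷ suc zero ∷ []) G) _ _ (begin
        stat edge [] [] (zero ∷ suc zero ∷ []) G +ᶻ sum (excess H)
          ≡⟨ cong (_+ᶻ sum (excess H)) (sym (stat-≡ edge edge-invariant [] [] (zero ∷ suc zero ∷ []) cost)) ⟩
        stat edge [] [] (zero ∷ suc zero ∷ []) H +ᶻ sum (excess H)  ≡⟨ sum-excess H ⟩
        2ℤ *ᶻ stat one [] [] (zero ∷ []) H                          ≡⟨ cong (2ℤ *ᶻ_) stat-one-≡ ⟩
        2ℤ *ᶻ stat one [] [] (zero ∷ []) G                          ≡⟨ sym (sum-excess G) ⟩
        stat edge [] [] (zero ∷ suc zero ∷ []) G +ᶻ sum (excess G)  ∎)
        where open ≡-Reasoning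

    abstract
      endSum-≡ : (L : Factors (suc r)) → length L + length V + suc (suc r) ≤ ℓ → endSum H L ≡ endSum G L
      endSum-≡ {r} L cost′ = +ᶻ-cancelˡ (stat extendedPath (shift L) [] (zero ∷ []) G) _ _ (begin
        stat extendedPath (shift L) [] (zero ∷ []) G +ᶻ endSum H L
          ≡⟨ cong (_+ᶻ endSum H L) (sym (stat-≡ extendedPath extendedPath-invariant (shift L) [] (zero ∷ [])
               (subst₂ (λ a b → a + b + suc (suc r) ≤ ℓ) (sym (Listₚ.length-map _ L)) (sym (ℕₚ.+-identityʳ (length V))) cost′))) ⟩
        stat extendedPath (shift L) [] (zero ∷ []) H +ᶻ endSum H L  ≡⟨ endSum-stat H L ⟩
        2ℤ *ᶻ stat path L [] [] H
          ≡⟨ cong (2ℤ *ᶻ_) (stat-≡ path path-invariant L [] []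
               (ℕₚ.≤-trans (ℕₚ.+-mono-≤ (ℕₚ.+-monoʳ-≤ (length L) z≤n) (ℕₚ.n≤1+n (suc r))) cost′)) ⟩
        2ℤ *ᶻ stat path L [] [] G                                   ≡⟨ sym (endSum-stat G L) ⟩
        stat extendedPath (shift L) [] (zero ∷ []) G +ᶻ endSum G L  ∎)
        where open ≡-Reasoning

    abstract
      -- Edges between two leaves are counted by two leaf conditions, at cost 2 |V| + 2. The terms
      -- are products of indicators, so the absence of such edges passes from G to H without
      -- squaring.
      leaf-nl : (∀ {v x} → nl G v ≡ false → adj G v x ≡ true → nl G x ≡ true) →
        ∀ {v x} → nl H v ≡ false → adj H v x ≡ true → nl H x ≡ true
      leaf-nl leafG {v} {x} leaf vx with nl H x in eq
      ... | true  = refl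
      ... | false = contradiction (sumV-all-zero 2 nonNeg zeroSum (v ∷ x ∷ [])) nonzero
        where
        term : Graph n → Vec (Fin n) 2 → ℤ
        term X t = edge X t *ᶻ 1ℤ *ᶻ leafWeight X (zero ∷ suc zero ∷ []) t *ᶻ 1ℤ
        nonNeg : ∀ t → 0ℤ ≤ᶻ term H t
        nonNeg t = *-nonNeg (*-nonNeg (*-nonNeg (ind-nonNeg (adj H (lookup t zero) (lookup t (suc zero)))) (ℤ.+≤+ z≤n))
          (*-nonNeg (ind-nonNeg (not (nl H (lookup t zero))))
            (*-nonNeg (ind-nonNeg (not (nl H (lookup t (suc zero))))) (ℤ.+≤+ z≤n)))) (ℤ.+≤+ z≤n)
        vanish : ∀ t → term G t ≡ 0ℤ
        vanish (u ∷ w ∷ []) with adj G u w in uw | nl G u in lu | nl G w in lw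
        ... | false | _     | _     = refl
        ... | true  | true  | _     = refl
        ... | true  | false | true  = refl
        ... | true  | false | false = contradiction (trans (sym (leafG lu uw)) lw) λ ()
        zeroSum : sumV 2 (term H) ≡ 0ℤ
        zeroSum = trans (stat-≡ edge edge-invariant [] (zero ∷ suc zero ∷ []) [] cost)
          (trans (sumV-cong 2 vanish) (sumV-zero {n} 2))
        nonzero : term H (v ∷ x ∷ []) ≢ 0ℤ
        nonzero rewrite vx | leaf | eq = λ ()

-- The maximal trail contains every nonleaf

countIn : (Fin n → Bool) → Vec (Fin n) r → ℕ
countIn g []      = 0
countIn g (x ∷ t) = boolToℕ (g x) + countIn g t

distinctᵇ : Vec (Fin n) r → Bool
distinctᵇ []      = true
distinctᵇ (x ∷ t) = not (x ∈ᵇ t) ∧ distinctᵇ t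

minDegree2ᵇ : Graph n → Vec (Fin n) r → Vec (Fin n) j → Bool
minDegree2ᵇ X []      s = true
minDegree2ᵇ X (v ∷ t) s = does (2 ≤? countIn (adj X v) s) ∧ minDegree2ᵇ X t s

-- The condition concerns adjacency among the entries, not degrees in the whole graph, so it is an
-- invariant weight whose only cost is the number of entries. Cycles are typical examples.
coreᵇ : Graph n → Vec (Fin n) r → Bool
coreᵇ X t = distinctᵇ t ∧ minDegree2ᵇ X t t

distinct-map : (f : Fin m → Fin n) → Injective _≡_ _≡_ f → (t : Vec (Fin m) r) →
  distinctᵇ t ≡ distinctᵇ (Vec.map f t)
distinct-map f finj []      = refl
distinct-map f finj (x ∷ t) = cong₂ _∧_ (cong not (∈ᵇ-map f finj x t)) (distinct-map f finj t)

countIn-map : (f : Fin m → Fin n) {g : Fin m → Bool} {h : Fin n → Bool} → (∀ x → g x ≡ h (f x)) →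
  (t : Vec (Fin m) r) → countIn g t ≡ countIn h (Vec.map f t)
countIn-map f eq []      = refl
countIn-map f eq (x ∷ t) = cong₂ _+_ (cong boolToℕ (eq x)) (countIn-map f eq t)

minDegree2-map : {X : Graph m} {Y : Graph n} {f : Fin m → Fin n} → Embeds X Y f →
  (t : Vec (Fin m) r) (s : Vec (Fin m) j) → minDegree2ᵇ X t s ≡ minDegree2ᵇ Y (Vec.map f t) (Vec.map f s)
minDegree2-map         emb []      s = refl
minDegree2-map {f = f} emb (v ∷ t) s = cong₂ _∧_
  (cong (λ a → does (2 ≤? a)) (countIn-map f (proj₂ emb v) s)) (minDegree2-map emb t s)

core : Weight r
core X t = ind (coreᵇ X t)

core-invariant : Invariant {r} core
core-invariant X Y f emb t = cong ind (cong₂ _∧_ (distinct-map f (proj₁ emb) t) (minDegree2-map emb t t))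

does-true : {A : Set} (d : Dec A) → does d ≡ true → A
does-true (yes a) _ = a

minDegree2-lookup : (X : Graph n) (t : Vec (Fin n) r) (s : Vec (Fin n) j) → minDegree2ᵇ X t s ≡ true →
  ∀ a → 2 ≤ countIn (adj X (lookup t a)) s
minDegree2-lookup X (v ∷ t) s e zero =
  does-true (2 ≤? countIn (adj X v) s) (proj₁ (∧-elim (does (2 ≤? countIn (adj X v) s)) e))
minDegree2-lookup X (v ∷ t) s e (suc a) =
  minDegree2-lookup X t s (proj₂ (∧-elim (does (2 ≤? countIn (adj X v) s)) e)) a

minDegree2-tabulate : (X : Graph n) (t : Vec (Fin n) r) (s : Vec (Fin n) j) →
  (∀ a → 2 ≤ countIn (adj X (lookup t a)) s) → minDegree2ᵇ X t s ≡ true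
minDegree2-tabulate X []      s deg = refl
minDegree2-tabulate X (v ∷ t) s deg =
  ∧-intro (dec-true (2 ≤? countIn (adj X v) s) (deg zero)) (minDegree2-tabulate X t s (deg ∘ suc))

countIn-none : (g : Fin n → Bool) (t : Vec (Fin n) r) → (∀ a → g (lookup t a) ≢ true) → countIn g t ≡ 0
countIn-none g []      none = refl
countIn-none g (x ∷ t) none with g x in eq
... | true  = contradiction eq (none zero)
... | false = countIn-none g t (none ∘ suc)

countIn-≤1 : (g : Fin n → Bool) (t : Vec (Fin n) r) → distinctᵇ t ≡ true →
  (∀ {a b} → g (lookup t a) ≡ true → g (lookup t b) ≡ true → lookup t a ≡ lookup t b) → countIn g t ≤ 1
countIn-≤1 g []      dist uniq = z≤n
countIn-≤1 g (x ∷ t) dist uniq with ∧-elim (not (x ∈ᵇ t)) dist | g x in eq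
... | _ , dist′ | false = countIn-≤1 g t dist′ λ {a} {b} → uniq {suc a} {suc b}
... | x∉ , _    | true  = s≤s (ℕₚ.≤-reflexive (countIn-none g t λ a e →
  true≢false x∉ (cong not (subst (λ y → y ∈ᵇ t ≡ true) (sym (uniq {zero} {suc a} eq e)) (∈ᵇ-lookup t a)))))

-- In a nonempty set of nonleaves, the vertex furthest along the spine has at most one neighbour.
spine-no-core : ∀ {G : Graph n} {k p} → Spine G k p → (t : Vec (Fin n) (suc r)) → coreᵇ G t ≢ true
spine-no-core {n} {r} {G} {k} {p} S t e with ∧-elim (distinctᵇ t) e
... | dist , deg = off-spine (covers (nonleaves zero))
  where
  open Spine S
  deg≥2 : ∀ a → 2 ≤ countIn (adj G (lookup t a)) t
  deg≥2 = minDegree2-lookup G t t deg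
  not-unique : ∀ a → ¬ (∀ {b c} → adj G (lookup t a) (lookup t b) ≡ true →
    adj G (lookup t a) (lookup t c) ≡ true → lookup t b ≡ lookup t c)
  not-unique a uniq = ℕₚ.1+n≰n (ℕₚ.≤-trans (deg≥2 a) (countIn-≤1 (adj G (lookup t a)) t dist uniq))
  nonleaves : ∀ a → nl G (lookup t a) ≡ true
  nonleaves a with nl G (lookup t a) in eq
  ... | true  = refl
  ... | false = ⊥-elim (not-unique a (leaf-unique G eq))
  beyond : ∀ c i → i < k → k ≤ i + c → ∀ a → lookup t a ≢ p i
  beyond zero    i i<k k≤i a eq = ℕₚ.<⇒≱ i<k (subst (k ≤_) (ℕₚ.+-identityʳ i) k≤i)
  beyond (suc c) i i<k k≤  a eq = not-unique a λ {b} {c} eb ec → same (before eb) (before ec)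
    where
    before : ∀ {b} → adj G (lookup t a) (lookup t b) ≡ true → ∃ λ j → p j ≡ lookup t b × i ≡ suc j
    before {b} ab with covers (nonleaves b)
    ... | j , j<k , pj with adj⇒consec i j i<k j<k (subst₂ (λ x y → adj G x y ≡ true) eq (sym pj) ab)
    ... | inj₂ i≡1+j = j , pj , i≡1+j
    ... | inj₁ refl  = contradiction (sym pj) (beyond c (suc i) j<k (subst (k ≤_) (ℕₚ.+-suc i c) k≤) b)
    same : ∀ {x y} → (∃ λ j → p j ≡ x × i ≡ suc j) → (∃ λ j → p j ≡ y × i ≡ suc j) → x ≡ y
    same (j , refl , refl) (.j , refl , refl) = refl
  off-spine : ¬ OnTrail k p (lookup t zero)
  off-spine (i , i<k , eq) = beyond k i i<k (ℕₚ.m≤n+m k i) zero (sym eq)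

enum : (f : Fin n → Bool) → Vec (Fin n) (countTrue f)
enum {zero}  f = []
enum {suc n} f with f zero
... | true  = zero ∷ Vec.map suc (enum (f ∘ suc))
... | false = Vec.map suc (enum (f ∘ suc))

zero∉map-suc : (t : Vec (Fin n) r) → zero ∈ᵇ Vec.map suc t ≡ false
zero∉map-suc []      = refl
zero∉map-suc (x ∷ t) = zero∉map-suc t

enum-distinct : (f : Fin n → Bool) → distinctᵇ (enum f) ≡ true
enum-distinct {zero}  f = refl
enum-distinct {suc n} f with f zero
... | true rewrite zero∉map-suc (enum (f ∘ suc)) =
  trans (sym (distinct-map suc Finₚ.suc-injective (enum (f ∘ suc)))) (enum-distinct (f ∘ suc))
... | false = trans (sym (distinct-map suc Finₚ.suc-injective (enum (f ∘ suc)))) (enum-distinct (f ∘ suc))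

enum-sat : (f : Fin n → Bool) → ∀ a → f (lookup (enum f) a) ≡ true
enum-sat {suc n} f a with f zero in eq
enum-sat {suc n} f zero    | true  = eq
enum-sat {suc n} f (suc a) | true  = trans (cong f (Vecₚ.lookup-map a suc (enum (f ∘ suc)))) (enum-sat (f ∘ suc) a)
enum-sat {suc n} f a       | false = trans (cong f (Vecₚ.lookup-map a suc (enum (f ∘ suc)))) (enum-sat (f ∘ suc) a)

countIn-enum : (f g : Fin n → Bool) → countIn g (enum f) ≡ countTrue (λ x → g x ∧ f x)
countIn-enum {zero}  f g = refl
countIn-enum {suc n} f g with f zero
... | true  = cong₂ _+_ (cong boolToℕ (sym (Boolₚ.∧-identityʳ (g zero))))
  (trans (sym (countIn-map suc (λ _ → refl) (enum (f ∘ suc)))) (countIn-enum (f ∘ suc) (g ∘ suc)))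
... | false = trans (trans (sym (countIn-map suc (λ _ → refl) (enum (f ∘ suc)))) (countIn-enum (f ∘ suc) (g ∘ suc)))
  (cong (λ b → boolToℕ b + countTrue (λ x → g (suc x) ∧ f (suc x))) (sym (Boolₚ.∧-zeroʳ (g zero))))

enum-core : (X : Graph n) (f : Fin n → Bool) →
  (∀ {v} → f v ≡ true → 2 ≤ countTrue (λ x → adj X v x ∧ f x)) → coreᵇ X (enum f) ≡ true
enum-core X f deg = ∧-intro (enum-distinct f) (minDegree2-tabulate X (enum f) (enum f) λ a →
  subst (2 ≤_) (sym (countIn-enum f (adj X (lookup (enum f) a)))) (deg (enum-sat f a)))

core-transfer : ∀ {ℓ} (H G : Graph n) → SameDeck ℓ H G → ℓ ≤ n → r ≤ ℓ →
  (∀ t → coreᵇ {r = r} G t ≢ true) → ∀ t → coreᵇ {r = r} H t ≢ true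
core-transfer {r = r} H G deck ℓ≤n r≤ℓ noCore t e = contradiction (sumV-all-zero r (λ t → ind-nonNeg (coreᵇ H t))
    (trans (tuple-sum-≡ core core-invariant H G deck r≤ℓ ℓ≤n) (trans (sumV-cong r vanish) (sumV-zero r))) t)
  nonzero
  where
  vanish : ∀ t → core G t ≡ 0ℤ
  vanish t with coreᵇ G t in eq
  ... | true  = contradiction eq (noCore t)
  ... | false = refl
  nonzero : core H t ≢ 0ℤ
  nonzero rewrite e = λ ()

-- The ends of a trail and the nonleaves off it

ends : ℕ → (ℕ → Fin n) → Fin n → ℕ
ends k p v = boolToℕ (eqᵇ v (p 0)) + boolToℕ (eqᵇ v (p k))

-- The total is 2 even for k = 0, where the single vertex counts as both ends.
sum-ends : ∀ k (p : ℕ → Fin n) → sum (λ v → pos (ends k p v)) ≡ 2ℤ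
sum-ends k p = trans (∑-distrib-+ (λ v → ind (eqᵇ v (p 0))) (λ v → ind (eqᵇ v (p k)))) (cong₂ _+ᶻ_ (once (p 0)) (once (p k)))
  where
  once : ∀ u → sum (λ v → ind (eqᵇ v u)) ≡ 1ℤ
  once u = trans (sum-ind (λ v → eqᵇ v u)) (cong pos (count-eq u))

spine-ends : ∀ {G : Graph n} {k p} → Spine G (suc k) p → ∀ {v} → nl G v ≡ true → 2 ≤ ends k p v + ν G v
spine-ends {n} {G} {k} {p} S nlv with Spine.covers S nlv
... | i , i<k , refl = cases i i<k
  where
  open Spine S
  one-nbr : ∀ {v x} → nlNbr G v x ≡ true → 1 ≤ ν G v
  one-nbr {v} e = subst (1 ≤_) (sym (count-take (nlNbr G v) e)) (s≤s z≤n)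
  cases : ∀ i → i < suc k → 2 ≤ ends k p (p i) + ν G (p i)
  cases zero 0<1+k with below-suc 0<1+k
  ... | inj₂ refl rewrite eqᵇ-refl (p 0) = s≤s (s≤s z≤n)
  ... | inj₁ 0<k  rewrite eqᵇ-refl (p 0) = s≤s (ℕₚ.≤-trans (one-nbr (next-nlNbr S (s≤s 0<k))) (ℕₚ.m≤n+m _ _))
  cases (suc i) 1+i<k with below-suc 1+i<k
  ... | inj₂ refl rewrite eqᵇ-refl (p (suc i)) = ℕₚ.+-mono-≤ (ℕₚ.m≤n+m 1 _) (one-nbr (prev-nlNbr S 1+i<k))
  ... | inj₁ 1+i<k′ = ℕₚ.≤-trans two (ℕₚ.m≤n+m _ _)
    where
    two : 2 ≤ ν G (p (suc i))
    two = subst (2 ≤_) (sym (trans (count-take (nlNbr G (p (suc i))) (prev-nlNbr S 1+i<k))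
        (cong suc (count-take (nlNbr G (p (suc i)) ∖ p i)
          (∖-intro (nlNbr G (p (suc i))) (next-nlNbr S (s≤s 1+i<k′))
            λ eq → ℕₚ.<⇒≢ (ℕₚ.m≤n⇒m≤1+n (ℕₚ.n<1+n i)) (inj _ _ (ℕₚ.<⇒≤ 1+i<k) (s≤s 1+i<k′) eq))))))
      (s≤s (s≤s z≤n))

-- The reverse of the bound in `spine-ends`: three-freeness caps ν at 2, and an end of the trail
-- falls short of this by at least 1, the vertex of a one-vertex trail by 2.
trail-ends : ∀ {H : Graph n} {k p} → ThreeFree H → Trail H (suc k) p → Closed H (suc k) p →
  ∀ v → ends k p v + ν H v ≤ 2
trail-ends {n} {H} {k} {p} tf T closed v with v ≟ p 0 | v ≟ p k
... | no _     | no _  = count-≤2 (nlNbr H v) (tf v)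
... | yes refl | no _  = s≤s (Trail.start T)
... | no _     | yes refl = s≤s (trail-last tf T closed)
... | yes refl | yes eq with Trail.inj T 0 k (s≤s z≤n) (ℕₚ.n<1+n k) eq
... | refl rewrite trail-single tf T closed = ℕₚ.≤-refl

excess-≤ : (G : Graph n) → ∀ {v e} → (nl G v ≡ true → 2 ≤ e + ν G v) → excess G v ≤ᶻ pos e
excess-≤ G {v} {e} h with nl G v
... | false = ℤ.+≤+ z≤n
... | true  = subst (_≤ᶻ pos e) (sym (ℤₚ.*-identityˡ (2ℤ -ᶻ pos (ν G v))))
  (subst (2ℤ -ᶻ pos (ν G v) ≤ᶻ_) (cancel (pos e) (pos (ν G v))) (ℤₚ.+-monoˡ-≤ (-ᶻ pos (ν G v)) (ℤ.+≤+ (h refl))))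
  where
  cancel : ∀ a b → a +ᶻ b -ᶻ b ≡ a
  cancel = ℤ-Solver.solve-∀

≤-excess : (H : Graph n) → ∀ {v e} → nl H v ≡ true → e + ν H v ≤ 2 → pos e ≤ᶻ excess H v
≤-excess H {v} {e} nlv h rewrite nlv = subst₂ _≤ᶻ_ (cancel (pos e) (pos (ν H v)))
  (sym (ℤₚ.*-identityˡ (2ℤ -ᶻ pos (ν H v)))) (ℤₚ.+-monoˡ-≤ (-ᶻ pos (ν H v)) (ℤ.+≤+ h))
  where
  cancel : ∀ a b → a +ᶻ b -ᶻ b ≡ a
  cancel = ℤ-Solver.solve-∀

sum-mono : {f g : Fin n → ℤ} → (∀ x → f x ≤ᶻ g x) → sum f ≤ᶻ sum g
sum-mono {zero}  f≤g = ℤₚ.≤-refl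
sum-mono {suc n} f≤g = ℤₚ.+-mono-≤ (f≤g zero) (sum-mono (f≤g ∘ suc))

sum-squeeze : {f g : Fin n → ℤ} → (∀ x → f x ≤ᶻ g x) → sum g ≤ᶻ sum f → ∀ x → f x ≡ g x
sum-squeeze {n} {f} {g} f≤g Σg≤Σf x = sym (ℤₚ.i-j≡0⇒i≡j (g x) (f x)
  (sum-zero {f = λ x → g x -ᶻ f x} (λ x → ℤₚ.i≤j⇒0≤j-i (f≤g x)) zeroSum x))
  where
  cancel : ∀ a b → b -ᶻ a +ᶻ a ≡ 0ℤ +ᶻ b
  cancel = ℤ-Solver.solve-∀
  zeroSum : sum (λ x → g x -ᶻ f x) ≡ 0ℤ
  zeroSum = +ᶻ-cancelʳ (sum f) _ _ (begin
    sum (λ x → g x -ᶻ f x) +ᶻ sum f    ≡⟨ sym (∑-distrib-+ (λ x → g x -ᶻ f x) f) ⟩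
    sum (λ x → g x -ᶻ f x +ᶻ f x)      ≡⟨ sum-cong-≗ (λ x → trans (cancel (f x) (g x)) (ℤₚ.+-identityˡ (g x))) ⟩
    sum g                              ≡⟨ ℤₚ.≤-antisym Σg≤Σf (sum-mono f≤g) ⟩
    sum f                              ≡⟨ sym (ℤₚ.+-identityˡ (sum f)) ⟩
    0ℤ +ᶻ sum f                        ∎)
    where open ≡-Reasoning

spine-count : ∀ {G : Graph n} {k p} → Spine G k p → countTrue (nl G) ≡ k
spine-count {G = G} {k} {p} S = trans (count-range (nl G) p k inj covers)
  (trans (sumTo-cong k λ i i<k → cong boolToℕ (nonleaf i i<k)) (sumTo-ones k))
  where open Spine S

module _ {ℓ} {H G : Graph n} {k k′} {p p′ : ℕ → Fin n} (deck : SameDeck ℓ H G) (ℓ≤n : ℓ ≤ n)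
  (S : Spine G (suc k) p) (tf : ThreeFree H) (T : Trail H (suc k′) p′) (closed : Closed H (suc k′) p′)
  (nl-count : countTrue (nl H) ≡ countTrue (nl G)) (excess-eq : sum (excess H) ≡ sum (excess G)) where

  private
    off-trail : Fin n → Bool
    off-trail = removeAll (nl H) p′ (suc k′)

  -- Both sums of `ends` are 2, while the excess is at most `ends` on G and at least `ends` on H.
  -- Since the total excesses agree, all the inequalities on H are tight.
  excess-ends : ∀ v → pos (ends k′ p′ v) ≡ excess H v
  excess-ends = sum-squeeze lower (subst₂ _≤ᶻ_ (sym excess-eq) (trans (sum-ends k p) (sym (sum-ends k′ p′)))
    (sum-mono {f = excess G} {g = λ v → pos (ends k p v)} λ v → excess-≤ G {v} {ends k p v} (spine-ends S)))
    where
    lower : ∀ v → pos (ends k′ p′ v) ≤ᶻ excess H v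
    lower v with nl H v in eq
    ... | true  = subst (pos (ends k′ p′ v) ≤ᶻ_) (cong (λ b → ind b *ᶻ (2ℤ -ᶻ pos (ν H v))) eq)
      (≤-excess H eq (trail-ends tf T closed v))
    ... | false = ℤₚ.≤-reflexive (cong pos (cong₂ _+_
      (not-end 0 (s≤s z≤n)) (not-end k′ (ℕₚ.n<1+n k′))))
      where
      not-end : ∀ i → i < suc k′ → boolToℕ (eqᵇ v (p′ i)) ≡ 0
      not-end i i<k = cong boolToℕ (eqᵇ-≢ {x = v} {p′ i} λ { refl → true≢false (Trail.nonleaf T i i<k) eq })

  off-trail-ν : ∀ {v} → off-trail v ≡ true → ν H v ≡ 2
  off-trail-ν {v} off with removeAll-elim (nl H) p′ (suc k′) off
  ... | nlv , fresh = sym (ℤₚ.+-injective (ℤₚ.i-j≡0⇒i≡j 2ℤ (pos (ν H v)) (trans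
    (sym (trans (cong (λ b → ind b *ᶻ (2ℤ -ᶻ pos (ν H v))) nlv) (ℤₚ.*-identityˡ (2ℤ -ᶻ pos (ν H v)))))
    (trans (sym (excess-ends v)) (cong pos (cong₂ _+_
      (cong boolToℕ (eqᵇ-≢ (fresh 0 (s≤s z≤n) ∘ sym))) (cong boolToℕ (eqᵇ-≢ (fresh k′ (ℕₚ.n<1+n k′) ∘ sym)))))))))

  -- An off-trail nonleaf has exactly two nonleaf neighbours, and closedness keeps both off the
  -- trail. The off-trail nonleaves thus induce a disjoint union of cycles.
  off-trail-degree : ∀ {v} → off-trail v ≡ true → 2 ≤ countTrue (λ x → adj H v x ∧ off-trail x)
  off-trail-degree {v} off = ℕₚ.≤-reflexive (trans (sym (off-trail-ν off)) (count-cong same))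
    where
    same : ∀ x → nlNbr H v x ≡ adj H v x ∧ off-trail x
    same x with adj H v x in vx
    ... | false = refl
    ... | true with nl H x in nlx
    ...   | true = sym (removeAll-intro (nl H) p′ (suc k′) nlx λ i i<k eq →
      let nlv , fresh = removeAll-elim (nl H) p′ (suc k′) off
          j , j<k , eq′ = closed i<k (∧-intro (subst (λ w → adj H w v ≡ true) (sym eq) (adj-swap H vx)) nlv)
      in fresh j j<k eq′)
    ...   | false with off-trail x in off′
    ...     | false = refl
    ...     | true  = contradiction nlx (true≢false (proj₁ (removeAll-elim (nl H) p′ (suc k′) off′)))

  nl-count-trail : countTrue (nl G) ≡ suc k′ + countTrue off-trail
  nl-count-trail = trans (sym nl-count) (trans (count-removeAll (nl H) p′ (suc k′) (Trail.inj T))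
    (cong (_+ countTrue off-trail) (trans (sumTo-cong (suc k′) λ i i<k → cong boolToℕ (Trail.nonleaf T i i<k))
      (sumTo-ones (suc k′)))))

  -- There are k - k′ nonleaves off the trail. If there were any, they would form a core with at
  -- most ℓ vertices, which the deck detects and G does not have.
  none-off-trail : k ∸ k′ ≤ ℓ → countTrue off-trail ≡ 0
  none-off-trail k∸k′≤ℓ with countTrue off-trail in eq
  ... | zero  = refl
  ... | suc c = contradiction (enum-core H off-trail off-trail-degree)
    (core-transfer H G deck ℓ≤n (subst (_≤ ℓ) k∸k′≡ k∸k′≤ℓ) (noCore eq) (enum off-trail))
    where
    k∸k′≡ : k ∸ k′ ≡ countTrue off-trail
    k∸k′≡ = trans (cong (_∸ suc k′) (trans (sym (spine-count S)) nl-count-trail)) (ℕₚ.m+n∸m≡n (suc k′) (countTrue off-trail))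
    -- The length has to be positive, since the empty tuple counts as a core.
    noCore : ∀ {c d} → d ≡ suc c → (t : Vec (Fin n) d) → coreᵇ G t ≢ true
    noCore refl = spine-no-core S

  abstract
    trail-length : k ∸ k′ ≤ ℓ → k ≡ k′
    trail-length k∸k′≤ℓ = ℕₚ.suc-injective (trans (sym (spine-count S)) (trans nl-count-trail
      (trans (cong (suc k′ +_) (none-off-trail k∸k′≤ℓ)) (ℕₚ.+-identityʳ (suc k′)))))

  abstract
    trail-covers : k ∸ k′ ≤ ℓ → ∀ {v} → nl H v ≡ true → OnTrail (suc k′) p′ v
    trail-covers k∸k′≤ℓ {v} nlv with ℕₚ.anyUpTo? (λ i → p′ i ≟ v) (suc k′)
    ... | yes on = on
    ... | no off = contradiction
      (trans (sym (none-off-trail k∸k′≤ℓ)) (count-take off-trail (removeAll-intro (nl H) p′ (suc k′) nlv λ i i<k eq → off (i , i<k , eq))))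
      λ ()

-- Caterpillars with equal spine degrees are isomorphic

count-punchIn : (f : Fin (suc n) → Bool) (y : Fin (suc n)) → countTrue f ≡ boolToℕ (f y) + countTrue (f ∘ punchIn y)
count-punchIn {n}     f zero    = refl
count-punchIn {suc n} f (suc y) = trans
  (cong (boolToℕ (f zero) +_) (count-punchIn (f ∘ suc) y)) (swap (boolToℕ (f zero)) (boolToℕ (f (suc y))) _)
  where
  swap : ∀ a b c → a + (b + c) ≡ b + (a + c)
  swap = ℕ-Solver.solve-∀

module _ {A : Set} (_≟ₐ_ : DecidableEquality A) where

  fibre : (Fin n → A) → A → ℕ
  fibre c a = countTrue λ x → does (c x ≟ₐ a)

  -- Vertex 0 is sent to any vertex of its colour; after deleting both, the fibres still have equal
  -- sizes.
  match-fibres : (c d : Fin n → A) → (∀ a → fibre c a ≡ fibre d a) →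
    Σ (Permutation n n) λ π → ∀ x → d (π ⟨$⟩ʳ x) ≡ c x
  match-fibres {zero}  c d eq = Perm.id , λ ()
  match-fibres {suc n} c d eq = Perm.insert zero y (proj₁ rest) , agree
    where
    found : ∃ λ y → does (d y ≟ₐ c zero) ≡ true
    found = count-witness _ (subst (1 ≤_) (trans (cong (λ b → boolToℕ b + fibre (c ∘ suc) (c zero))
      (sym (dec-true (c zero ≟ₐ c zero) refl))) (eq (c zero))) (s≤s z≤n))
    y = proj₁ found
    dy : d y ≡ c zero
    dy = does-true (d y ≟ₐ c zero) (proj₂ found)
    rest = match-fibres (c ∘ suc) (d ∘ punchIn y) λ a → ℕₚ.+-cancelˡ-≡ (boolToℕ (does (c zero ≟ₐ a))) _ _ (trans (eq a)
      (trans (count-punchIn (λ x → does (d x ≟ₐ a)) y)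
        (cong (λ z → boolToℕ (does (z ≟ₐ a)) + fibre (d ∘ punchIn y) a) dy)))
    agree : ∀ x → d (Perm.insert zero y (proj₁ rest) ⟨$⟩ʳ x) ≡ c x
    agree zero    = dy
    agree (suc x) = trans (cong d (Perm.insert-punchIn zero y (proj₁ rest) x)) (proj₂ rest x)

bool-ext : ∀ {a b} → (a ≡ true → b ≡ true) → (b ≡ true → a ≡ true) → a ≡ b
bool-ext {true}  {true}  f g = refl
bool-ext {true}  {false} f g = sym (f refl)
bool-ext {false} {true}  f g = g refl
bool-ext {false} {false} f g = refl

count-split : (f g : Fin n → Bool) →
  countTrue f ≡ countTrue (λ x → f x ∧ g x) + countTrue (λ x → f x ∧ not (g x))
count-split {zero}  f g = refl
count-split {suc n} f g with f zero | g zero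
... | false | _     = count-split (f ∘ suc) (g ∘ suc)
... | true  | true  = cong suc (count-split (f ∘ suc) (g ∘ suc))
... | true  | false = trans (cong suc (count-split (f ∘ suc) (g ∘ suc))) (sym (ℕₚ.+-suc _ _))

-- A vertex is coded by its spine index, with true for the spine vertex and false for a leaf hanging from it.
Code : Set
Code = ℕ × Bool

_≟ᶜ_ : DecidableEquality Code
_≟ᶜ_ = ×ₚ.≡-dec ℕₚ._≟_ Boolₚ._≟_

adjᶜ : Code → Code → Bool
adjᶜ (i , true)  (j , true)  = does (j ℕₚ.≟ suc i) ∨ does (i ℕₚ.≟ suc j)
adjᶜ (i , true)  (j , false) = does (i ℕₚ.≟ j)
adjᶜ (i , false) (j , true)  = does (i ℕₚ.≟ j)
adjᶜ (i , false) (j , false) = false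

consec-true : ∀ {i j} → Consec i j → adjᶜ (i , true) (j , true) ≡ true
consec-true {i} {j} (inj₁ eq) = cong (_∨ does (i ℕₚ.≟ suc j)) (dec-true (j ℕₚ.≟ suc i) eq)
consec-true {i} {j} (inj₂ eq) = trans (cong (does (j ℕₚ.≟ suc i) ∨_) (dec-true (i ℕₚ.≟ suc j) eq)) (Boolₚ.∨-zeroʳ _)

true-consec : ∀ i j → adjᶜ (i , true) (j , true) ≡ true → Consec i j
true-consec i j e with j ℕₚ.≟ suc i
... | yes eq = inj₁ eq
... | no ne  = inj₂ (does-true (i ℕₚ.≟ suc j)
  (trans (sym (cong (_∨ does (i ℕₚ.≟ suc j)) (dec-false (j ℕₚ.≟ suc i) ne))) e))

module Coding {X : Graph n} {k} {p : ℕ → Fin n} (S : Spine X k p) where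
  open Spine S

  data Coded (v : Fin n) : Code → Set where
    onSpine : ∀ {i} → i < k → p i ≡ v → Coded v (i , true)
    onLeaf  : ∀ {i} → i < k → adj X v (p i) ≡ true → nl X v ≡ false → Coded v (i , false)

  coded : ∀ v → ∃ (Coded v)
  coded v with nl X v in eq
  ... | true  = let i , i<k , e = covers eq in (i , true) , onSpine i<k e
  ... | false = let i , i<k , e = attached eq in (i , false) , onLeaf i<k e eq

  code : Fin n → Code
  code v = proj₁ (coded v)

  spine-adj : ∀ {i j} → i < k → j < k → adj X (p i) (p j) ≡ adjᶜ (i , true) (j , true)
  spine-adj {i} {j} i<k j<k = bool-ext (λ e → consec-true (adj⇒consec i j i<k j<k e)) (back ∘ true-consec i j)
    where
    back : Consec i j → adj X (p i) (p j) ≡ true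
    back (inj₁ refl) = consec⇒adj i j<k
    back (inj₂ refl) = adj-swap X (consec⇒adj j i<k)

  leaf-adj : ∀ {v i j} → i < k → j < k → adj X v (p j) ≡ true → nl X v ≡ false →
    adj X v (p i) ≡ does (i ℕₚ.≟ j)
  leaf-adj {v} {i} {j} i<k j<k vj leaf = bool-ext
    (λ vi → dec-true (i ℕₚ.≟ j) (inj i j i<k j<k (leaf-unique X leaf vi vj)))
    (λ e → subst (λ a → adj X v (p a) ≡ true) (sym (does-true (i ℕₚ.≟ j) e)) vj)

  -- Since codes alone decide adjacency, a permutation that preserves codes is an isomorphism.
  coded-adj : ∀ {u v c d} → Coded u c → Coded v d → adj X u v ≡ adjᶜ c d
  coded-adj (onSpine i<k refl) (onSpine j<k refl) = spine-adj i<k j<k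
  coded-adj {v = v} (onSpine {i} i<k refl) (onLeaf j<k vj leaf) = trans (adj-sym X (p i) v) (leaf-adj i<k j<k vj leaf)
  coded-adj (onLeaf {i} i<k ui leaf) (onSpine {j} j<k refl) = trans (leaf-adj j<k i<k ui leaf)
    (bool-ext (λ e → dec-true (i ℕₚ.≟ j) (sym (does-true (j ℕₚ.≟ i) e)))
              (λ e → dec-true (j ℕₚ.≟ i) (sym (does-true (i ℕₚ.≟ j) e))))
  coded-adj {u} {v} (onLeaf {i} i<k ui leaf) (onLeaf _ _ leaf′) with adj X u v in uv
  ... | false = refl
  ... | true  = contradiction leaf′
    (true≢false (subst (λ w → nl X w ≡ true) (leaf-unique X leaf ui uv) (nonleaf i i<k)))

  code-spine : ∀ {i v} → i < k → does (code v ≟ᶜ (i , true)) ≡ eqᵇ v (p i)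
  code-spine {i} {v} i<k = bool-ext (λ e → to (coded v) (does-true (code v ≟ᶜ (i , true)) e))
    (λ e → dec-true (code v ≟ᶜ (i , true)) (from (coded v) (does-true (v ≟ p i) e)))
    where
    to : (c : ∃ (Coded v)) → proj₁ c ≡ (i , true) → eqᵇ v (p i) ≡ true
    to (_ , onSpine _ refl) refl = eqᵇ-refl (p i)
    from : (c : ∃ (Coded v)) → v ≡ p i → proj₁ c ≡ (i , true)
    from (_ , onSpine j<k eq)   refl = cong (_, true) (inj _ _ j<k i<k eq)
    from (_ , onLeaf _ _ leaf) refl = contradiction leaf (true≢false (nonleaf i i<k))

  code-leaf : ∀ {i v} → i < k → does (code v ≟ᶜ (i , false)) ≡ adj X (p i) v ∧ not (nl X v)
  code-leaf {i} {v} i<k = bool-ext (λ e → to (coded v) (does-true (code v ≟ᶜ (i , false)) e))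
    (λ e → dec-true (code v ≟ᶜ (i , false)) (from (coded v) (∧-elim (adj X (p i) v) e)))
    where
    to : (c : ∃ (Coded v)) → proj₁ c ≡ (i , false) → adj X (p i) v ∧ not (nl X v) ≡ true
    to (_ , onLeaf _ vi leaf) refl = ∧-intro (adj-swap X vi) (cong not leaf)
    from : (c : ∃ (Coded v)) → adj X (p i) v ≡ true × not (nl X v) ≡ true → proj₁ c ≡ (i , false)
    from (_ , onSpine j<k refl) (_ , leaf) = contradiction (cong not (nonleaf _ j<k)) (true≢false leaf)
    from (_ , onLeaf {j} j<k vj leaf) (iv , _) =
      cong (_, false) (inj j i j<k i<k (leaf-unique X leaf vj (adj-swap X iv)))

  code-bound : ∀ {v i b} → code v ≡ (i , b) → i < k
  code-bound {v} eq = go (coded v) eq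
    where
    go : ∀ {i b} (c : ∃ (Coded v)) → proj₁ c ≡ (i , b) → i < k
    go (_ , onSpine i<k _)  refl = i<k
    go (_ , onLeaf i<k _ _) refl = i<k

  ν-spine : ∀ {i} → i < k → ν X (p i) ≡ sumTo k (λ j → boolToℕ (adjᶜ (i , true) (j , true)))
  ν-spine {i} i<k = trans
    (count-range (nlNbr X (p i)) p k inj (λ {x} e → covers (proj₂ (∧-elim (adj X (p i) x) e))))
    (sumTo-cong k λ j j<k → cong boolToℕ (trans (cong (adj X (p i) (p j) ∧_) (nonleaf j j<k))
      (trans (Boolₚ.∧-identityʳ _) (spine-adj i<k j<k))))

  fibre-spine : ∀ {i} → i < k → fibre _≟ᶜ_ code (i , true) ≡ 1
  fibre-spine {i} i<k = trans (count-cong λ v → code-spine {v = v} i<k) (count-eq (p i))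

  -- The number of spine neighbours depends on i and k alone, so on spines of equal length equal
  -- degrees force equal numbers of hanging leaves.
  fibre-leaf : ∀ {i} → i < k →
    degree X (p i) ≡ sumTo k (λ j → boolToℕ (adjᶜ (i , true) (j , true))) + fibre _≟ᶜ_ code (i , false)
  fibre-leaf {i} i<k = trans (count-split (adj X (p i)) (nl X))
    (cong₂ _+_ (ν-spine i<k) (count-cong λ v → sym (code-leaf {v = v} i<k)))

  fibre-outside : ∀ {i b} → ¬ i < k → fibre _≟ᶜ_ code (i , b) ≡ 0
  fibre-outside {i} {b} i≮k = count-none λ v e → i≮k (code-bound {v} (does-true (code v ≟ᶜ (i , b)) e))

spine-iso : ∀ {H G : Graph n} {k q p} → Spine H k q → Spine G k p →
  (∀ i → i < k → degree H (q i) ≡ degree G (p i)) → Iso H G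
spine-iso {n} {H} {G} {k} SH SG deg = π , λ u v →
  trans (CH.coded-adj (proj₂ (CH.coded u)) (proj₂ (CH.coded v)))
    (trans (cong₂ adjᶜ (sym (agree u)) (sym (agree v)))
      (sym (CG.coded-adj (proj₂ (CG.coded (π ⟨$⟩ʳ u))) (proj₂ (CG.coded (π ⟨$⟩ʳ v))))))
  where
  module CH = Coding SH
  module CG = Coding SG
  fibres : ∀ a → fibre _≟ᶜ_ CH.code a ≡ fibre _≟ᶜ_ CG.code a
  fibres (i , b) with i <? k
  fibres (i , b)     | no i≮k = trans (CH.fibre-outside i≮k) (sym (CG.fibre-outside i≮k))
  fibres (i , true)  | yes i<k = trans (CH.fibre-spine i<k) (sym (CG.fibre-spine i<k))
  fibres (i , false) | yes i<k = ℕₚ.+-cancelˡ-≡ (sumTo k (λ j → boolToℕ (adjᶜ (i , true) (j , true)))) _ _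
    (trans (sym (CH.fibre-leaf i<k)) (trans (deg i i<k) (CG.fibre-leaf i<k)))
  matching = match-fibres _≟ᶜ_ CH.code CG.code fibres
  π = proj₁ matching
  agree = proj₂ matching

-- The spine of a caterpillar

elems-∈ : (P : Subset n) (i : Fin (size P)) → lookup P (elems P i) ≡ true
elems-∈ (true ∷ P)  zero    = refl
elems-∈ (true ∷ P)  (suc i) = elems-∈ P i
elems-∈ (false ∷ P) i       = elems-∈ P i

elems-surjective : (P : Subset n) {v : Fin n} → lookup P v ≡ true → ∃ λ i → elems P i ≡ v
elems-surjective (true ∷ P)  {zero}  e = zero , refl
elems-surjective (true ∷ P)  {suc v} e = let i , eq = elems-surjective P e in suc i , cong suc eq
elems-surjective (false ∷ P) {suc v} e = let i , eq = elems-surjective P e in i , cong suc eq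

third-vertex : (v x : Fin (suc (suc (suc n)))) → ∃ λ w → w ≢ v × w ≢ x
third-vertex zero          zero          = suc zero , (λ ()) , (λ ())
third-vertex zero          (suc zero)    = suc (suc zero) , (λ ()) , (λ ())
third-vertex zero          (suc (suc x)) = suc zero , (λ ()) , (λ ())
third-vertex (suc zero)    zero          = suc (suc zero) , (λ ()) , (λ ())
third-vertex (suc (suc v)) zero          = suc zero , (λ ()) , (λ ())
third-vertex (suc v)       (suc x)       = zero , (λ ()) , (λ ())

-- Two adjacent leaves form a component, which in a connected graph leaves no place for a third
-- vertex.
leaf-pair-walk : (G : Graph n) {v x u w : Fin n} → nl G v ≡ false → nl G x ≡ false → adj G v x ≡ true →
  Walk G u w → u ≡ v ⊎ u ≡ x → w ≡ v ⊎ w ≡ x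
leaf-pair-walk G lv lx vx here        at          = at
leaf-pair-walk G lv lx vx (step e wk) (inj₁ refl) = leaf-pair-walk G lv lx vx wk (inj₂ (leaf-unique G lv e vx))
leaf-pair-walk G lv lx vx (step e wk) (inj₂ refl) = leaf-pair-walk G lv lx vx wk (inj₁ (leaf-unique G lx e (adj-swap G vx)))

walk-degree : (G : Graph n) {v w : Fin n} → Walk G v w → w ≢ v → 1 ≤ degree G v
walk-degree G         here                w≢v = contradiction refl w≢v
walk-degree G {v = v} (step {k = x} e wk) w≢v = subst (1 ≤_) (sym (count-take (adj G v) {x} e)) (s≤s z≤n)

module _ {n : ℕ} (G : Graph (suc (suc (suc n)))) (connected : Connected G) (isPath : IsPath (induced G (nonLeaves G))) where

  private
    P = nonLeaves G
    σ = proj₁ isPath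

  connected-degree : ∀ v → 1 ≤ degree G v
  connected-degree v = let w , w≢v , _ = third-vertex v v in walk-degree G (connected v w) w≢v

  connected-leaf-nl : ∀ {v x} → nl G v ≡ false → adj G v x ≡ true → nl G x ≡ true
  connected-leaf-nl {v} {x} lv vx with nl G x in lx
  ... | true  = refl
  ... | false with third-vertex v x
  ... | w , w≢v , w≢x with leaf-pair-walk G lv lx vx (connected v w) (inj₁ refl)
  ... | inj₁ w≡v = contradiction w≡v w≢v
  ... | inj₂ w≡x = contradiction w≡x w≢x

  spineVertex : Fin (size P) → Fin (suc (suc (suc n)))
  spineVertex a = elems P (Inverse.to σ a)

  spineAt : ℕ → Fin (suc (suc (suc n)))
  spineAt i with i <? size P
  ... | yes i<k = spineVertex (fromℕ< i<k)
  ... | no  _   = zero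

  spineAt-< : ∀ {i} (i<k : i < size P) → spineAt i ≡ spineVertex (fromℕ< i<k)
  spineAt-< {i} i<k with i <? size P
  ... | yes i<k′ = cong spineVertex (Finₚ.fromℕ<-cong i i refl i<k′ i<k)
  ... | no  i≮k  = contradiction i<k i≮k

  lookup-nonLeaves : ∀ v → lookup P v ≡ nl G v
  lookup-nonLeaves = Vecₚ.lookup∘tabulate (nl G)

  spine-covers : ∀ {v} → nl G v ≡ true → ∃ λ i → i < size P × spineAt i ≡ v
  spine-covers {v} nlv with elems-surjective P {v} (trans (lookup-nonLeaves v) nlv)
  ... | b , eq = toℕ a , Finₚ.toℕ<n a , trans (spineAt-< (Finₚ.toℕ<n a))
      (trans (cong spineVertex (Finₚ.fromℕ<-toℕ a (Finₚ.toℕ<n a))) (trans (cong (elems P) (Inverse.strictlyInverseˡ σ b)) eq))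
    where a = Inverse.from σ b

  nonLeaf-spine : Spine G (size P) spineAt
  nonLeaf-spine = record
    { inj        = λ i j i<k j<k eq → trans (sym (Finₚ.toℕ-fromℕ< i<k)) (trans
        (cong toℕ (↔-injective σ (elems-injective P (trans (sym (spineAt-< i<k)) (trans eq (spineAt-< j<k))))))
        (Finₚ.toℕ-fromℕ< j<k))
    ; nonleaf    = λ i i<k → trans (cong (nl G) (spineAt-< i<k))
        (trans (sym (lookup-nonLeaves _)) (elems-∈ P (Inverse.to σ (fromℕ< i<k))))
    ; covers     = spine-covers
    ; adj⇒consec = λ i j i<k j<k e → subst₂ Consec (Finₚ.toℕ-fromℕ< i<k) (Finₚ.toℕ-fromℕ< j<k)
        (Equivalence.to (proj₂ isPath (fromℕ< i<k) (fromℕ< j<k))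
          (subst₂ (λ u v → adj G u v ≡ true) (spineAt-< i<k) (spineAt-< j<k) e))
    ; consec⇒adj = λ i 1+i<k → let i<k = ℕₚ.<⇒≤ 1+i<k in
        subst₂ (λ u v → adj G u v ≡ true) (sym (spineAt-< i<k)) (sym (spineAt-< 1+i<k))
          (Equivalence.from (proj₂ isPath (fromℕ< i<k) (fromℕ< 1+i<k))
            (inj₁ (trans (Finₚ.toℕ-fromℕ< 1+i<k) (cong suc (sym (Finₚ.toℕ-fromℕ< i<k))))))
    ; attached   = λ {v} leaf → let x , vx = count-witness (adj G v) (connected-degree v)
                                    i , i<k , eq = spine-covers (connected-leaf-nl leaf vx)
                                in i , i<k , subst (λ w → adj G v w ≡ true) (sym eq) vx
    }

spine-nonempty : ∀ {G : Graph n} {k p} → Spine G k p → Fin n → 1 ≤ k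
spine-nonempty {G = G} S v with nl G v in eq
... | true  = let _ , i<k , _ = Spine.covers S eq in ℕₚ.≤-trans (s≤s z≤n) i<k
... | false = let _ , i<k , _ = Spine.attached S eq in ℕₚ.≤-trans (s≤s z≤n) i<k

abstract
  -- A tree on two vertices has no nonleaf, and one on a single vertex has degree 0; three vertices
  -- exclude both cases.
  caterpillar-spine : (G : Graph n) → IsCaterpillar G → 3 ≤ n →
    ∃₂ λ k p → Spine G (suc k) p × (∀ v → 1 ≤ degree G v)
  caterpillar-spine {suc (suc (suc n))} G ((_ , connected , _) , isPath) (s≤s (s≤s (s≤s z≤n))) =
    split (nonLeaf-spine G connected isPath) (spine-nonempty (nonLeaf-spine G connected isPath) zero)
    where
    split : ∀ {k p} → Spine G k p → 1 ≤ k → ∃₂ λ k p → Spine G (suc k) p × (∀ v → 1 ≤ degree G v)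
    split {suc k} {p} S _ = k , p , S , connected-degree G connected isPath

spine-leaf-nl : ∀ {G : Graph n} {k p} → Spine G k p → ∀ {v x} → nl G v ≡ false → adj G v x ≡ true → nl G x ≡ true
spine-leaf-nl {G = G} S leaf vx with Spine.attached S leaf
... | i , i<k , vi = subst (λ w → nl G w ≡ true) (leaf-unique G leaf vi vx) (Spine.nonleaf S i i<k)

-- The number of vertices of large degree

count-all : ∀ n → countTrue {n} (λ _ → true) ≡ n
count-all zero    = refl
count-all (suc n) = cong suc (count-all n)

leafNbrs : Graph n → Fin n → ℕ
leafNbrs G v = countTrue λ x → adj G v x ∧ not (nl G x)

-- Double counting of adjacent pairs whose second vertex is a leaf: each leaf has exactly one
-- neighbour.
sum-leafNbrs : (G : Graph n) → sum (λ v → pos (leafNbrs G v)) ≡ pos (countTrue (not ∘ nl G))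
sum-leafNbrs G = begin
  sum (λ v → pos (leafNbrs G v))
    ≡⟨ sum-cong-≗ (λ v → trans (sym (sum-ind (λ x → adj G v x ∧ not (nl G x))))
         (sum-cong-≗ λ x → sym (ind-∧ (adj G v x) (not (nl G x))))) ⟩
  sum (λ v → sum λ x → ind (adj G v x) *ᶻ ind (not (nl G x)))
    ≡⟨ ∑-comm (λ v x → ind (adj G v x) *ᶻ ind (not (nl G x))) ⟩
  sum (λ x → sum λ v → ind (adj G v x) *ᶻ ind (not (nl G x)))
    ≡⟨ sum-cong-≗ column ⟩
  sum (λ x → ind (not (nl G x)))
    ≡⟨ sum-ind (not ∘ nl G) ⟩
  pos (countTrue (not ∘ nl G)) ∎
  where
  open ≡-Reasoning
  column : ∀ x → sum (λ v → ind (adj G v x) *ᶻ ind (not (nl G x))) ≡ ind (not (nl G x))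
  column x = begin
    sum (λ v → ind (adj G v x) *ᶻ ind (not (nl G x)))
      ≡⟨ sum-cong-≗ (λ v → trans (ℤₚ.*-comm (ind (adj G v x)) _) (cong (λ b → ind (not (nl G x)) *ᶻ ind b) (adj-sym G v x))) ⟩
    sum (λ v → ind (not (nl G x)) *ᶻ ind (adj G x v))
      ≡⟨ sym (*-distribˡ-sum (ind (not (nl G x))) (ind ∘ adj G x)) ⟩
    ind (not (nl G x)) *ᶻ sum (ind ∘ adj G x)
      ≡⟨ cong (ind (not (nl G x)) *ᶻ_) (sum-ind (adj G x)) ⟩
    ind (not (nl G x)) *ᶻ pos (degree G x)
      ≡⟨ leaf-term ⟩
    ind (not (nl G x)) ∎
    where
    leaf-term : ind (not (nl G x)) *ᶻ pos (degree G x) ≡ ind (not (nl G x))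
    leaf-term with nl G x in eq
    ... | true  = refl
    ... | false = cong (λ d → 1ℤ *ᶻ pos d) (nl-false G eq)

-- The threshold is 6 = 4 + 2: with at most two nonleaf neighbours such a vertex claims four leaves
-- of its own, so even twice the number of these vertices is at most half the number of leaves.
bigᵇ : Graph n → Fin n → Bool
bigᵇ G v = does (6 ≤? degree G v)

big-leafNbrs : (G : Graph n) → ThreeFree G → ∀ v → 4 * boolToℕ (bigᵇ G v) ≤ leafNbrs G v
big-leafNbrs G tf v with 6 ≤? degree G v
... | no 6≰ rewrite dec-false (6 ≤? degree G v) 6≰ = z≤n
... | yes 6≤ rewrite dec-true (6 ≤? degree G v) 6≤ = ℕₚ.+-cancelˡ-≤ 2 4 (leafNbrs G v) (ℕₚ.≤-trans 6≤
  (ℕₚ.≤-trans (ℕₚ.≤-reflexive (count-split (adj G v) (nl G))) (ℕₚ.+-monoˡ-≤ (leafNbrs G v) (count-≤2 (nlNbr G v) (tf v)))))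

big-count : (G : Graph n) → ThreeFree G → 4 * countTrue (bigᵇ G) + countTrue (nl G) ≤ n
big-count {n} G tf = ℕₚ.≤-trans (ℕₚ.+-monoˡ-≤ (countTrue (nl G)) (ℤₚ.drop‿+≤+ bound))
  (ℕₚ.≤-reflexive (trans (ℕₚ.+-comm (countTrue (not ∘ nl G)) _)
    (trans (sym (count-split (λ _ → true) (nl G))) (count-all n))))
  where
  bound : pos (4 * countTrue (bigᵇ G)) ≤ᶻ pos (countTrue (not ∘ nl G))
  bound = subst₂ _≤ᶻ_
    (trans (sum-cong-≗ λ v → ℤₚ.pos-* 4 (boolToℕ (bigᵇ G v)))
      (trans (sym (*-distribˡ-sum (pos 4) (ind ∘ bigᵇ G)))
        (trans (cong (pos 4 *ᶻ_) (sum-ind (bigᵇ G))) (sym (ℤₚ.pos-* 4 (countTrue (bigᵇ G)))))))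
    (sum-leafNbrs G)
    (sum-mono {f = λ v → pos (4 * boolToℕ (bigᵇ G v))} λ v → ℤ.+≤+ (big-leafNbrs G tf v))

-- A vertex of degree at least 6 has four leaves, so the entries from 6 on number at most (n − k) / 4, where
-- k is the length of the spine; listing the small values once is what keeps the loss additive.
nlDegrees : Graph n → List ℕ
nlDegrees {n} G = 2 ∷ 3 ∷ 4 ∷ 5 ∷ map (degree G) (filter (λ v → 6 ≤? degree G v) (allFin n))

length-filter-tabulate : {A : Set} {P : A → Set} (P? : ∀ a → Dec (P a)) (f : Fin n → A) →
  length (filter P? (tabulate f)) ≡ countTrue (λ x → does (P? (f x)))
length-filter-tabulate {zero}  P? f = refl
length-filter-tabulate {suc n} P? f with does (P? (f zero))
... | true  = cong suc (length-filter-tabulate P? (f ∘ suc))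
... | false = length-filter-tabulate P? (f ∘ suc)

length-nlDegrees : (G : Graph n) → length (nlDegrees G) ≡ 4 + countTrue (bigᵇ G)
length-nlDegrees {n} G = cong (4 +_) (trans
  (Listₚ.length-map (degree G) (filter (λ v → 6 ≤? degree G v) (allFin n)))
  (length-filter-tabulate (λ v → 6 ≤? degree G v) id))

1∉nlDegrees : (G : Graph n) → ¬ 1 ∈ nlDegrees G
1∉nlDegrees {n} G (there (there (there (there 1∈)))) with ∈ₚ.∈-map⁻ (degree G) 1∈
... | v , v∈ , eq with subst (6 ≤_) (sym eq) (proj₂ (∈ₚ.∈-filter⁻ (λ v → 6 ≤? degree G v) {xs = allFin n} v∈))
... | s≤s ()

0∉nlDegrees : (G : Graph n) → (∀ v → 1 ≤ degree G v) → ¬ 0 ∈ nlDegrees G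
0∉nlDegrees G deg≥1 (there (there (there (there 0∈)))) with ∈ₚ.∈-map⁻ (degree G) 0∈
... | v , _ , eq = ℕₚ.<⇒≢ (deg≥1 v) eq

degree-∈ : (G : Graph n) → (∀ v → 1 ≤ degree G v) → ∀ {v} → nl G v ≡ true → degree G v ∈ nlDegrees G
degree-∈ G deg≥1 {v} nlv with 6 ≤? degree G v
... | yes 6≤ = there (there (there (there (∈ₚ.∈-map⁺ (degree G) (∈ₚ.∈-filter⁺ (λ v → 6 ≤? degree G v) (∈ₚ.∈-allFin v) 6≤)))))
... | no 6≰ = small (degree G v) (deg≥1 v) (nl-degree G nlv) (ℕₚ.≰⇒> 6≰)
  where
  small : ∀ d → 1 ≤ d → d ≢ 1 → d < 6 → d ∈ nlDegrees G
  small 1 _ d≢1 _ = contradiction refl d≢1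
  small 2 _ _ _ = here refl
  small 3 _ _ _ = there (here refl)
  small 4 _ _ _ = there (there (here refl))
  small 5 _ _ _ = there (there (there (here refl)))
  small (suc (suc (suc (suc (suc (suc _)))))) _ _ (s≤s (s≤s (s≤s (s≤s (s≤s (s≤s ()))))))

-- Reading off the spine degrees from both ends

NonZeroAt : Graph n → Factors j → Vec (Fin n) j → Set
NonZeroAt X L t = ∀ {i c} → (i , c) ∈ L → pos (degree X (lookup t i)) ≢ c

bothEnds : Factors (suc r) → Factors (suc r)
bothEnds {r} rest = (zero , 1ℤ) ∷ (fromℕ r , 1ℤ) ∷ rest

ind-true : ∀ {b} → ind b ≢ 0ℤ → b ≡ true
ind-true {true}  _  = refl
ind-true {false} ≢0 = contradiction refl ≢0

nl-true : (X : Graph n) {v : Fin n} → degree X v ≢ 1 → nl X v ≡ true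
nl-true X {v} d≢1 with nl X v in eq
... | true  = refl
... | false = contradiction (nl-false X eq) d≢1

module _ (X : Graph n) (tf : ThreeFree X) (rest : Factors (suc r)) where

  private
    L = bothEnds rest

  ν≤2 : ∀ v → ν X v ≤ 2
  ν≤2 v = count-≤2 (nlNbr X v) (tf v)

  -- Three-freeness gives ν ≤ 2, so 2 - ν is nonnegative as it stands and only the linear factors
  -- have to be doubled.
  endTerm-nonNeg : ∀ t → 0ℤ ≤ᶻ endTerm X (L ++ L) t
  endTerm-nonNeg t = *-nonNeg (count-weight-nonNeg (pathᵇ X t) X L t)
    (ℤₚ.i≤j⇒0≤j-i (ℤ.+≤+ (ν≤2 (lookup t zero))))

  endTerm⇒endPath : ∀ t → endTerm X (L ++ L) t ≢ 0ℤ → EndPath X t × NonZeroAt X rest t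
  endTerm⇒endPath t ≢0 = (isPath , first , last , ν≤1) , λ i∈ → nonzero (there (there i∈))
    where
    isPath : pathᵇ X t ≡ true
    isPath = ind-true (*-≢0ˡ (*-≢0ˡ ≢0))
    nonzero : NonZeroAt X L t
    nonzero {i} i∈ refl = *-≢0ʳ {path X t} (*-≢0ˡ ≢0) (lin-vanish X {L ++ L} {t} (∈ₚ.∈-++⁺ˡ i∈) refl)
    first : nl X (lookup t zero) ≡ true
    first = nl-true X (nonzero (here refl) ∘ cong pos)
    last : nl X (lookup t (fromℕ _)) ≡ true
    last = nl-true X (nonzero (there (here refl)) ∘ cong pos)
    ν≤1 : ν X (lookup t zero) ≤ 1
    ν≤1 with below-suc (s≤s (ν≤2 (lookup t zero)))
    ... | inj₁ ν<2 = ℕₚ.≤-pred ν<2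
    ... | inj₂ ν≡2 = contradiction (cong (λ d → 2ℤ -ᶻ pos d) ν≡2)
      (*-≢0ʳ {path X t *ᶻ lin X (L ++ L) t} ≢0)

  endPath⇒endTerm : ∀ t → EndPath X t → NonZeroAt X rest t → endTerm X (L ++ L) t ≢ 0ℤ
  endPath⇒endTerm t (isPath , first , last , ν≤1) nonzero = *-≢0 (*-≢0 path≢0
      (λ eq → lin-≢0 X {L} {t} nonzero′ (lin-square-zero X L {t} eq)))
      (λ eq → ℕₚ.<⇒≢ (s≤s ν≤1) (sym (ℤₚ.+-injective (ℤₚ.i-j≡0⇒i≡j 2ℤ (pos (ν X (lookup t zero))) eq))))
    where
    path≢0 : path X t ≢ 0ℤ
    path≢0 eq = true≢false isPath (ind-zero eq)
    nonzero′ : NonZeroAt X L t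
    nonzero′ (here refl)         = nl-degree X first ∘ ℤₚ.+-injective
    nonzero′ (there (here refl)) = nl-degree X last ∘ ℤₚ.+-injective
    nonzero′ (there (there i∈))  = nonzero i∈

abstract
  -- The given path makes the sum for X positive, so the equal sum for Y has a nonzero term. Through
  -- `rest` one prescribes degrees to be avoided at chosen positions; this is how degree sequences
  -- are told apart.
  endPath-transfer : (X Y : Graph n) → ThreeFree X → ThreeFree Y → (rest : Factors (suc r)) →
    endSum X (bothEnds rest ++ bothEnds rest) ≡ endSum Y (bothEnds rest ++ bothEnds rest) →
    ∀ t → EndPath X t → NonZeroAt X rest t → ∃ λ t′ → EndPath Y t′ × NonZeroAt Y rest t′
  endPath-transfer {r = r} X Y tfX tfY rest eq t ep nonzero =
    let t′ , ≢0 = sumV-witness (suc r) (endTerm Y (bothEnds rest ++ bothEnds rest)) λ zeroY →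
          endPath⇒endTerm X tfX rest t ep nonzero
            (sumV-all-zero (suc r) (endTerm-nonNeg X tfX rest) (trans eq zeroY) t)
    in t′ , endTerm⇒endPath Y tfY rest t′ ≢0

SameWord : (X Y : Graph n) → Vec (Fin n) j → Vec (Fin n) j → Set
SameWord X Y s t = ∀ i → degree X (lookup s i) ≡ degree Y (lookup t i)

sameWord? : (X Y : Graph n) (s t : Vec (Fin n) j) →
  SameWord X Y s t ⊎ ∃ λ i → degree X (lookup s i) ≢ degree Y (lookup t i)
sameWord? {j = j} X Y s t with all? (λ i → degree X (lookup s i) ℕₚ.≟ degree Y (lookup t i))
... | yes same = inj₁ same
... | no ¬same = inj₂ (¬∀⟶∃¬ j _ (λ i → degree X (lookup s i) ℕₚ.≟ degree Y (lookup t i)) ¬same)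

half-bound : ∀ k → k ≤ suc (⌊ k /2⌋ + ⌊ k /2⌋)
half-bound zero          = z≤n
half-bound (suc zero)    = s≤s z≤n
half-bound (suc (suc k)) = s≤s (s≤s (subst (k ≤_) (sym (ℕₚ.+-suc ⌊ k /2⌋ ⌊ k /2⌋)) (half-bound k)))

half-double : ∀ k → ⌊ k /2⌋ + ⌊ k /2⌋ ≤ k
half-double zero          = z≤n
half-double (suc zero)    = z≤n
half-double (suc (suc k)) = s≤s (subst (_≤ suc k) (sym (ℕₚ.+-suc ⌊ k /2⌋ ⌊ k /2⌋)) (s≤s (half-double k)))

halve : ∀ {a ℓ} → a + a ≤ 2 * ℓ → a ≤ ℓ
halve {a} {ℓ} a+a≤ = ℕₚ.*-cancelˡ-≤ 2 (subst (_≤ 2 * ℓ) (cong (_+_ a) (sym (ℕₚ.+-identityʳ a))) a+a≤)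

-- Segments of h + 1 vertices from both ends cover the k + 1 spine vertices because k ≤ 2h + 1. In
-- `cost-ends`, 8 pays for four factors taken twice, |V| for one nonleaf condition, and h + 2 for
-- the path with an extra neighbour of its first vertex.
module Reconstruct {ℓ} (H G : Graph n) (deck : SameDeck ℓ H G) (ℓ≤n : ℓ ≤ n)
  (V : List ℕ) (1∉V : ¬ 1 ∈ V) (0∉V : ¬ 0 ∈ V) (degG : ∀ {v} → nl G v ≡ true → degree G v ∈ V)
  {k} {p : ℕ → Fin n} (S : Spine G (suc k) p)
  (h : ℕ) (h≤k : h ≤ k) (half : k ≤ suc (h + h)) (10≤ℓ : 10 ≤ ℓ)
  (cost-degrees : 2 * suc (length V) + 1 ≤ ℓ) (cost-ends : 8 + length V + suc (suc h) ≤ ℓ) where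

  private
    tfG : ThreeFree G
    tfG = spine-threeFree S

    cost-pairs : 2 * length V + 2 ≤ ℓ
    cost-pairs = ℕₚ.≤-trans (subst (2 * length V + 2 ≤_) (sym (expand (length V))) (ℕₚ.m≤m+n _ 1)) cost-degrees
      where
      expand : ∀ v → 2 * suc v + 1 ≡ 2 * v + 2 + 1
      expand = ℕ-Solver.solve-∀

    cost-core : suc h ≤ ℓ
    cost-core = ℕₚ.≤-trans (ℕₚ.≤-trans (ℕₚ.n≤1+n (suc h)) (ℕₚ.m≤n+m (suc (suc h)) (8 + length V))) cost-ends

    degG′ : ∀ v → degree G v ∈ 1 ∷ V
    degG′ v with nl G v in eq
    ... | true  = there (degG eq)
    ... | false = here (nl-false G eq)

    degH′ : ∀ v → degree H v ∈ 1 ∷ V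
    degH′ = degrees-transfer H G deck ℓ≤n (1 ∷ V) cost-degrees degG′

    degH : ∀ {v} → nl H v ≡ true → degree H v ∈ V
    degH {v} nlv with degH′ v
    ... | here eq  = contradiction eq (nl-degree H nlv)
    ... | there d∈ = d∈

    deg≥1H : ∀ v → 1 ≤ degree H v
    deg≥1H v with degree H v | degH′ v
    ... | zero  | there 0∈ = contradiction 0∈ 0∉V
    ... | suc _ | _        = s≤s z≤n

    tfH : ThreeFree H
    tfH = threeFree-transfer H G deck ℓ≤n 10≤ℓ tfG

    open Transferred V 1∉V H G deck ℓ≤n degH degG cost-pairs

    ends-≡ : (rest : Factors (suc h)) → length rest ≤ 2 →
      endSum H (bothEnds rest ++ bothEnds rest) ≡ endSum G (bothEnds rest ++ bothEnds rest)
    ends-≡ rest ≤2 = endSum-≡ (bothEnds rest ++ bothEnds rest) (ℕₚ.≤-trans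
      (ℕₚ.+-monoˡ-≤ (suc (suc h)) (ℕₚ.+-monoˡ-≤ (length V)
        (subst (_≤ 8) (sym (length-double (bothEnds rest))) (ℕₚ.*-monoʳ-≤ 2 (s≤s (s≤s ≤2)))))) cost-ends)

    G⇒H : (rest : Factors (suc h)) → length rest ≤ 2 →
      ∀ t → EndPath G t → NonZeroAt G rest t → ∃ λ t′ → EndPath H t′ × NonZeroAt H rest t′
    G⇒H rest ≤2 = endPath-transfer G H tfG tfH rest (sym (ends-≡ rest ≤2))

    H⇒G : (rest : Factors (suc h)) → length rest ≤ 2 →
      ∀ t → EndPath H t → NonZeroAt H rest t → ∃ λ t′ → EndPath G t′ × NonZeroAt G rest t′
    H⇒G rest ≤2 = endPath-transfer H G tfH tfG rest (ends-≡ rest ≤2)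

    front back : Vec (Fin n) (suc h)
    front = seg p 0 (suc h)
    back  = seg (rev (suc k) p) 0 (suc h)

    front-end : EndPath G front
    front-end = seg-endPath (spine-trail S (s≤s z≤n)) h (s≤s h≤k)

    back-end : EndPath G back
    back-end = seg-endPath (spine-trail (Spine-rev S) (s≤s z≤n)) h (s≤s h≤k)

    differ : ∀ (X Y : Graph n) {s t : Vec (Fin n) (suc h)} {i} → degree X (lookup s i) ≢ degree Y (lookup t i) →
      NonZeroAt X ((i , pos (degree Y (lookup t i))) ∷ []) s
    differ X Y ne (here refl) eq = ne (ℤₚ.+-injective eq)

    -- If t differed from both words, one position of difference for each would give two factors
    -- that are nonzero on t but kill both end paths of G.
    dichotomy : ∀ t → EndPath H t → SameWord H G t front ⊎ SameWord H G t back
    dichotomy t ep with sameWord? H G t front | sameWord? H G t back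
    ... | inj₁ same    | _            = inj₁ same
    ... | inj₂ _       | inj₁ same    = inj₂ same
    ... | inj₂ (i , ne) | inj₂ (i′ , ne′) with H⇒G ((i , pos (degree G (lookup front i))) ∷ (i′ , pos (degree G (lookup back i′))) ∷ [])
                                              (s≤s (s≤s z≤n)) t ep nonzero
      where
      nonzero : NonZeroAt H ((i , pos (degree G (lookup front i))) ∷ (i′ , pos (degree G (lookup back i′))) ∷ []) t
      nonzero (here refl)         = ne ∘ ℤₚ.+-injective
      nonzero (there (here refl)) = ne′ ∘ ℤₚ.+-injective
    ... | t′ , ep′ , nonzero with endPath-spine S t′ ep′
    ... | inj₁ refl = contradiction refl (nonzero (here refl))
    ... | inj₂ refl = contradiction refl (nonzero (there (here refl)))

    -- If the two words of G agree, any end path of H will do. Otherwise a position where they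
    -- differ gives a factor that excludes the back word, and the dichotomy leaves the front word.
    front-in-H : ∃ λ t → EndPath H t × SameWord H G t front
    front-in-H with sameWord? G G front back
    ... | inj₁ same with G⇒H [] z≤n front front-end (λ ())
    ...   | t , ep , _ with dichotomy t ep
    ...     | inj₁ w = t , ep , w
    ...     | inj₂ w = t , ep , λ i → trans (w i) (sym (same i))
    front-in-H | inj₂ (i , ne) with G⇒H _ (s≤s z≤n) front front-end (differ G G {front} {back} {i} ne)
    ...   | t , ep , nonzero with dichotomy t ep
    ...     | inj₁ w = t , ep , w
    ...     | inj₂ w = contradiction (cong pos (w i)) (nonzero (here refl))

    -- Suppose that the other end of H reads the front word too. Unless the two words coincide, a
    -- factor that kills the front word still leaves an end path in H, yet both end paths of H read
    -- the front word.
    back-in-H : ∀ {q} → Spine H (suc k) q → SameWord H G (seg q 0 (suc h)) front →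
      SameWord H G (seg (rev (suc k) q) 0 (suc h)) back
    back-in-H {q} SH fr with dichotomy (seg (rev (suc k) q) 0 (suc h)) (seg-endPath (spine-trail (Spine-rev SH) (s≤s z≤n)) h (s≤s h≤k))
    ... | inj₂ w = w
    ... | inj₁ w with sameWord? G G back front
    ...   | inj₁ same = λ i → trans (w i) (sym (same i))
    ...   | inj₂ (i , ne) with G⇒H _ (s≤s z≤n) back back-end (differ G G {back} {front} {i} ne)
    ...     | t , ep , nonzero with endPath-spine SH t ep
    ...       | inj₁ refl = contradiction (cong pos (fr i)) (nonzero (here refl))
    ...       | inj₂ refl = contradiction (cong pos (w i)) (nonzero (here refl))

    word-at : ∀ {q q′ : ℕ → Fin n} → SameWord H G (seg q 0 (suc h)) (seg q′ 0 (suc h)) →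
      ∀ i → i < suc h → degree H (q i) ≡ degree G (q′ i)
    word-at {q} {q′} w i i<h = subst₂ (λ u v → degree H u ≡ degree G v) (at q) (at q′) (w (fromℕ< i<h))
      where
      at : ∀ (s : ℕ → Fin n) → lookup (seg s 0 (suc h)) (fromℕ< i<h) ≡ s i
      at s = trans (seg-lookup s 0 (suc h) (fromℕ< i<h)) (cong s (Finₚ.toℕ-fromℕ< i<h))

    beyond-half : ∀ {i} → ¬ i < suc h → i < suc k → suc k ∸ suc i < suc h
    beyond-half {i} i≮h i<k = s≤s (ℕₚ.m≤n+o⇒m∸n≤o k i (ℕₚ.≤-trans half (ℕₚ.+-monoˡ-≤ h (ℕₚ.≮⇒≥ i≮h))))

    degrees-agree : ∀ {q} → Spine H (suc k) q → SameWord H G (seg q 0 (suc h)) front →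
      ∀ i → i < suc k → degree H (q i) ≡ degree G (p i)
    degrees-agree {q} SH fr i i<k with i <? suc h
    ... | yes i<h = word-at fr i i<h
    ... | no i≮h  = subst₂ (λ a c → degree H (q a) ≡ degree G (p c)) (rev-rev i<k) (rev-rev i<k)
      (word-at (back-in-H SH fr) (suc k ∸ suc i) (beyond-half i≮h i<k))

  reconstruct : Iso H G
  reconstruct with front-in-H
  ... | t , ep , w with endPath-extend tfH t ep
  ... | suc k′ , q , h<k′ , T , closed , agree =
    spine-iso SH S (degrees-agree SH λ i → trans (cong (degree H) (at i)) (w i))
    where
    -- The trail has at least h + 1 vertices, so at most h + 1 of the k + 1 nonleaves lie off it.
    short : k ∸ k′ ≤ ℓ
    short = ℕₚ.≤-trans (ℕₚ.m≤n+o⇒m∸n≤o k k′ (ℕₚ.≤-trans half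
      (subst (suc (h + h) ≤_) (ℕₚ.+-comm (suc h) k′) (s≤s (ℕₚ.+-monoʳ-≤ h (ℕₚ.≤-pred h<k′)))))) cost-core
    k≡k′ : k ≡ k′
    k≡k′ = trail-length deck ℓ≤n S tfH T closed nl-count-≡ excess-≡ short
    SH : Spine H (suc k) q
    SH = subst (λ a → Spine H (suc a) q) (sym k≡k′)
      (trail-spine tfH T (trail-covers deck ℓ≤n S tfH T closed nl-count-≡ excess-≡ short)
        (leaf-nl (spine-leaf-nl S)) deg≥1H)
    at : ∀ i → lookup (seg q 0 (suc h)) i ≡ lookup t i
    at i = trans (seg-lookup q 0 (suc h) i) (trans (agree (Finₚ.toℕ<n i)) (nth-lookup t i))

-- With b vertices of degree at least 6, the inequality 4b + (k + 1) ≤ n gives 2ℓ ≥ 4b + k + 41.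
-- Twice the main costs are 4b + 22 and 2b + 2h + 28 with 2h ≤ k. The second is the tighter one and
-- would be satisfied by 27 in place of 40.
caterpillar-reconstruct : ∀ {ℓ} (H G : Graph n) → SameDeck ℓ H G → ℓ ≤ n → n + 40 ≤ 2 * ℓ →
  ∀ {k p} → Spine G (suc k) p → (∀ v → 1 ≤ degree G v) → Iso H G
caterpillar-reconstruct {n} {ℓ} H G deck ℓ≤n bound {k} {p} S deg≥1 = Reconstruct.reconstruct H G deck ℓ≤n
  (nlDegrees G) (1∉nlDegrees G) (0∉nlDegrees G deg≥1) (degree-∈ G deg≥1) S
  h (ℕₚ.⌊n/2⌋≤n k) (half-bound k) (within 10 (ℕₚ.≤-trans (ℕₚ.m≤n+m 20 20) (ℕₚ.m≤n+m 40 _)))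
  cost-degrees cost-ends
  where
  b = countTrue (bigᵇ G)
  h = ⌊ k /2⌋

  big-bound : 4 * b + suc k ≤ n
  big-bound = subst (λ a → 4 * b + a ≤ n) (spine-count S) (big-count G (spine-threeFree S))

  within : ∀ a → a + a ≤ 4 * b + suc k + 40 → a ≤ ℓ
  within a le = halve (ℕₚ.≤-trans le (ℕₚ.≤-trans (ℕₚ.+-monoˡ-≤ 40 big-bound) bound))

  cost-degrees : 2 * suc (length (nlDegrees G)) + 1 ≤ ℓ
  cost-degrees = subst (λ v → 2 * suc v + 1 ≤ ℓ) (sym (length-nlDegrees G)) (within (2 * suc (4 + b) + 1)
    (subst₂ _≤_ (sym (lhs b)) (sym (rhs b k)) (ℕₚ.m≤m+n (4 * b + 22) (k + 19))))
    where
    lhs : ∀ b → 2 * suc (4 + b) + 1 + (2 * suc (4 + b) + 1) ≡ 4 * b + 22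
    lhs = ℕ-Solver.solve-∀
    rhs : ∀ b k → 4 * b + suc k + 40 ≡ 4 * b + 22 + (k + 19)
    rhs = ℕ-Solver.solve-∀

  cost-ends : 8 + length (nlDegrees G) + suc (suc h) ≤ ℓ
  cost-ends = subst (λ v → 8 + v + suc (suc h) ≤ ℓ) (sym (length-nlDegrees G)) (within (8 + (4 + b) + suc (suc h))
    (subst₂ _≤_ (sym (lhs b h)) (sym (rhs b k))
      (ℕₚ.≤-trans (ℕₚ.+-monoˡ-≤ 28 (ℕₚ.+-monoʳ-≤ (2 * b) (half-double k))) (ℕₚ.m≤m+n (2 * b + k + 28) (2 * b + 13)))))
    where
    lhs : ∀ b h → 8 + (4 + b) + suc (suc h) + (8 + (4 + b) + suc (suc h)) ≡ 2 * b + (h + h) + 28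
    lhs = ℕ-Solver.solve-∀
    rhs : ∀ b k → 4 * b + suc k + 40 ≡ 2 * b + k + 28 + (2 * b + 13)
    rhs = ℕ-Solver.solve-∀

theorem1p1 : Σ ℕ λ C → ∀ (n : ℕ) (G : Graph n) → IsCaterpillar G →
    ∀ (ℓ : ℕ) → n + 2 * C ≤ 2 * ℓ → ℓ ≤ n →
    ∀ (m : ℕ) (H : Graph m) → SameDeck ℓ H G → Iso H G
theorem1p1 = 20 , main
  where
  large : ∀ {n ℓ} → n + 40 ≤ 2 * ℓ → ℓ ≤ n → 40 ≤ n
  large {n} {ℓ} bound ℓ≤n = ℕₚ.+-cancelˡ-≤ n 40 n
    (ℕₚ.≤-trans bound (ℕₚ.≤-trans (ℕₚ.*-monoʳ-≤ 2 ℓ≤n) (ℕₚ.≤-reflexive (cong (_+_ n) (ℕₚ.+-identityʳ n)))))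
  main : ∀ (n : ℕ) (G : Graph n) → IsCaterpillar G → ∀ (ℓ : ℕ) → n + 40 ≤ 2 * ℓ → ℓ ≤ n →
    ∀ (m : ℕ) (H : Graph m) → SameDeck ℓ H G → Iso H G
  main n G cat ℓ bound ℓ≤n m H deck = equal-order m (same-order 1≤ℓ ℓ≤n (proj₁ deck)) H deck
    where
    1≤ℓ : 1 ≤ ℓ
    1≤ℓ = halve (ℕₚ.≤-trans (ℕₚ.≤-trans (s≤s (s≤s z≤n)) (ℕₚ.m≤n+m 40 n)) bound)
    equal-order : ∀ m → m ≡ n → (H : Graph m) → SameDeck ℓ H G → Iso H G
    equal-order .n refl H deck =
      let k , p , S , deg≥1 = caterpillar-spine G cat (ℕₚ.≤-trans (s≤s (s≤s (s≤s z≤n))) (large bound ℓ≤n))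
      in caterpillar-reconstruct H G deck ℓ≤n bound S deg≥1
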